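{- Let $G$ be a simple connected graph with $n\geq 4$ vertices whose chromatic number $\chi$ satisfies $\frac{n}{2}\leq \chi\leq n-1$, and suppose that the complement of $G$ is disconnected. Then $DLS(G)\geq 2$, with equality if and only if $$G\cong K_{\underbrace{2,2,\dots,2}_{n-\chi},\underbrace{1,1,\dots,1}_{2\chi-n}}.$$
   Context: All graphs are finite, simple and connected (complements may be disconnected). $K_{l_1,\dots,l_k}$ denotes the complete $k$-partite graph with independent classes of cardinalities $l_1,\dots,l_k$; here the graph has $n-\chi$ classes of size $2$ and $2\chi-n$ classes of size $1$. For a connected graph $G$ on vertices $v_1,\dots,v_n$, $d_{uv}$ denotes the distance (length of a shortest path) between $u$ and $v$, and $D(G)=(d_{uv})$ is the distance matrix. The transmission of a vertex $v$ is $Tr(v)=\sum_{u\in V(G)}d_{uv}$. The distance Laplacian matrix is $D^L(G)=\mathrm{diag}(Tr(v_1),\dots,Tr(v_n))-D(G)$; it is positive semidefinite, and its eigenvalues, with multiplicity, are written $\partial_1^L(G)\ge \partial_2^L(G)\ge\dots\ge\partial_n^L(G)=0$. The distance Laplacian spread is $DLS(G)=\partial_1^L(G)-\partial_{n-1}^L(G)$. -}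

module Defs where

open import Algebra.Bundles using (CommutativeMonoid)
open import Algebra.Bundles.Raw using (RawRing)
import Algebra.Definitions.RawSemiring as RawSemiringDefinitions
import Algebra.Properties.CommutativeSemigroup as CommutativeSemigroupProperties
open import Data.Fin as Fin using (Fin; zero; suc; toℕ; fromℕ; inject₁; punchIn)
open import Data.Fin.Properties using (any?) renaming (_≟_ to _≟ᶠ_)
open import Data.Integer as ℤ using (ℤ; +_)
open import Data.List as List using (List)
open import Data.Nat as ℕ using (ℕ; zero; suc; z≤n; s≤s)
import Data.Nat.Properties as ℕP
open import Data.Product using (Σ; Σ-syntax; ∃; _×_; _,_; proj₁; proj₂)
open import Data.Rational as ℚ using (ℚ; 0ℚ; 1ℚ; ½; ∣_∣)
import Data.Rational.Properties as ℚP
open import Data.Vec.Functional as Vector using (Vector)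
open import Function using (_∘_)
open import Function.Bundles using (_↔_; _⇔_; Inverse)
open import Level using (0ℓ)
open import Relation.Binary.Definitions using (Decidable)
open import Relation.Binary.PropositionalEquality using (_≡_; _≢_; refl; sym; trans; cong; cong₂; subst)
open import Relation.Nullary using (Dec; yes; no; ¬_; ¬?; _×-dec_; contradiction)

-- Reals are Cauchy sequences of rationals, compared by _≈ᴿ_ rather than _≡_.
IsCauchy : (ℕ → ℚ) → Set
IsCauchy a =
  ∀ ε → 0ℚ ℚ.< ε →
  Σ[ N ∈ ℕ ] (∀ m n → N ℕ.≤ m → N ℕ.≤ n → ∣ a m ℚ.- a n ∣ ℚ.< ε)

record ℝ : Set where
  constructor mkℝ
  field
    seq    : ℕ → ℚ
    cauchy : IsCauchy seq

open ℝ public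

infix 4 _≈ᴿ_ _≤ᴿ_

record _≈ᴿ_ (x y : ℝ) : Set where
  constructor mk≈
  field
    eventually≈ :
      ∀ ε → 0ℚ ℚ.< ε →
      Σ[ N ∈ ℕ ] (∀ n → N ℕ.≤ n → ∣ seq x n ℚ.- seq y n ∣ ℚ.< ε)

-- The slack ε is needed: the sequence of x may stay above that of y while
-- both have the same limit.
record _≤ᴿ_ (x y : ℝ) : Set where
  constructor mk≤
  field
    eventually≤ :
      ∀ ε → 0ℚ ℚ.< ε →
      Σ[ N ∈ ℕ ] (∀ n → N ℕ.≤ n → seq x n ℚ.< seq y n ℚ.+ ε)

open _≈ᴿ_ public
open _≤ᴿ_ public

fromℚ : ℚ → ℝ
fromℚ q = mkℝ (λ _ → q) λ ε 0<ε →
  0 , λ _ _ _ _ → subst (ℚ._< ε) (sym (cong ∣_∣ (ℚP.+-inverseʳ q))) 0<ε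

fromℤ : ℤ → ℝ
fromℤ z = fromℚ (z ℚ./ 1)

private
  half-pos : ∀ {ε} → 0ℚ ℚ.< ε → 0ℚ ℚ.< ½ ℚ.* ε
  half-pos {ε} 0<ε = subst (ℚ._< ½ ℚ.* ε) (ℚP.*-zeroʳ ½) (ℚP.*-monoʳ-<-pos ½ 0<ε)

  half+half : ∀ ε → ½ ℚ.* ε ℚ.+ ½ ℚ.* ε ≡ ε
  half+half ε = trans (sym (ℚP.*-distribʳ-+ ε ½ ½)) (ℚP.*-identityˡ ε)

  +-cauchy : ∀ a b → IsCauchy a → IsCauchy b → IsCauchy (λ n → a n ℚ.+ b n)
  +-cauchy a b ca cb ε 0<ε with ca (½ ℚ.* ε) (half-pos 0<ε) | cb (½ ℚ.* ε) (half-pos 0<ε)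
  ... | M , p | N , q = M ℕ.⊔ N , λ m n K≤m K≤n → begin-strict
    ∣ (a m ℚ.+ b m) ℚ.- (a n ℚ.+ b n) ∣
      ≡⟨ cong ∣_∣ (rearrange (a m) (b m) (a n) (b n)) ⟩
    ∣ (a m ℚ.- a n) ℚ.+ (b m ℚ.- b n) ∣
      ≤⟨ ℚP.∣p+q∣≤∣p∣+∣q∣ (a m ℚ.- a n) (b m ℚ.- b n) ⟩
    ∣ a m ℚ.- a n ∣ ℚ.+ ∣ b m ℚ.- b n ∣
      <⟨ ℚP.+-mono-<
           (p m n (ℕP.m⊔n≤o⇒m≤o M N K≤m) (ℕP.m⊔n≤o⇒m≤o M N K≤n))
           (q m n (ℕP.m⊔n≤o⇒n≤o M N K≤m) (ℕP.m⊔n≤o⇒n≤o M N K≤n)) ⟩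
    ½ ℚ.* ε ℚ.+ ½ ℚ.* ε
      ≡⟨ half+half ε ⟩
    ε ∎
    where
    open ℚP.≤-Reasoning
    rearrange : ∀ w x y z → (w ℚ.+ x) ℚ.- (y ℚ.+ z) ≡ (w ℚ.- y) ℚ.+ (x ℚ.- z)
    rearrange w x y z =
      trans (cong ((w ℚ.+ x) ℚ.+_) (ℚP.neg-distrib-+ y z)) (interchange w x (ℚ.- y) (ℚ.- z))
      where
      open CommutativeSemigroupProperties
        (CommutativeMonoid.commutativeSemigroup ℚP.+-0-commutativeMonoid)

  neg-cauchy : ∀ a → IsCauchy a → IsCauchy (λ n → ℚ.- a n)
  neg-cauchy a ca ε 0<ε with ca ε 0<ε
  ... | N , p = N , λ m n N≤m N≤n →
    subst (ℚ._< ε) (trans (sym (ℚP.∣-p∣≡∣p∣ (a m ℚ.- a n))) (cong ∣_∣ (ℚP.neg-distrib-+ (a m) (ℚ.- a n))))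
      (p m n N≤m N≤n)

  p≡[p-q]+q : ∀ p q → p ≡ (p ℚ.- q) ℚ.+ q
  p≡[p-q]+q p q = sym (trans (ℚP.+-assoc p (ℚ.- q) q)
    (trans (cong (p ℚ.+_) (ℚP.+-inverseˡ q)) (ℚP.+-identityʳ p)))

  eventually-bounded : ∀ a → IsCauchy a →
    Σ[ B ∈ ℚ ] Σ[ N ∈ ℕ ] (0ℚ ℚ.< B × (∀ n → N ℕ.≤ n → ∣ a n ∣ ℚ.< B))
  eventually-bounded a ca with ca 1ℚ (ℚP.positive⁻¹ 1ℚ)
  ... | N , p = 1ℚ ℚ.+ ∣ a N ∣ , N
    , ℚP.<-≤-trans (ℚP.positive⁻¹ 1ℚ)
        (subst (ℚ._≤ 1ℚ ℚ.+ ∣ a N ∣) (ℚP.+-identityʳ 1ℚ) (ℚP.+-monoʳ-≤ 1ℚ (ℚP.0≤∣p∣ (a N))))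
    , λ n N≤n → begin-strict
        ∣ a n ∣                             ≡⟨ cong ∣_∣ (p≡[p-q]+q (a n) (a N)) ⟩
        ∣ (a n ℚ.- a N) ℚ.+ a N ∣           ≤⟨ ℚP.∣p+q∣≤∣p∣+∣q∣ (a n ℚ.- a N) (a N) ⟩
        ∣ a n ℚ.- a N ∣ ℚ.+ ∣ a N ∣         <⟨ ℚP.+-monoˡ-< ∣ a N ∣ (p n N N≤n ℕP.≤-refl) ⟩
        1ℚ ℚ.+ ∣ a N ∣                      ∎
    where open ℚP.≤-Reasoning

  *-bound : ∀ {A δ} → 0ℚ ℚ.< A → ∀ p → ∣ p ∣ ℚ.< A → ∀ q → ∣ q ∣ ℚ.< δ → ∣ p ℚ.* q ∣ ℚ.< A ℚ.* δ
  *-bound {A} {δ} 0<A p p<A q q<δ = begin-strict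
    ∣ p ℚ.* q ∣        ≡⟨ ℚP.∣p*q∣≡∣p∣*∣q∣ p q ⟩
    ∣ p ∣ ℚ.* ∣ q ∣    ≤⟨ ℚP.*-monoʳ-≤-nonNeg ∣ q ∣ {{ℚP.∣-∣-nonNeg q}} (ℚP.<⇒≤ p<A) ⟩
    A ℚ.* ∣ q ∣        <⟨ ℚP.*-monoʳ-<-pos A {{ℚ.positive 0<A}} q<δ ⟩
    A ℚ.* δ            ∎
    where open ℚP.≤-Reasoning

  *-cauchy : ∀ a b → IsCauchy a → IsCauchy b → IsCauchy (λ n → a n ℚ.* b n)
  *-cauchy a b ca cb ε 0<ε with eventually-bounded a ca | eventually-bounded b cb
  ... | A , Nᵃ , 0<A , a<A | B , Nᵇ , 0<B , b<B = result
    where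
    0<C : 0ℚ ℚ.< A ℚ.+ B
    0<C = ℚP.+-mono-< 0<A 0<B

    instance
      posC : ℚ.Positive (A ℚ.+ B)
      posC = ℚ.positive 0<C
      nonZeroC : ℚ.NonZero (A ℚ.+ B)
      nonZeroC = ℚP.pos⇒nonZero (A ℚ.+ B)
      posε : ℚ.Positive ε
      posε = ℚ.positive 0<ε
      pos1/C : ℚ.Positive (ℚ.1/ (A ℚ.+ B))
      pos1/C = ℚP.1/pos⇒pos (A ℚ.+ B)

    δ : ℚ
    δ = ℚ.1/ (A ℚ.+ B) ℚ.* ε

    0<δ : 0ℚ ℚ.< δ
    0<δ = ℚP.positive⁻¹ δ {{ℚP.pos*pos⇒pos (ℚ.1/ (A ℚ.+ B)) ε}}

    Cδ≡ε : A ℚ.* δ ℚ.+ B ℚ.* δ ≡ ε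
    Cδ≡ε = trans (sym (ℚP.*-distribʳ-+ δ A B))
          (trans (sym (ℚP.*-assoc (A ℚ.+ B) (ℚ.1/ (A ℚ.+ B)) ε))
          (trans (cong (ℚ._* ε) (ℚP.*-inverseʳ (A ℚ.+ B))) (ℚP.*-identityˡ ε)))

    rearrange : ∀ w x y z → w ℚ.* x ℚ.- y ℚ.* z ≡ w ℚ.* (x ℚ.- z) ℚ.+ z ℚ.* (w ℚ.- y)
    rearrange w x y z = begin-equality
      w ℚ.* x ℚ.- y ℚ.* z
        ≡⟨ cong (ℚ._- y ℚ.* z) (p≡[p-q]+q (w ℚ.* x) (w ℚ.* z)) ⟩
      (w ℚ.* x ℚ.- w ℚ.* z) ℚ.+ w ℚ.* z ℚ.- y ℚ.* z
        ≡⟨ ℚP.+-assoc (w ℚ.* x ℚ.- w ℚ.* z) (w ℚ.* z) (ℚ.- (y ℚ.* z)) ⟩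
      (w ℚ.* x ℚ.- w ℚ.* z) ℚ.+ (w ℚ.* z ℚ.- y ℚ.* z)
        ≡⟨ cong₂ ℚ._+_ (factor w x z)
             (trans (cong₂ ℚ._-_ (ℚP.*-comm w z) (ℚP.*-comm y z)) (factor z w y)) ⟩
      w ℚ.* (x ℚ.- z) ℚ.+ z ℚ.* (w ℚ.- y) ∎
      where
      open ℚP.≤-Reasoning
      factor : ∀ p q r → p ℚ.* q ℚ.- p ℚ.* r ≡ p ℚ.* (q ℚ.- r)
      factor p q r = trans (cong (p ℚ.* q ℚ.+_) (ℚP.neg-distribʳ-* p r))
        (sym (ℚP.*-distribˡ-+ p q (ℚ.- r)))

    open ℚP.≤-Reasoning

    result : Σ[ N ∈ ℕ ] (∀ m n → N ℕ.≤ m → N ℕ.≤ n → ∣ a m ℚ.* b m ℚ.- a n ℚ.* b n ∣ ℚ.< ε)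
    result with ca δ 0<δ | cb δ 0<δ
    ... | M , p | N , q = (Nᵃ ℕ.⊔ Nᵇ) ℕ.⊔ (M ℕ.⊔ N) , λ m n K≤m K≤n →
      let Nᵃ≤m = ℕP.m⊔n≤o⇒m≤o Nᵃ Nᵇ (ℕP.m⊔n≤o⇒m≤o (Nᵃ ℕ.⊔ Nᵇ) (M ℕ.⊔ N) K≤m)
          Nᵇ≤n = ℕP.m⊔n≤o⇒n≤o Nᵃ Nᵇ (ℕP.m⊔n≤o⇒m≤o (Nᵃ ℕ.⊔ Nᵇ) (M ℕ.⊔ N) K≤n)
          L≤m  = ℕP.m⊔n≤o⇒n≤o (Nᵃ ℕ.⊔ Nᵇ) (M ℕ.⊔ N) K≤m
          L≤n  = ℕP.m⊔n≤o⇒n≤o (Nᵃ ℕ.⊔ Nᵇ) (M ℕ.⊔ N) K≤n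
      in begin-strict
        ∣ a m ℚ.* b m ℚ.- a n ℚ.* b n ∣
          ≡⟨ cong ∣_∣ (rearrange (a m) (b m) (a n) (b n)) ⟩
        ∣ a m ℚ.* (b m ℚ.- b n) ℚ.+ b n ℚ.* (a m ℚ.- a n) ∣
          ≤⟨ ℚP.∣p+q∣≤∣p∣+∣q∣ (a m ℚ.* (b m ℚ.- b n)) (b n ℚ.* (a m ℚ.- a n)) ⟩
        ∣ a m ℚ.* (b m ℚ.- b n) ∣ ℚ.+ ∣ b n ℚ.* (a m ℚ.- a n) ∣
          <⟨ ℚP.+-mono-<
               (*-bound 0<A (a m) (a<A m Nᵃ≤m) (b m ℚ.- b n)
                 (q m n (ℕP.m⊔n≤o⇒n≤o M N L≤m) (ℕP.m⊔n≤o⇒n≤o M N L≤n)))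
               (*-bound 0<B (b n) (b<B n Nᵇ≤n) (a m ℚ.- a n)
                 (p m n (ℕP.m⊔n≤o⇒m≤o M N L≤m) (ℕP.m⊔n≤o⇒m≤o M N L≤n))) ⟩
        A ℚ.* δ ℚ.+ B ℚ.* δ
          ≡⟨ Cδ≡ε ⟩
        ε ∎

infixl 6 _+ᴿ_ _-ᴿ_
infixl 7 _*ᴿ_
infix  8 -ᴿ_

_+ᴿ_ : ℝ → ℝ → ℝ
x +ᴿ y = mkℝ (λ n → seq x n ℚ.+ seq y n) (+-cauchy (seq x) (seq y) (cauchy x) (cauchy y))

_*ᴿ_ : ℝ → ℝ → ℝ
x *ᴿ y = mkℝ (λ n → seq x n ℚ.* seq y n) (*-cauchy (seq x) (seq y) (cauchy x) (cauchy y))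

-ᴿ_ : ℝ → ℝ
-ᴿ x = mkℝ (λ n → ℚ.- seq x n) (neg-cauchy (seq x) (cauchy x))

_-ᴿ_ : ℝ → ℝ → ℝ
x -ᴿ y = x +ᴿ (-ᴿ y)

ℝ-rawRing : RawRing 0ℓ 0ℓ
ℝ-rawRing = record
  { Carrier = ℝ
  ; _≈_     = _≈ᴿ_
  ; _+_     = _+ᴿ_
  ; _*_     = _*ᴿ_
  ; -_      = -ᴿ_
  ; 0#      = fromℚ 0ℚ
  ; 1#      = fromℚ 1ℚ
  }

Matrix : ∀ {a} → Set a → ℕ → Set a
Matrix A n = Fin n → Fin n → A

-- The argument o is the value off the diagonal, always a zero below.
diag : ∀ {a} {A : Set a} {n} → A → Vector A n → Matrix A n
diag o t i j with i ≟ᶠ j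
... | yes _ = t i
... | no  _ = o

module _ {c ℓ} (R : RawRing c ℓ) where
  open RawRing R
  open RawSemiringDefinitions rawSemiring using (sum; _^_)

  -- Laplace expansion along the first row.
  det : ∀ {n} → Matrix Carrier n → Carrier
  det {zero}  M = 1#
  det {suc n} M =
    sum λ j → (- 1#) ^ toℕ j * (M zero j * det (λ i k → M (suc i) (punchIn j k)))

charPoly : ∀ {n} → Matrix ℤ n → ℝ → ℝ
charPoly M x = det ℝ-rawRing (λ i j → diag (fromℚ 0ℚ) (λ _ → x) i j -ᴿ fromℤ (M i j))

-- ∂ lists the eigenvalues of M, i.e. the roots of its characteristic
-- polynomial, with multiplicity and in non-increasing order.  Since ℝ is
-- infinite, equality of the two polynomial functions is equality of the
-- polynomials.
IsSpectrum : ∀ {n} → Matrix ℤ n → Vector ℝ n → Set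
IsSpectrum {n} M ∂ =
  (∀ i j → i Fin.≤ j → ∂ j ≤ᴿ ∂ i) ×
  (∀ x → charPoly M x ≈ᴿ product (λ i → x -ᴿ ∂ i))
  where open RawSemiringDefinitions (RawRing.rawSemiring ℝ-rawRing) using (product)

-- ∂₁ − ∂ₙ₋₁; positions are counted from 0, so ∂ₙ₋₁ is the entry at index
-- m = n − 2.
spread : ∀ {n} → 2 ℕ.≤ n → Vector ℝ n → ℝ
spread {suc (suc m)} _ ∂ = ∂ zero -ᴿ ∂ (inject₁ (fromℕ m))
spread {suc zero} (s≤s ()) ∂

record Graph (V : Set) : Set₁ where
  field
    Adj     : V → V → Set
    adj?    : Decidable Adj
    adj-sym : ∀ {u v} → Adj u v → Adj v u
    irrefl  : ∀ {v} → ¬ Adj v v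

open Graph public

complement : ∀ {n} → Graph (Fin n) → Graph (Fin n)
complement G = record
  { Adj     = λ u v → u ≢ v × ¬ Adj G u v
  ; adj?    = λ u v → ¬? (u ≟ᶠ v) ×-dec ¬? (adj? G u v)
  ; adj-sym = λ (u≢v , ¬uv) → (u≢v ∘ sym) , (¬uv ∘ adj-sym G)
  ; irrefl  = λ (v≢v , _) → v≢v refl
  }

completeMultipartite : (ls : List ℕ) → Graph (Σ[ i ∈ Fin (List.length ls) ] Fin (List.lookup ls i))
completeMultipartite ls = record
  { Adj     = λ u v → proj₁ u ≢ proj₁ v
  ; adj?    = λ u v → ¬? (proj₁ u ≟ᶠ proj₁ v)
  ; adj-sym = λ i≢j → i≢j ∘ sym
  ; irrefl  = λ i≢i → i≢i refl
  }

infix 4 _≅_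

_≅_ : ∀ {V W} → Graph V → Graph W → Set
_≅_ {V} {W} G H =
  Σ[ f ∈ V ↔ W ] (∀ u v → Adj G u v ⇔ Adj H (Inverse.to f u) (Inverse.to f v))

Colourable : ∀ {V} → Graph V → ℕ → Set
Colourable {V} G k = Σ[ c ∈ (V → Fin k) ] (∀ u v → Adj G u v → c u ≢ c v)

IsChromaticNumber : ∀ {V} → Graph V → ℕ → Set
IsChromaticNumber G χ = Colourable G χ × (∀ k → Colourable G k → χ ℕ.≤ k)

data Walk {V : Set} (G : Graph V) : V → V → ℕ → Set where
  []  : ∀ {u} → Walk G u u 0
  _∷_ : ∀ {u v w k} → Adj G u v → Walk G v w k → Walk G u w (suc k)

Connected : ∀ {V} → Graph V → Set
Connected G = ∀ u v → ∃ λ k → Walk G u v k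

-- A shortest walk repeats no vertex, so it is a shortest path.
IsDistance : ∀ {V} → Graph V → V → V → ℕ → Set
IsDistance G u v d = Walk G u v d × (∀ k → Walk G u v k → d ℕ.≤ k)

private
  walk? : ∀ {n} (G : Graph (Fin n)) u v k → Dec (Walk G u v k)
  walk? G u v zero with u ≟ᶠ v
  ... | yes refl = yes []
  ... | no u≢v   = no λ { [] → u≢v refl }
  walk? G u v (suc k) with any? (λ w → adj? G u w ×-dec walk? G w v k)
  ... | yes (_ , e , p) = yes (e ∷ p)
  ... | no ¬p           = no λ { (e ∷ p) → ¬p (_ , e , p) }

  least : {P : ℕ → Set} → (∀ k → Dec (P k)) → ∀ k → P k →
          ∃ λ d → P d × (∀ j → P j → d ℕ.≤ j)
  least P? zero    p = 0 , p , λ _ _ → z≤n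
  least {P} P? (suc k) p with P? 0 | least (P? ∘ suc) k p
  ... | yes p₀ | _           = 0 , p₀ , λ _ _ → z≤n
  ... | no ¬p₀ | d , pd , min = suc d , pd , λ where
    zero    p₀ → contradiction p₀ ¬p₀
    (suc j) pj → s≤s (min j pj)

module _ {n} (G : Graph (Fin n)) (conn : Connected G) where

  distance∃ : ∀ u v → ∃ (IsDistance G u v)
  distance∃ u v = least (walk? G u v) (proj₁ (conn u v)) (proj₂ (conn u v))

  distance : Matrix ℕ n
  distance u v = proj₁ (distance∃ u v)

  transmission : Fin n → ℕ
  transmission v = Vector.foldr ℕ._+_ 0 (λ u → distance u v)

  distanceLaplacian : Matrix ℤ n
  distanceLaplacian u v = diag (+ 0) (λ w → + transmission w) u v ℤ.- + distance u v

  -- A relation, because the spectrum is a relation: that all roots of the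
  -- characteristic polynomial of this symmetric matrix are real is not built
  -- into the definitions.
  IsDLS : 2 ℕ.≤ n → ℝ → Set
  IsDLS 2≤n s = Σ[ ∂ ∈ Vector ℝ n ] (IsSpectrum distanceLaplacian ∂ × s ≈ᴿ spread 2≤n ∂)

{-# OPTIONS --safe #-}

-- Since the complement is disconnected, G has diameter ≤ 2 and its distance
-- Laplacian is ν I − J + L, with ν the order of G, J the all-ones matrix and L
-- the Laplacian of the complement.  So ∂ₙ₋₁ = ν (a vector constant on a
-- component of the complement and on the rest) and the spread is the largest
-- Laplacian eigenvalue of the complement.  The Rayleigh quotient at
-- e_u − e_v, for an edge uv of the complement, is (d u + d v + 2) / 2, which
-- is at least 2, and at least 5/2 if some degree exceeds 1.  If all degrees
-- are at most 1 then L² = 2 L, hence with y = x − ν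
--   y · det (x I − Dᴸ) · det ((y − 2) I + L) = x (y (y − 2))ⁿ,
-- and the only roots are 0, which is simple, ν and ν + 2.
--
-- No spectral theorem is available: the eigenvalues are known only as roots of
-- the characteristic polynomial.  That ∂₁ bounds the Rayleigh quotients comes
-- from lowering x from infinity: while det (x I − Dᴸ) stays away from 0, the
-- adjugate bounds the inverse of x I − Dᴸ, which therefore stays positive
-- definite.
module Submission where

open import Defs
open import Algebra.Bundles using (CommutativeRing)
open import Algebra.Bundles.Raw using (RawRing)
import Algebra.Definitions.RawSemiring as RawSemiringDefinitions
import Algebra.Properties.CommutativeMonoid.Sum
open import Data.Empty using (⊥)
open import Data.Fin as Fin using (Fin; zero; suc; inject₁; toℕ; punchIn; punchOut; fromℕ<)
import Data.Fin.Properties as FinP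
open import Data.Fin.Properties using (suc-injective; toℕ-injective; toℕ<n; toℕ-fromℕ<; pigeonhole; punchOut-injective; any?;
  punchIn-punchOut; punchIn-injective; punchInᵢ≢i)
  renaming (_≟_ to _≟ᶠ_; <⇒≢ to <⇒≢ᶠ)
open import Data.Integer as ℤ using (ℤ; -[1+_])
import Data.Integer.Properties as ℤP
open import Data.List as List using (List; replicate; _++_; length)
import Data.List.Properties as ListP
open import Data.Nat as ℕ using (ℕ; zero; suc; z≤n; s≤s)
import Data.Nat.Properties as ℕP
import Data.Nat.Solver
open import Data.Product using (Σ; Σ-syntax; _×_; _,_; proj₁; proj₂; ∃; ∃₂)
import Data.Rational
import Data.Rational.Properties
import Data.Rational.Solver
import Data.Rational.Unnormalised as ℚᵘ
import Data.Rational.Unnormalised.Properties as ℚᵘP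
open import Data.Sum using (_⊎_; inj₁; inj₂)
open import Data.Vec.Functional as Vector using (Vector; updateAt)
open import Data.Vec.Functional.Properties using (updateAt-updates; updateAt-minimal)
open import Function using (_∘_; const; _⇔_; mk⇔; mk↔ₛ′)
open import Function.Bundles using (Inverse; Equivalence)
open import Level using (_⊔_)
open import Relation.Binary.PropositionalEquality as ≡ using (_≡_; _≢_; module ≡-Reasoning)
open import Relation.Nullary using (Dec; yes; no; ¬_; contradiction; _×-dec_)
open import Relation.Nullary.Decidable using (decidable-stable; ¬¬-excluded-middle)

-- Everything is computed over ℚ. The order of two reals cannot be decided, so claims about
-- eigenvalues are read at the k-th rational approximations and carried along as statements that
-- hold eventually. An inequality between an eigenvalue and a rational is obtained by refuting a
-- fixed rational gap; the Cauchy condition turns the refutation into `_≤ᴿ_`. Excluded middle for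
-- reachability in the complement enters only under a double negation.
--
-- The factorisation of the characteristic polynomial is available only up to an error at each
-- point, so simplicity of the root 0 cannot be read off by comparing factors. It comes from growth:
-- near 0 the closed form is at least linear, while two roots tending to 0 would make the product
-- quadratic. Likewise, positivity above the largest root is needed with a uniform constant, which
-- gives the descent a fixed step length.
--
-- The determinant is defined by expansion along the first row, which singles out one row. The
-- symmetry between the rows is recovered once, by showing that it is alternating and multilinear;
-- the adjugate identity rests on that, the product rule on uniqueness of such functions up to a
-- scalar.

module Determinant {c ℓ} (R : CommutativeRing c ℓ) where
  open CommutativeRing R hiding (zero)
  open import Algebra.Properties.Ring ring using (-1*x≈-x)
  open import Algebra.Properties.Semiring.Sum semiring
  open import Algebra.Solver.Ring.NaturalCoefficients.Default commutativeSemiring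
  open RawSemiringDefinitions (RawRing.rawSemiring rawRing) using (_^_)
  open import Relation.Binary.Reasoning.Setoid setoid

  -- Alternating multilinear functions of the rows of a matrix

  Det : ∀ {n} → Matrix Carrier n → Carrier
  Det = det rawRing

  sign : ∀ {n} → Fin n → Carrier
  sign j = (- 1#) ^ toℕ j

  minor : ∀ {n} → Matrix Carrier (suc n) → Fin (suc n) → Matrix Carrier n
  minor A j i k = A (suc i) (punchIn j k)

  sum-cong : ∀ {n} {f g : Vector Carrier n} → (∀ i → f i ≈ g i) → sum f ≈ sum g
  sum-cong = sum-cong-≋

  sum-zero : ∀ {n} {f : Vector Carrier n} → (∀ i → f i ≈ 0#) → sum f ≈ 0#
  sum-zero {n} f≈0 = trans (sum-cong f≈0) (sum-replicate-zero n)

  sum-linear : ∀ {n} a b {f g h : Vector Carrier n} →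
               (∀ i → f i ≈ a * g i + b * h i) → sum f ≈ a * sum g + b * sum h
  sum-linear a b {f} {g} {h} eq = begin
    sum f                                            ≈⟨ sum-cong eq ⟩
    sum (λ i → a * g i + b * h i)                    ≈⟨ ∑-distrib-+ (λ i → a * g i) (λ i → b * h i) ⟩
    sum (λ i → a * g i) + sum (λ i → b * h i)        ≈⟨ +-cong (*-distribˡ-sum a g) (*-distribˡ-sum b h) ⟨
    a * sum g + b * sum h                            ∎

  [_≔_]_ : ∀ {m n} → Fin m → Vector Carrier n → Vector (Vector Carrier n) m → Vector (Vector Carrier n) m
  [ i ≔ r ] A = updateAt A i (const r)

  ≔-hit : ∀ {m n} (i : Fin m) (r : Vector Carrier n) A k → ([ i ≔ r ] A) i k ≈ r k
  ≔-hit i r A k = reflexive (≡.cong-app (updateAt-updates i A) k)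

  ≔-miss : ∀ {m n} {i : Fin m} (r : Vector Carrier n) A j → j ≢ i → ∀ k → ([ i ≔ r ] A) j k ≈ A j k
  ≔-miss {i = i} r A j j≢i k = reflexive (≡.cong-app (updateAt-minimal j i A j≢i) k)

  -- No normalisation at the identity is imposed, so that linear combinations of such functions and
  -- `λ A → Det (A ⊗ B)` qualify. Linearity compares three matrices that agree entrywise up to `_≈_`
  -- off row `i`, because minors and products of updated matrices are not themselves literally
  -- updated matrices.
  record IsVolumeForm {n} (Φ : Matrix Carrier n → Carrier) : Set (c ⊔ ℓ) where
    field
      Φ-cong : ∀ {A B} → (∀ i k → A i k ≈ B i k) → Φ A ≈ Φ B
      linear : ∀ i {A B C} a b →
               (∀ j → j ≢ i → ∀ k → A j k ≈ B j k) → (∀ j → j ≢ i → ∀ k → A j k ≈ C j k) →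
               (∀ k → A i k ≈ a * B i k + b * C i k) → Φ A ≈ a * Φ B + b * Φ C
      alternating : ∀ i j A → i ≢ j → (∀ k → A i k ≈ A j k) → Φ A ≈ 0#

    row-cong : ∀ i {r s} A → (∀ k → r k ≈ s k) → Φ ([ i ≔ r ] A) ≈ Φ ([ i ≔ s ] A)
    row-cong i {r} {s} A r≈s = Φ-cong λ j k → lemma j k
      where
      lemma : ∀ j k → ([ i ≔ r ] A) j k ≈ ([ i ≔ s ] A) j k
      lemma j k with j ≟ᶠ i
      ... | yes ≡.refl = trans (≔-hit i r A k) (trans (r≈s k) (sym (≔-hit i s A k)))
      ... | no j≢i     = trans (≔-miss r A j j≢i k) (sym (≔-miss s A j j≢i k))

    row-restore : ∀ i A → Φ ([ i ≔ A i ] A) ≈ Φ A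
    row-restore i A = Φ-cong lemma
      where
      lemma : ∀ j k → ([ i ≔ A i ] A) j k ≈ A j k
      lemma j k with j ≟ᶠ i
      ... | yes ≡.refl = ≔-hit i (A i) A k
      ... | no j≢i     = ≔-miss (A i) A j j≢i k

    linear-≔ : ∀ i a b r s A →
               Φ ([ i ≔ (λ k → a * r k + b * s k) ] A) ≈ a * Φ ([ i ≔ r ] A) + b * Φ ([ i ≔ s ] A)
    linear-≔ i a b r s A = linear i a b
      (λ j j≢i k → trans (≔-miss _ A j j≢i k) (sym (≔-miss r A j j≢i k)))
      (λ j j≢i k → trans (≔-miss _ A j j≢i k) (sym (≔-miss s A j j≢i k)))
      (λ k → trans (≔-hit i _ A k) (sym (+-cong (*-congˡ (≔-hit i r A k)) (*-congˡ (≔-hit i s A k)))))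

    scale-≔ : ∀ i a r A → Φ ([ i ≔ (λ k → a * r k) ] A) ≈ a * Φ ([ i ≔ r ] A)
    scale-≔ i a r A = begin
      Φ ([ i ≔ (λ k → a * r k) ] A)
        ≈⟨ row-cong i A (λ k → solve 2 (λ a r → a :* r := a :* r :+ con 0 :* r) refl a (r k)) ⟩
      Φ ([ i ≔ (λ k → a * r k + 0# * r k) ] A)
        ≈⟨ linear-≔ i a 0# r r A ⟩
      a * Φ ([ i ≔ r ] A) + 0# * Φ ([ i ≔ r ] A)
        ≈⟨ solve 2 (λ a r → a :* r :+ con 0 :* r := a :* r) refl a _ ⟩
      a * Φ ([ i ≔ r ] A) ∎

    expand-row : ∀ i {m} (v : Vector Carrier m) (r : Fin m → Vector Carrier n) A →
                 Φ ([ i ≔ (λ k → sum λ t → v t * r t k) ] A) ≈ sum λ t → v t * Φ ([ i ≔ r t ] A)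
    expand-row i {zero} v r A = begin
      Φ ([ i ≔ (λ _ → 0#) ] A)        ≈⟨ row-cong i A (λ k → zeroˡ 0#) ⟨
      Φ ([ i ≔ (λ _ → 0# * 0#) ] A)   ≈⟨ scale-≔ i 0# (λ _ → 0#) A ⟩
      0# * Φ ([ i ≔ (λ _ → 0#) ] A)   ≈⟨ zeroˡ _ ⟩
      0#                              ∎
    expand-row i {suc m} v r A = begin
      Φ ([ i ≔ (λ k → sum λ t → v t * r t k) ] A)
        ≈⟨ row-cong i A (λ k → +-congˡ (sym (*-identityˡ _))) ⟩
      Φ ([ i ≔ (λ k → v zero * r zero k + 1# * rest k) ] A)
        ≈⟨ linear-≔ i (v zero) 1# (r zero) rest A ⟩
      v zero * Φ ([ i ≔ r zero ] A) + 1# * Φ ([ i ≔ rest ] A)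
        ≈⟨ +-congˡ (trans (*-identityˡ _) (expand-row i (v ∘ suc) (r ∘ suc) A)) ⟩
      sum (λ t → v t * Φ ([ i ≔ r t ] A)) ∎
      where
      rest : Vector Carrier n
      rest k = sum λ t → v (suc t) * r (suc t) k

    duplicate-row : ∀ i j A → j ≢ i → Φ ([ i ≔ A j ] A) ≈ 0#
    duplicate-row i j A j≢i = alternating i j ([ i ≔ A j ] A) (j≢i ∘ ≡.sym)
      (λ k → trans (≔-hit i (A j) A k) (sym (≔-miss (A j) A j j≢i k)))

  sum-single : ∀ {n} (f : Vector Carrier n) i → (∀ j → j ≢ i → f j ≈ 0#) → sum f ≈ f i
  sum-single {suc n} f zero    z = trans (+-congˡ (sum-zero λ j → z (suc j) λ ())) (+-identityʳ _)
  sum-single {suc n} f (suc i) z = trans (+-cong (z zero λ ()) (sum-single (f ∘ suc) i λ j j≢i → z (suc j) (j≢i ∘ suc-injective))) (+-identityˡ _)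

  module _ {n} {Φ : Matrix Carrier n → Carrier} (V : IsVolumeForm Φ) where
    open IsVolumeForm V

    -- Putting row `t` in place of row `i` creates a repeated row unless `t` is `i`, so a single
    -- term of the expansion survives.
    combine-rows : ∀ i (v : Vector Carrier n) A → Φ ([ i ≔ (λ k → sum λ t → v t * A t k) ] A) ≈ v i * Φ A
    combine-rows i v A = begin
      Φ ([ i ≔ (λ k → sum λ t → v t * A t k) ] A)   ≈⟨ expand-row i v A A ⟩
      sum (λ t → v t * Φ ([ i ≔ A t ] A))
        ≈⟨ sum-single _ i (λ j j≢i → trans (*-congˡ (duplicate-row i j A j≢i)) (zeroʳ _)) ⟩
      v i * Φ ([ i ≔ A i ] A)                       ≈⟨ *-congˡ (row-restore i A) ⟩
      v i * Φ A                                     ∎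

    -- The coefficient stays in the conclusion because the ring may have zero divisors.
    dependent-rows : ∀ i (v : Vector Carrier n) A → (∀ k → sum (λ t → v t * A t k) ≈ 0#) → v i * Φ A ≈ 0#
    dependent-rows i v A dependent = begin
      v i * Φ A                                     ≈⟨ combine-rows i v A ⟨
      Φ ([ i ≔ (λ k → sum λ t → v t * A t k) ] A)   ≈⟨ row-cong i A (λ k → trans (dependent k) (sym (zeroˡ 0#))) ⟩
      Φ ([ i ≔ (λ _ → 0# * 0#) ] A)                 ≈⟨ scale-≔ i 0# (λ _ → 0#) A ⟩
      0# * Φ ([ i ≔ (λ _ → 0#) ] A)                 ≈⟨ zeroˡ _ ⟩
      0#                                            ∎

  -- The Laplace expansion is alternating and multilinear

  det-cong : ∀ {n} {A B : Matrix Carrier n} → (∀ i k → A i k ≈ B i k) → Det A ≈ Det B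
  det-cong {zero}  eq = refl
  det-cong {suc n} eq = sum-cong λ j →
    *-congˡ {sign j} (*-cong (eq zero j) (det-cong λ i k → eq (suc i) (punchIn j k)))

  det-linear : ∀ {n} i {A B C : Matrix Carrier n} a b →
               (∀ j → j ≢ i → ∀ k → A j k ≈ B j k) → (∀ j → j ≢ i → ∀ k → A j k ≈ C j k) →
               (∀ k → A i k ≈ a * B i k + b * C i k) → Det A ≈ a * Det B + b * Det C
  det-linear {suc n} zero {A} {B} {C} a b A≈B A≈C eq = sum-linear a b λ j → begin
    sign j * (A zero j * Det (minor A j))
      ≈⟨ *-congˡ (*-congʳ (eq j)) ⟩
    sign j * ((a * B zero j + b * C zero j) * Det (minor A j))
      ≈⟨ solve 6 (λ s a x b y d → s :* ((a :* x :+ b :* y) :* d) := a :* (s :* (x :* d)) :+ b :* (s :* (y :* d)))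
           refl (sign j) a (B zero j) b (C zero j) (Det (minor A j)) ⟩
    a * (sign j * (B zero j * Det (minor A j))) + b * (sign j * (C zero j * Det (minor A j)))
      ≈⟨ +-cong (*-congˡ (*-congˡ (*-congˡ (det-cong λ i k → A≈B (suc i) (λ ()) (punchIn j k)))))
                (*-congˡ (*-congˡ (*-congˡ (det-cong λ i k → A≈C (suc i) (λ ()) (punchIn j k))))) ⟩
    a * (sign j * (B zero j * Det (minor B j))) + b * (sign j * (C zero j * Det (minor C j))) ∎
  det-linear {suc n} (suc i) {A} {B} {C} a b A≈B A≈C eq = sum-linear a b λ j → begin
    sign j * (A zero j * Det (minor A j))
      ≈⟨ *-congˡ (*-congˡ (det-linear i a b
           (λ l l≢i k → A≈B (suc l) (l≢i ∘ suc-injective) (punchIn j k))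
           (λ l l≢i k → A≈C (suc l) (l≢i ∘ suc-injective) (punchIn j k))
           (λ k → eq (punchIn j k)))) ⟩
    sign j * (A zero j * (a * Det (minor B j) + b * Det (minor C j)))
      ≈⟨ solve 6 (λ s x a d b e → s :* (x :* (a :* d :+ b :* e)) := a :* (s :* (x :* d)) :+ b :* (s :* (x :* e)))
           refl (sign j) (A zero j) a (Det (minor B j)) b (Det (minor C j)) ⟩
    a * (sign j * (A zero j * Det (minor B j))) + b * (sign j * (A zero j * Det (minor C j)))
      ≈⟨ +-cong (*-congˡ (*-congˡ (*-congʳ (A≈B zero (λ ()) j)))) (*-congˡ (*-congˡ (*-congʳ (A≈C zero (λ ()) j)))) ⟩
    a * (sign j * (B zero j * Det (minor B j))) + b * (sign j * (C zero j * Det (minor C j))) ∎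

  x+-1*x≈0 : ∀ x → x + - 1# * x ≈ 0#
  x+-1*x≈0 x = trans (+-congˡ (-1*x≈-x x)) (-‿inverseʳ x)

  -- Y j k stands for the term that picks column j in the first row and the
  -- k-th of the remaining columns in the second row.
  signed-pairs-cancel : ∀ {n} (Y : Fin (suc n) → Fin n → Carrier) →
    (∀ j k j′ k′ → punchIn j k ≡ j′ → punchIn j′ k′ ≡ j → Y j k ≈ Y j′ k′) →
    sum (λ j → sign j * sum λ k → sign k * Y j k) ≈ 0#
  signed-pairs-cancel {zero}  Y symm = trans (+-identityʳ _) (zeroʳ _)
  signed-pairs-cancel {suc n} Y symm = begin
    1# * S + sum (λ j → - 1# * sign j * (1# * Y (suc j) zero + sum (λ k → - 1# * sign k * Y (suc j) (suc k))))
      ≈⟨ +-congˡ (sum-linear (- 1#) (- 1# * - 1#) λ j → trans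
           (*-congˡ (+-congˡ (trans
             (sum-cong λ k → *-assoc (- 1#) (sign k) (Y (suc j) (suc k)))
             (sym (*-distribˡ-sum (- 1#) λ k → sign k * Y (suc j) (suc k))))))
           (solve 4 (λ m s y t → m :* s :* (con 1 :* y :+ m :* t) := m :* (s :* y) :+ m :* m :* (s :* t))
             refl (- 1#) (sign j) (Y (suc j) zero) (inner j))) ⟩
    1# * S + (- 1# * sum (λ j → sign j * Y (suc j) zero) + (- 1# * - 1#) * sum (λ j → sign j * inner j))
      -- By symmetry the terms with `k` = 0 equal those with `j` = 0 and carry the opposite sign;
      -- what is left is the same kind of sum, one size smaller.
      ≈⟨ +-congˡ (+-cong (*-congˡ (sum-cong λ j → *-congˡ {sign j} (symm (suc j) zero zero j ≡.refl ≡.refl)))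
           (trans (*-congˡ (signed-pairs-cancel (λ j k → Y (suc j) (suc k))
              λ j k j′ k′ p q → symm (suc j) (suc k) (suc j′) (suc k′) (≡.cong suc p) (≡.cong suc q)))
            (zeroʳ _))) ⟩
    1# * S + (- 1# * S + 0#)
      ≈⟨ +-cong (*-identityˡ S) (+-identityʳ _) ⟩
    S + - 1# * S
      ≈⟨ x+-1*x≈0 S ⟩
    0# ∎
    where
    S : Carrier
    S = sum λ k → sign k * Y zero k
    inner : Fin (suc n) → Carrier
    inner j = sum λ k → sign k * Y (suc j) (suc k)

  -- Both sides enumerate, in increasing order, the columns other than `j` and `j′`.
  punchIn-comm : ∀ {n} (j : Fin (suc (suc n))) k j′ k′ → punchIn j k ≡ j′ → punchIn j′ k′ ≡ j →
                 ∀ l → punchIn j (punchIn k l) ≡ punchIn j′ (punchIn k′ l)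
  punchIn-comm zero    k       _ zero     ≡.refl q l = ≡.refl
  punchIn-comm (suc j) zero    _ k′       ≡.refl ≡.refl l = ≡.refl
  punchIn-comm {suc n} (suc j) (suc k) _ (suc k′) ≡.refl q zero = ≡.refl
  punchIn-comm {suc n} (suc j) (suc k) _ (suc k′) ≡.refl q (suc l) =
    ≡.cong suc (punchIn-comm j k _ k′ ≡.refl (suc-injective q) l)

  -- Two expansions give a signed sum over ordered pairs of distinct columns. With equal first rows,
  -- exchanging the two columns preserves the term, since the remaining minor is the same.
  det-alternating₀₁ : ∀ {n} (A : Matrix Carrier (suc (suc n))) →
    (∀ k → A zero k ≈ A (suc zero) k) → Det A ≈ 0#
  det-alternating₀₁ {n} A eq = trans
    (sum-cong λ j → *-congˡ {sign j} (trans (*-distribˡ-sum (A zero j) λ k → sign k * (A (suc zero) (punchIn j k) * D j k))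
      (sum-cong λ k → solve 4 (λ a s b d → a :* (s :* (b :* d)) := s :* (a :* b :* d))
        refl (A zero j) (sign k) (A (suc zero) (punchIn j k)) (D j k))))
    (signed-pairs-cancel (λ j k → A zero j * A (suc zero) (punchIn j k) * D j k) symm)
    where
    D : Fin (suc (suc n)) → Fin (suc n) → Carrier
    D j k = Det (minor (minor A j) k)
    symm : ∀ j k j′ k′ → punchIn j k ≡ j′ → punchIn j′ k′ ≡ j →
           A zero j * A (suc zero) (punchIn j k) * D j k ≈ A zero j′ * A (suc zero) (punchIn j′ k′) * D j′ k′
    symm j k j′ k′ p q = *-cong
      (begin
        A zero j * A (suc zero) (punchIn j k)     ≈⟨ *-cong (eq j) (trans (reflexive (≡.cong (A (suc zero)) p)) (sym (eq j′))) ⟩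
        A (suc zero) j * A zero j′                ≈⟨ *-comm _ _ ⟩
        A zero j′ * A (suc zero) j                ≈⟨ *-congˡ (reflexive (≡.cong (A (suc zero)) q)) ⟨
        A zero j′ * A (suc zero) (punchIn j′ k′)  ∎)
      (det-cong λ i l → reflexive (≡.cong (A (suc (suc i))) (punchIn-comm j k j′ k′ p q l)))



  det-minors-zero : ∀ {n} (A : Matrix Carrier (suc n)) → (∀ l → Det (minor A l) ≈ 0#) → Det A ≈ 0#
  det-minors-zero A minor≈0 = sum-zero λ l →
    trans (*-congˡ {sign l} (*-congˡ {A zero l} (minor≈0 l))) (trans (*-congˡ (zeroʳ _)) (zeroʳ _))

  -- Rows 1 and j are both replaced by their sum, which makes the determinant
  -- vanish; of the four terms of its expansion only det A can survive.
  det-alternating-zero-suc-suc : ∀ {n} j (A : Matrix Carrier (suc (suc n))) →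
    (∀ (B : Matrix Carrier (suc n)) → (∀ k → B zero k ≈ B (suc j) k) → Det B ≈ 0#) →
    (∀ k → A zero k ≈ A (suc (suc j)) k) → Det A ≈ 0#
  det-alternating-zero-suc-suc {n} j A minors eq = begin
    Det A                                ≈⟨ +-identityʳ _ ⟨
    Det A + 0#                           ≈⟨ +-congˡ (det-alternating₀₁ (X r r) λ k → refl) ⟨
    Det A + Det (X r r)                  ≈⟨ +-congʳ (det-cong A≈X) ⟩
    Det (X s r) + Det (X r r)            ≈⟨ split-one s r r ⟨
    Det (X (s ⊕ r) r)                    ≈⟨ +-identityˡ _ ⟨
    0# + Det (X (s ⊕ r) r)               ≈⟨ +-congʳ zero-ss ⟨
    Det (X (s ⊕ r) s) + Det (X (s ⊕ r) r) ≈⟨ split-two (s ⊕ r) s r ⟨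
    Det (X (s ⊕ r) (s ⊕ r))              ≈⟨ equal-rows (s ⊕ r) ⟩
    0#                                   ∎
    where
    one two : Fin (suc (suc n))
    one = suc zero
    two = suc (suc j)
    r s : Vector Carrier (suc (suc n))
    r = A zero
    s = A one
    _⊕_ : (u v : Vector Carrier (suc (suc n))) → Vector Carrier (suc (suc n))
    (u ⊕ v) k = u k + v k
    X : (u v : Vector Carrier (suc (suc n))) → Matrix Carrier (suc (suc n))
    X u v zero          = r
    X u v (suc zero)    = u
    X u v (suc (suc i)) = ([ j ≔ v ] λ i → A (suc (suc i))) i
    X-two : ∀ u v k → X u v two k ≈ v k
    X-two u v k = ≔-hit j v _ k
    equal-rows : ∀ u → Det (X u u) ≈ 0#
    equal-rows u = det-minors-zero (X u u) λ l → minors (minor (X u u) l) λ k → sym (X-two u u (punchIn l k))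
    A≈X : ∀ i k → A i k ≈ X s r i k
    A≈X zero k = refl
    A≈X (suc zero) k = refl
    A≈X (suc (suc i)) k with i ≟ᶠ j
    ... | yes ≡.refl = trans (sym (eq k)) (sym (X-two s r k))
    ... | no i≢j′    = sym (≔-miss r (λ i → A (suc (suc i))) i i≢j′ k)
    1x+1y : ∀ {x y} → x + y ≈ 1# * x + 1# * y
    1x+1y = sym (+-cong (*-identityˡ _) (*-identityˡ _))
    split-one : ∀ u v w → Det (X (u ⊕ v) w) ≈ Det (X u w) + Det (X v w)
    split-one u v w = trans
      (det-linear one {X (u ⊕ v) w} {X u w} {X v w} 1# 1# (rows u) (rows v) λ k → 1x+1y)
      (sym 1x+1y)
      where
      rows : ∀ t i → i ≢ one → ∀ k → X (u ⊕ v) w i k ≈ X t w i k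
      rows t zero          i≢ k = refl
      rows t (suc zero)    i≢ k = contradiction ≡.refl i≢
      rows t (suc (suc i)) i≢ k = refl
    split-two : ∀ u v w → Det (X u (v ⊕ w)) ≈ Det (X u v) + Det (X u w)
    split-two u v w = trans
      (det-linear two {X u (v ⊕ w)} {X u v} {X u w} 1# 1# (rows v) (rows w) λ k →
        trans (X-two u (v ⊕ w) k) (trans 1x+1y (sym (+-cong (*-congˡ (X-two u v k)) (*-congˡ (X-two u w k))))))
      (sym 1x+1y)
      where
      rows : ∀ t i → i ≢ two → ∀ k → X u (v ⊕ w) i k ≈ X u t i k
      rows t zero          i≢ k = refl
      rows t (suc zero)    i≢ k = refl
      rows t (suc (suc i)) i≢ k =
        trans (≔-miss (v ⊕ w) _ i i≢j k) (sym (≔-miss t _ i i≢j k))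
        where
        i≢j : i ≢ j
        i≢j i≡j = i≢ (≡.cong (λ i → suc (suc i)) i≡j)
    zero-ss : Det (X (s ⊕ r) s) ≈ 0#
    zero-ss = begin
      Det (X (s ⊕ r) s)          ≈⟨ split-one s r s ⟩
      Det (X s s) + Det (X r s)  ≈⟨ +-cong (equal-rows s)
        (det-alternating₀₁ (X r s) λ k → refl) ⟩
      0# + 0#                    ≈⟨ +-identityˡ 0# ⟩
      0#                         ∎

  -- Expansion along row 0 leaves three situations: both equal rows lie below row 0 and persist in
  -- every minor; they are rows 0 and 1; or row 0 equals a row further down, which reduces to the
  -- previous two.
  det-alternating : ∀ {n} i j (A : Matrix Carrier n) → i ≢ j → (∀ k → A i k ≈ A j k) → Det A ≈ 0#
  det-alternating zero zero A i≢j eq = contradiction ≡.refl i≢j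
  det-alternating zero (suc zero) A i≢j eq = det-alternating₀₁ A eq
  det-alternating (suc zero) zero A i≢j eq = det-alternating₀₁ A (sym ∘ eq)
  det-alternating {suc n} (suc i) (suc j) A i≢j eq = det-minors-zero A λ l →
    det-alternating i j (minor A l) (i≢j ∘ ≡.cong suc) λ k → eq (punchIn l k)
  det-alternating {suc n} (suc (suc j)) zero A i≢j eq =
    det-alternating-zero-suc-suc j A (λ B → det-alternating zero (suc j) B (λ ())) (sym ∘ eq)
  det-alternating {suc n} zero (suc (suc j)) A i≢j eq =
    det-alternating-zero-suc-suc j A (λ B → det-alternating zero (suc j) B (λ ())) eq

  det-isVolumeForm : ∀ {n} → IsVolumeForm (Det {n})
  det-isVolumeForm = record { Φ-cong = det-cong ; linear = det-linear ; alternating = det-alternating }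

  -- Uniqueness of volume forms up to a scalar

  I : ∀ {n} → Matrix Carrier n
  I = diag 0# (λ _ → 1#)

  diag-≡ : ∀ {n} (t : Vector Carrier n) i → diag 0# t i i ≈ t i
  diag-≡ t i with i ≟ᶠ i
  ... | yes _  = refl
  ... | no i≢i = contradiction ≡.refl i≢i

  diag-≢ : ∀ {n} (t : Vector Carrier n) {i j} → i ≢ j → diag 0# t i j ≈ 0#
  diag-≢ t {i} {j} i≢j with i ≟ᶠ j
  ... | yes i≡j = contradiction i≡j i≢j
  ... | no _    = refl

  diag-suc : ∀ {n} (t : Vector Carrier (suc n)) i j → diag 0# t (suc i) (suc j) ≈ diag 0# (t ∘ suc) i j
  diag-suc t i j with i ≟ᶠ j
  ... | yes _ = refl
  ... | no _  = refl

  sum-I* : ∀ {n} (f : Vector Carrier n) i → sum (λ j → I i j * f j) ≈ f i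
  sum-I* f i = trans
    (sum-single _ i λ j j≢i → trans (*-congʳ (diag-≢ _ (j≢i ∘ ≡.sym))) (zeroˡ _))
    (trans (*-congʳ (diag-≡ _ i)) (*-identityˡ _))

  sum-*I : ∀ {n} (f : Vector Carrier n) i → sum (λ j → f j * I j i) ≈ f i
  sum-*I f i = trans
    (sum-single _ i λ j j≢i → trans (*-congˡ (diag-≢ _ j≢i)) (zeroʳ _))
    (trans (*-congˡ (diag-≡ _ i)) (*-identityʳ _))

  det-scalar : ∀ n x → Det {n} (diag 0# (λ _ → x)) ≈ x ^ n
  det-scalar zero    x = refl
  det-scalar (suc n) x = begin
    Det X
      ≈⟨ sum-single (λ j → sign j * (X zero j * Det (minor X j))) zero
           (λ j j≢0 → trans (*-congˡ {sign j} (trans (*-congʳ (diag-≢ (λ _ → x) (j≢0 ∘ ≡.sym))) (zeroˡ _))) (zeroʳ _)) ⟩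
    1# * (x * Det (minor X zero))
      ≈⟨ trans (*-identityˡ _) (*-congˡ (trans (det-cong {n} (diag-suc (λ _ → x))) (det-scalar n x))) ⟩
    x * x ^ n ∎
    where
    X : Matrix Carrier (suc n)
    X = diag 0# (λ _ → x)

  det-I : ∀ n → Det {n} I ≈ 1#
  det-I n = trans (det-scalar n 1#) (1^ n)
    where
    1^ : ∀ n → 1# ^ n ≈ 1#
    1^ zero    = refl
    1^ (suc n) = trans (*-identityˡ _) (1^ n)

  collide : ∀ {n} (κ : Fin n → Fin n) p → (∀ j → κ j ≢ p) → ∃₂ λ i j → i ≢ j × κ i ≡ κ j
  collide {suc n} κ p misses with pigeonhole (ℕP.n<1+n n) (λ j → punchOut (misses j ∘ ≡.sym))
  ... | i , j , i<j , eq = i , j , <⇒≢ᶠ i<j , punchOut-injective (misses i ∘ ≡.sym) (misses j ∘ ≡.sym) eq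

  module _ {n} {Φ : Matrix Carrier n → Carrier} (V : IsVolumeForm Φ) where
    open IsVolumeForm V

    -- Polarisation: with the sum of the two rows in both places the form vanishes, and of the four
    -- terms of the expansion the two with a repeated row vanish as well. Only vanishing is
    -- transferred, so no sign of a permutation has to be tracked.
    swap-rows : ∀ i j A → i ≢ j → Φ ([ i ≔ A j ] ([ j ≔ A i ] A)) ≈ 0# → Φ A ≈ 0#
    swap-rows i j A i≢j swapped≈0 = begin
      Φ A                                              ≈⟨ Φ-cong A≈Y ⟩
      Φ (Y r s)                                        ≈⟨ trans (+-identityʳ _) (+-identityˡ _) ⟨
      0# + Φ (Y r s) + 0#                              ≈⟨ +-cong (+-congʳ (equal r)) swapped≈0 ⟨
      Φ (Y r r) + Φ (Y r s) + Φ (Y s r)                ≈⟨ +-identityʳ _ ⟨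
      Φ (Y r r) + Φ (Y r s) + Φ (Y s r) + 0#           ≈⟨ +-congˡ (equal s) ⟨
      Φ (Y r r) + Φ (Y r s) + Φ (Y s r) + Φ (Y s s)    ≈⟨ solve 4 (λ a b c d → a :+ b :+ c :+ d := (a :+ c) :+ (b :+ d)) refl _ _ _ _ ⟩
      (Φ (Y r r) + Φ (Y s r)) + (Φ (Y r s) + Φ (Y s s)) ≈⟨ +-cong (split-i r) (split-i s) ⟨
      Φ (Y (r ⊕ s) r) + Φ (Y (r ⊕ s) s)                ≈⟨ split-j (r ⊕ s) ⟨
      Φ (Y (r ⊕ s) (r ⊕ s))                            ≈⟨ equal (r ⊕ s) ⟩
      0#                                               ∎
      where
      r s : Vector Carrier n
      r = A i
      s = A j
      _⊕_ : (u v : Vector Carrier n) → Vector Carrier n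
      (u ⊕ v) k = u k + v k
      Y : (u v : Vector Carrier n) → Matrix Carrier n
      Y u v = [ i ≔ u ] ([ j ≔ v ] A)
      Y-i : ∀ u v k → Y u v i k ≈ u k
      Y-i u v k = ≔-hit i u _ k
      Y-j : ∀ u v k → Y u v j k ≈ v k
      Y-j u v k = trans (≔-miss u _ j (i≢j ∘ ≡.sym) k) (≔-hit j v A k)
      Y-miss : ∀ u v l → l ≢ i → l ≢ j → ∀ k → Y u v l k ≈ A l k
      Y-miss u v l l≢i l≢j k = trans (≔-miss u _ l l≢i k) (≔-miss v A l l≢j k)
      A≈Y : ∀ l k → A l k ≈ Y r s l k
      A≈Y l k with l ≟ᶠ i | l ≟ᶠ j
      ... | yes ≡.refl | _          = sym (Y-i r s k)
      ... | no _       | yes ≡.refl = sym (Y-j r s k)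
      ... | no l≢i     | no l≢j     = sym (Y-miss r s l l≢i l≢j k)
      equal : ∀ u → Φ (Y u u) ≈ 0#
      equal u = alternating i j (Y u u) i≢j λ k → trans (Y-i u u k) (sym (Y-j u u k))
      1x+1y : ∀ {x y} → x + y ≈ 1# * x + 1# * y
      1x+1y = sym (+-cong (*-identityˡ _) (*-identityˡ _))
      split-i : ∀ v → Φ (Y (r ⊕ s) v) ≈ Φ (Y r v) + Φ (Y s v)
      split-i v = trans (row-cong i _ λ k → 1x+1y) (trans (linear-≔ i 1# 1# r s ([ j ≔ v ] A)) (sym 1x+1y))
      split-j : ∀ u → Φ (Y u (r ⊕ s)) ≈ Φ (Y u r) + Φ (Y u s)
      split-j u = trans
        (linear j {Y u (r ⊕ s)} {Y u r} {Y u s} 1# 1# (rows r) (rows s) λ k →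
          trans (Y-j u (r ⊕ s) k) (trans 1x+1y (sym (+-cong (*-congˡ (Y-j u r k)) (*-congˡ (Y-j u s k))))))
        (sym 1x+1y)
        where
        rows : ∀ t l → l ≢ j → ∀ k → Y u (r ⊕ s) l k ≈ Y u t l k
        rows t l l≢j k with l ≟ᶠ i
        ... | yes ≡.refl = trans (Y-i u (r ⊕ s) k) (sym (Y-i u t k))
        ... | no l≢i     = trans (Y-miss u (r ⊕ s) l l≢i l≢j k) (sym (Y-miss u t l l≢i l≢j k))

    module _ (ΦI≈0 : Φ I ≈ 0#) where

      split-≤ : ∀ {m} (m<n : m ℕ.< n) {i : Fin n} → i ≢ fromℕ< m<n → m ℕ.≤ toℕ i → suc m ℕ.≤ toℕ i
      split-≤ m<n i≢p m≤i = ℕP.≤∧≢⇒< m≤i λ m≡i →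
        i≢p (toℕ-injective (≡.trans (≡.sym m≡i) (≡.sym (toℕ-fromℕ< m<n))))

      -- Sorts the rows of `I ∘ κ` into place from the last index downwards. If the value `p` due at
      -- position `p` occurs elsewhere, two rows are swapped; if it does not occur at all, `κ` takes
      -- some value twice and the matrix has a repeated row.
      vanishes-on-basis : ∀ m → m ℕ.≤ n → (κ : Fin n → Fin n) → (∀ i → m ℕ.≤ toℕ i → κ i ≡ i) → Φ (I ∘ κ) ≈ 0#
      vanishes-on-basis zero    _   κ fixed = trans (Φ-cong λ i k → reflexive (≡.cong (λ j → I j k) (fixed i z≤n))) ΦI≈0
      vanishes-on-basis (suc m) m<n κ fixed with κ (fromℕ< m<n) ≟ᶠ fromℕ< m<n
      ... | yes κp≡p = vanishes-on-basis m (ℕP.<⇒≤ m<n) κ fixed′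
        where
        fixed′ : ∀ i → m ℕ.≤ toℕ i → κ i ≡ i
        fixed′ i m≤i with i ≟ᶠ fromℕ< m<n
        ... | yes ≡.refl = κp≡p
        ... | no i≢p     = fixed i (split-≤ m<n i≢p m≤i)
      ... | no κp≢p with any? (λ j → κ j ≟ᶠ fromℕ< m<n)
      ... | yes (j , κj≡p) = swap-rows p j (I ∘ κ) p≢j
              (trans (Φ-cong E≈) (vanishes-on-basis m (ℕP.<⇒≤ m<n) κ′ fixed′))
        where
        p : Fin n
        p = fromℕ< m<n
        p≢j : p ≢ j
        p≢j p≡j = κp≢p (≡.trans (≡.cong κ p≡j) κj≡p)
        κ₁ κ′ : Vector (Fin n) n
        κ₁ = updateAt κ j (const (κ p))
        κ′ = updateAt κ₁ p (const (κ j))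
        E≈ : ∀ i k → ([ p ≔ I (κ j) ] ([ j ≔ I (κ p) ] (I ∘ κ))) i k ≈ I (κ′ i) k
        E≈ i k with i ≟ᶠ p
        ... | yes ≡.refl = trans (≔-hit p (I (κ j)) _ k) (reflexive (≡.cong (λ l → I l k) (≡.sym (updateAt-updates p κ₁))))
        ... | no i≢p with i ≟ᶠ j
        ... | yes ≡.refl = trans (≔-miss (I (κ j)) _ j i≢p k) (trans (≔-hit j (I (κ p)) (I ∘ κ) k)
                (reflexive (≡.cong (λ l → I l k) (≡.sym (≡.trans (updateAt-minimal j p κ₁ i≢p) (updateAt-updates j κ))))))
        ... | no i≢j = trans (≔-miss (I (κ j)) _ i i≢p k) (trans (≔-miss (I (κ p)) (I ∘ κ) i i≢j k)
                (reflexive (≡.cong (λ l → I l k) (≡.sym (≡.trans (updateAt-minimal i p κ₁ i≢p) (updateAt-minimal i j κ i≢j))))))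
        fixed′ : ∀ i → m ℕ.≤ toℕ i → κ′ i ≡ i
        fixed′ i m≤i with i ≟ᶠ p
        ... | yes ≡.refl = ≡.trans (updateAt-updates p κ₁) κj≡p
        ... | no i≢p with i ≟ᶠ j
        -- The swap never disturbs a position that is already settled: `j` is not `p`, so a settled
        -- `j` would have `κ j` = `j` and not `p`.
        ... | yes ≡.refl = contradiction (≡.trans (≡.sym κj≡p) (fixed i (split-≤ m<n i≢p m≤i))) (i≢p ∘ ≡.sym)
        ... | no i≢j = ≡.trans (updateAt-minimal i p κ₁ i≢p)
                (≡.trans (updateAt-minimal i j κ i≢j) (fixed i (split-≤ m<n i≢p m≤i)))
      ... | no misses with collide κ (fromℕ< m<n) (λ j κj≡p → misses (j , κj≡p))
      ... | i , j , i≢j , κi≡κj = alternating i j (I ∘ κ) i≢j λ k → reflexive (≡.cong (λ l → I l k) κi≡κj)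

      -- Rows from index `m` on are already basis vectors; expanding the row just before them in the
      -- standard basis settles one more.
      vanishes : ∀ m → m ℕ.≤ n → ∀ A → (∀ i → m ℕ.≤ toℕ i → ∃ λ k → ∀ l → A i l ≈ I k l) → Φ A ≈ 0#
      vanishes zero _ A basis = trans (Φ-cong λ i l → proj₂ (basis i z≤n) l)
        (vanishes-on-basis n ℕP.≤-refl (λ i → proj₁ (basis i z≤n)) λ i n≤i → contradiction (toℕ<n i) (ℕP.≤⇒≯ n≤i))
      vanishes (suc m) m<n A basis = begin
        Φ A
          ≈⟨ row-restore p A ⟨
        Φ ([ p ≔ A p ] A)
          ≈⟨ row-cong p A (λ k → sym (sum-*I (A p) k)) ⟩
        Φ ([ p ≔ (λ k → sum λ t → A p t * I t k) ] A)
          ≈⟨ expand-row p (A p) I A ⟩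
        sum (λ t → A p t * Φ ([ p ≔ I t ] A))
          ≈⟨ sum-zero (λ t → trans (*-congˡ (vanishes m (ℕP.<⇒≤ m<n) ([ p ≔ I t ] A) (basis′ t))) (zeroʳ _)) ⟩
        0# ∎
        where
        p : Fin n
        p = fromℕ< m<n
        basis′ : ∀ t i → m ℕ.≤ toℕ i → ∃ λ k → ∀ l → ([ p ≔ I t ] A) i l ≈ I k l
        basis′ t i m≤i with i ≟ᶠ p
        ... | yes ≡.refl = t , ≔-hit p (I t) A
        ... | no i≢p with basis i (split-≤ m<n i≢p m≤i)
        ... | k , eq = k , λ l → trans (≔-miss (I t) A i i≢p l) (eq l)

  combination-isVolumeForm : ∀ {n} {Φ Ψ : Matrix Carrier n → Carrier} → IsVolumeForm Φ → IsVolumeForm Ψ →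
    ∀ x y → IsVolumeForm (λ A → x * Φ A + y * Ψ A)
  combination-isVolumeForm {Φ = Φ} {Ψ} V W x y = record
    { Φ-cong = λ eq → +-cong (*-congˡ (V.Φ-cong eq)) (*-congˡ (W.Φ-cong eq))
    ; linear = λ i {A} {B} {C} a b A≈B A≈C eq → trans
        (+-cong (*-congˡ (V.linear i a b A≈B A≈C eq)) (*-congˡ (W.linear i a b A≈B A≈C eq)))
        (solve 8 (λ x y a b p q r s → x :* (a :* p :+ b :* q) :+ y :* (a :* r :+ b :* s)
                                   := a :* (x :* p :+ y :* r) :+ b :* (x :* q :+ y :* s))
          refl x y a b (Φ B) (Φ C) (Ψ B) (Ψ C))
    ; alternating = λ i j A i≢j eq → trans
        (+-cong (trans (*-congˡ (V.alternating i j A i≢j eq)) (zeroʳ x))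
                (trans (*-congˡ (W.alternating i j A i≢j eq)) (zeroʳ y)))
        (+-identityˡ 0#)
    }
    where
    module V = IsVolumeForm V
    module W = IsVolumeForm W

  -- The difference of `Φ` and `Φ I` times `Det` is again a volume form and vanishes at `I`, hence
  -- everywhere.
  volumeForm-unique : ∀ {n} {Φ : Matrix Carrier n → Carrier} → IsVolumeForm Φ → ∀ A → Φ A ≈ Φ I * Det A
  volumeForm-unique {n} {Φ} V A = begin
    Φ A
      ≈⟨ +-identityʳ _ ⟨
    Φ A + 0#
      ≈⟨ +-congˡ (trans (*-congʳ (-‿inverseˡ (Φ I))) (zeroˡ (Det A))) ⟨
    Φ A + (- Φ I + Φ I) * Det A
      ≈⟨ solve 4 (λ x m y d → x :+ (m :+ y) :* d := (con 1 :* x :+ m :* d) :+ y :* d) refl (Φ A) (- Φ I) (Φ I) (Det A) ⟩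
    (1# * Φ A + - Φ I * Det A) + Φ I * Det A
      ≈⟨ +-congʳ (vanishes (combination-isVolumeForm V det-isVolumeForm 1# (- Φ I)) at-I n ℕP.≤-refl A
           λ i n≤i → contradiction (toℕ<n i) (ℕP.≤⇒≯ n≤i)) ⟩
    0# + Φ I * Det A
      ≈⟨ +-identityˡ _ ⟩
    Φ I * Det A ∎
    where
    at-I : 1# * Φ I + - Φ I * Det {n} I ≈ 0#
    at-I = trans (+-cong (*-identityˡ _) (trans (*-congˡ (det-I n)) (*-identityʳ _))) (-‿inverseʳ _)

  -- The product rule, shears and the adjugate

  infixl 7 _⊗_
  _⊗_ : ∀ {n} → Matrix Carrier n → Matrix Carrier n → Matrix Carrier n
  (A ⊗ B) i k = sum λ j → A i j * B j k

  ⊗-isVolumeForm : ∀ {n} (B : Matrix Carrier n) → IsVolumeForm (λ A → Det (A ⊗ B))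
  ⊗-isVolumeForm B = record
    { Φ-cong = λ eq → det-cong λ i k → sum-cong λ j → *-congʳ (eq i j)
    ; linear = λ i a b A≈B A≈C eq → det-linear i a b
        (λ j j≢i k → sum-cong λ l → *-congʳ (A≈B j j≢i l))
        (λ j j≢i k → sum-cong λ l → *-congʳ (A≈C j j≢i l))
        (λ k → sum-linear a b λ l → trans (*-congʳ (eq l))
          (solve 5 (λ a x b y z → (a :* x :+ b :* y) :* z := a :* (x :* z) :+ b :* (y :* z)) refl a _ b _ _))
    ; alternating = λ i j A i≢j eq → det-alternating i j _ i≢j λ k → sum-cong λ l → *-congʳ (eq l)
    }

  det-⊗ : ∀ {n} (A B : Matrix Carrier n) → Det (A ⊗ B) ≈ Det A * Det B
  det-⊗ A B = begin
    Det (A ⊗ B)           ≈⟨ volumeForm-unique (⊗-isVolumeForm B) A ⟩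
    Det (I ⊗ B) * Det A   ≈⟨ *-congʳ (det-cong λ i k → sum-I* (λ j → B j k) i) ⟩
    Det B * Det A         ≈⟨ *-comm _ _ ⟩
    Det A * Det B         ∎

  shear : ∀ {n} → Vector Carrier n → Matrix Carrier (suc n) → Matrix Carrier (suc n)
  shear t A zero    k = A zero k
  shear t A (suc i) k = t i * A zero k + A (suc i) k

  -- Shearing is multiplication from the left by `shear t I`, whose first row is a basis vector and
  -- whose complementary minor is the identity. It serves to clear an all-ones matrix from the rows
  -- below an all-ones first row.
  det-shear : ∀ {n} t (A : Matrix Carrier (suc n)) → Det (shear t A) ≈ Det A
  det-shear {n} t A = begin
    Det (shear t A)           ≈⟨ det-cong rows ⟩
    Det (shear t I ⊗ A)       ≈⟨ det-⊗ (shear t I) A ⟩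
    Det (shear t I) * Det A   ≈⟨ *-congʳ det-T ⟩
    1# * Det A                ≈⟨ *-identityˡ _ ⟩
    Det A                     ∎
    where
    rows : ∀ i k → shear t A i k ≈ (shear t I ⊗ A) i k
    rows zero    k = sym (sum-I* (λ j → A j k) zero)
    rows (suc i) k = sym (trans
      (sum-linear (t i) 1# λ j → solve 4 (λ t x y a → (t :* x :+ y) :* a := t :* (x :* a) :+ con 1 :* (y :* a))
         refl (t i) (I zero j) (I (suc i) j) (A j k))
      (+-cong (*-congˡ (sum-I* (λ j → A j k) zero)) (trans (*-identityˡ _) (sum-I* (λ j → A j k) (suc i)))))
    det-T : Det (shear t I) ≈ 1#
    det-T = begin
      Det (shear t I)
        ≈⟨ sum-single (λ j → sign j * (I zero j * Det (minor (shear t I) j))) zero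
             (λ j j≢0 → trans (*-congˡ {sign j} (trans (*-congʳ (diag-≢ _ (j≢0 ∘ ≡.sym))) (zeroˡ _))) (zeroʳ _)) ⟩
      1# * (1# * Det (minor (shear t I) zero))
        ≈⟨ trans (*-identityˡ _) (*-identityˡ _) ⟩
      Det (minor (shear t I) zero)
        ≈⟨ det-cong (λ i k → trans (+-cong (zeroʳ (t i)) (diag-suc (λ _ → 1#) i k)) (+-identityˡ _)) ⟩
      Det {n} I
        ≈⟨ det-I n ⟩
      1# ∎

  -- Cofactors are written as determinants with a row replaced by a basis vector instead of signed
  -- minors: `⊗-adjugate` is then just linearity in that row, and the entries obey the general size
  -- bound for determinants.
  adjugate : ∀ {n} → Matrix Carrier n → Matrix Carrier n
  adjugate A k j = Det ([ j ≔ I k ] A)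

  ⊗-adjugate : ∀ {n} (A : Matrix Carrier n) i j → (A ⊗ adjugate A) i j ≈ Det A * I i j
  ⊗-adjugate A i j = begin
    sum (λ k → A i k * Det ([ j ≔ I k ] A))             ≈⟨ expand-row j (A i) I A ⟨
    Det ([ j ≔ (λ l → sum λ k → A i k * I k l) ] A)     ≈⟨ row-cong j A (sum-*I (A i)) ⟩
    Det ([ j ≔ A i ] A)                                 ≈⟨ lemma ⟩
    Det A * I i j                                       ∎
    where
    open IsVolumeForm det-isVolumeForm
    lemma : Det ([ j ≔ A i ] A) ≈ Det A * I i j
    lemma with i ≟ᶠ j
    ... | yes ≡.refl = trans (row-restore i A) (sym (*-identityʳ _))
    ... | no i≢j     = trans (duplicate-row j i A i≢j) (sym (zeroʳ _))

module DistanceLaplacian where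

  open Data.Rational using (ℚ; 0ℚ; 1ℚ; ½; _+_; _*_; _-_; -_; _≤_; _<_; ∣_∣; _/_; 1/_; NonZero; Positive; nonNegative; positive; ↥_; toℚᵘ; mkℚ)
  open Data.Rational.Properties
  open ≡ using (refl; sym; trans; cong; cong₂; subst; subst₂)
  open Data.Rational.Solver.+-*-Solver

  open Determinant +-*-commutativeRing
  open import Algebra.Properties.Semiring.Sum (CommutativeRing.semiring +-*-commutativeRing)
    using (sum; *-distribˡ-sum; *-distribʳ-sum; ∑-distrib-+; ∑-comm)

  -- Ordered arithmetic of ℚ and size bounds for determinants

  ι : ℤ → ℚ
  ι z = z / 1

  private
    toℚᵘ-ι : ∀ z → toℚᵘ (ι z) ℚᵘ.≃ ℚᵘ.mkℚᵘ z 0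
    toℚᵘ-ι z = toℚᵘ-fromℚᵘ (ℚᵘ.mkℚᵘ z 0)

  ι-+ : ∀ a b → ι (a ℤ.+ b) ≡ ι a + ι b
  ι-+ a b = toℚᵘ-injective (begin
    toℚᵘ (ι (a ℤ.+ b))                  ≈⟨ toℚᵘ-ι (a ℤ.+ b) ⟩
    ℚᵘ.mkℚᵘ (a ℤ.+ b) 0                 ≈⟨ ℚᵘ.*≡* (cong (ℤ._* ℤ.+ 1) (cong₂ ℤ._+_ (ℤP.*-identityʳ a) (ℤP.*-identityʳ b))) ⟨
    ℚᵘ.mkℚᵘ a 0 ℚᵘ.+ ℚᵘ.mkℚᵘ b 0        ≈⟨ ℚᵘP.+-cong (toℚᵘ-ι a) (toℚᵘ-ι b) ⟨
    toℚᵘ (ι a) ℚᵘ.+ toℚᵘ (ι b)          ≈⟨ toℚᵘ-homo-+ (ι a) (ι b) ⟨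
    toℚᵘ (ι a + ι b)                    ∎)
    where open import Relation.Binary.Reasoning.Setoid ℚᵘP.≃-setoid

  ι-neg : ∀ a → ι (ℤ.- a) ≡ - ι a
  ι-neg a = toℚᵘ-injective (begin
    toℚᵘ (ι (ℤ.- a))      ≈⟨ toℚᵘ-ι (ℤ.- a) ⟩
    ℚᵘ.- ℚᵘ.mkℚᵘ a 0      ≈⟨ ℚᵘP.-‿cong (toℚᵘ-ι a) ⟨
    ℚᵘ.- toℚᵘ (ι a)       ≈⟨ toℚᵘ-homo‿- (ι a) ⟨
    toℚᵘ (- ι a)          ∎)
    where open import Relation.Binary.Reasoning.Setoid ℚᵘP.≃-setoid

  fromℕ : ℕ → ℚ
  fromℕ k = ι (ℤ.+ k)

  fromℕ-suc : ∀ k → fromℕ (suc k) ≡ 1ℚ + fromℕ k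
  fromℕ-suc k = ι-+ (ℤ.+ 1) (ℤ.+ k)

  -- The denominator is at least 1, so the absolute value of the numerator is large enough.
  ≤-fromℕ : ∀ r → Σ[ k ∈ ℕ ] r ≤ fromℕ k
  ≤-fromℕ r = ℤ.∣ ↥ r ∣ , toℚᵘ-cancel-≤ (ℚᵘP.≤-respʳ-≃ (ℚᵘP.≃-sym (toℚᵘ-ι (ℤ.+ ℤ.∣ ↥ r ∣))) (lemma r))
    where
    lemma : ∀ r → toℚᵘ r ℚᵘ.≤ ℚᵘ.mkℚᵘ (ℤ.+ ℤ.∣ ↥ r ∣) 0
    lemma (mkℚ (ℤ.+ n) d _) = ℚᵘ.*≤* (subst₂ ℤ._≤_ (sym (ℤP.*-identityʳ (ℤ.+ n))) (ℤP.pos-* n (suc d)) (ℤ.+≤+ (ℕP.m≤m*n n (suc d))))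
    lemma (mkℚ -[1+ n ] d _) = ℚᵘ.*≤* ℤ.-≤+

  p≤q⇒0≤q-p : ∀ {p q} → p ≤ q → 0ℚ ≤ q - p
  p≤q⇒0≤q-p {p} {q} p≤q = subst (_≤ q - p) (+-inverseʳ p) (+-monoˡ-≤ (- p) p≤q)

  p<q⇒0<q-p : ∀ {p q} → p < q → 0ℚ < q - p
  p<q⇒0<q-p {p} {q} p<q = subst (_< q - p) (+-inverseʳ p) (+-monoˡ-< (- p) p<q)

  -- The format of most inequalities below: `r` is a certificate, a sum of visibly nonnegative
  -- terms, and the ring solver checks that it equals the difference.
  ≤-from-difference : ∀ {p q} r → q - p ≡ r → 0ℚ ≤ r → p ≤ q
  ≤-from-difference {p} {q} r eq 0≤r = subst₂ _≤_ (+-identityʳ p)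
    (trans (cong (p +_) (sym eq)) (solve 2 (λ p q → p :+ (q :- p) := q) refl p q)) (+-monoʳ-≤ p 0≤r)

  <-from-difference : ∀ {p q} r → q - p ≡ r → 0ℚ < r → p < q
  <-from-difference {p} {q} r eq 0<r = subst₂ _<_ (+-identityʳ p)
    (trans (cong (p +_) (sym eq)) (solve 2 (λ p q → p :+ (q :- p) := q) refl p q)) (+-monoʳ-< p 0<r)

  +-nonNeg : ∀ {p q} → 0ℚ ≤ p → 0ℚ ≤ q → 0ℚ ≤ p + q
  +-nonNeg = +-mono-≤

  +-pos : ∀ {p q} → 0ℚ < p → 0ℚ < q → 0ℚ < p + q
  +-pos = +-mono-<

  *-nonNeg : ∀ {p q} → 0ℚ ≤ p → 0ℚ ≤ q → 0ℚ ≤ p * q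
  *-nonNeg {p} {q} 0≤p 0≤q = nonNegative⁻¹ (p * q) {{nonNeg*nonNeg⇒nonNeg p {{nonNegative 0≤p}} q {{nonNegative 0≤q}}}}

  *-pos : ∀ {p q} → 0ℚ < p → 0ℚ < q → 0ℚ < p * q
  *-pos {p} {q} 0<p 0<q = positive⁻¹ (p * q) {{pos*pos⇒pos p {{positive 0<p}} q {{positive 0<q}}}}

  *-mono-≤ : ∀ {p q r s} → 0ℚ ≤ p → 0ℚ ≤ s → p ≤ q → r ≤ s → p * r ≤ q * s
  *-mono-≤ {p} {q} {r} {s} 0≤p 0≤s p≤q r≤s = ≤-trans
    (*-monoˡ-≤-nonNeg p {{nonNegative 0≤p}} r≤s) (*-monoʳ-≤-nonNeg s {{nonNegative 0≤s}} p≤q)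

  square-nonNeg : ∀ p → 0ℚ ≤ p * p
  square-nonNeg p with ≤-total 0ℚ p
  ... | inj₁ 0≤p = *-nonNeg 0≤p 0≤p
  ... | inj₂ p≤0 = subst (0ℚ ≤_) (solve 1 (λ p → :- p :* :- p := p :* p) refl p)
                     (*-nonNeg (neg-antimono-≤ p≤0) (neg-antimono-≤ p≤0))

  0≤1 : 0ℚ ≤ 1ℚ
  0≤1 = nonNegative⁻¹ 1ℚ

  0<1 : 0ℚ < 1ℚ
  0<1 = positive⁻¹ 1ℚ

  reciprocal : ∀ {p} → 0ℚ < p → Σ[ r ∈ ℚ ] (0ℚ < r × r * p ≡ 1ℚ)
  reciprocal {p} 0<p = 1/ p , positive⁻¹ (1/ p) {{1/pos⇒pos p}} , *-inverseˡ p
    where instance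
      posP : Positive p
      posP = positive 0<p
      nonZeroP : NonZero p
      nonZeroP = pos⇒nonZero p

  ∣p∣≤q : ∀ {p q} → p ≤ q → - p ≤ q → ∣ p ∣ ≤ q
  ∣p∣≤q {p} {q} p≤q -p≤q with ∣p∣≡p∨∣p∣≡-p p
  ... | inj₁ eq = subst (_≤ q) (sym eq) p≤q
  ... | inj₂ eq = subst (_≤ q) (sym eq) -p≤q

  p≤∣p∣ : ∀ p → p ≤ ∣ p ∣
  p≤∣p∣ p with ≤-total 0ℚ p
  ... | inj₁ 0≤p = ≤-reflexive (sym (0≤p⇒∣p∣≡p 0≤p))
  ... | inj₂ p≤0 = ≤-trans p≤0 (0≤∣p∣ p)

  -p≤∣p∣ : ∀ p → - p ≤ ∣ p ∣
  -p≤∣p∣ p = subst (- p ≤_) (∣-p∣≡∣p∣ p) (p≤∣p∣ (- p))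

  sum-mono-≤ : ∀ {n} {f g : Vector ℚ n} → (∀ i → f i ≤ g i) → sum f ≤ sum g
  sum-mono-≤ {zero}  f≤g = ≤-refl
  sum-mono-≤ {suc n} f≤g = +-mono-≤ (f≤g zero) (sum-mono-≤ (f≤g ∘ suc))

  ∣sum∣≤sum∣∣ : ∀ {n} (f : Vector ℚ n) → ∣ sum f ∣ ≤ sum (λ i → ∣ f i ∣)
  ∣sum∣≤sum∣∣ {zero}  f = ≤-refl
  ∣sum∣≤sum∣∣ {suc n} f = ≤-trans (∣p+q∣≤∣p∣+∣q∣ (f zero) (sum (f ∘ suc))) (+-monoʳ-≤ ∣ f zero ∣ (∣sum∣≤sum∣∣ (f ∘ suc)))

  sum-nonNeg : ∀ {n} {f : Vector ℚ n} → (∀ i → 0ℚ ≤ f i) → 0ℚ ≤ sum f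
  sum-nonNeg {zero}  0≤f = ≤-refl
  sum-nonNeg {suc n} 0≤f = +-nonNeg (0≤f zero) (sum-nonNeg (0≤f ∘ suc))

  ∣∣-bounded : ∀ {n} (f : Vector ℚ n) → Σ[ K ∈ ℚ ] (0ℚ ≤ K × (∀ i → ∣ f i ∣ ≤ K))
  ∣∣-bounded {zero}  f = 0ℚ , ≤-refl , λ ()
  ∣∣-bounded {suc n} f with ∣∣-bounded (f ∘ suc)
  ... | K , 0≤K , f≤K = ∣ f zero ∣ + K , +-nonNeg (0≤∣p∣ (f zero)) 0≤K , λ where
    zero    → subst (_≤ ∣ f zero ∣ + K) (+-identityʳ _) (+-monoʳ-≤ ∣ f zero ∣ 0≤K)
    (suc i) → ≤-trans (f≤K i) (subst (_≤ ∣ f zero ∣ + K) (+-identityˡ K) (+-monoˡ-≤ K (0≤∣p∣ (f zero))))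

  matrix-bounded : ∀ {n} (A : Matrix ℚ n) → Σ[ K ∈ ℚ ] (0ℚ ≤ K × (∀ i j → ∣ A i j ∣ ≤ K))
  matrix-bounded A with ∣∣-bounded (λ i → proj₁ (∣∣-bounded (A i)))
  ... | K , 0≤K , rows≤K = K , 0≤K , λ i j →
    ≤-trans (proj₂ (proj₂ (∣∣-bounded (A i))) j) (≤-trans (p≤∣p∣ _) (rows≤K i))

  -- This is n! times the n-th power of `K`, in the shape in which the Laplace expansion produces
  -- it.
  det-bound : ℕ → ℚ → ℚ
  det-bound zero    K = 1ℚ
  det-bound (suc n) K = sum {suc n} λ _ → K * det-bound n K

  det-bound-nonNeg : ∀ n {K} → 0ℚ ≤ K → 0ℚ ≤ det-bound n K
  det-bound-nonNeg zero    0≤K = 0≤1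
  det-bound-nonNeg (suc n) {K} 0≤K = sum-nonNeg {suc n} λ _ → *-nonNeg 0≤K (det-bound-nonNeg n 0≤K)

  ∣sign∣ : ∀ {n} (j : Fin n) → ∣ sign j ∣ ≡ 1ℚ
  ∣sign∣ zero    = refl
  ∣sign∣ (suc j) = trans (∣p*q∣≡∣p∣*∣q∣ (- 1ℚ) (sign j)) (trans (*-identityˡ _) (∣sign∣ j))

  ∣det∣≤det-bound : ∀ {n} (A : Matrix ℚ n) {K} → 0ℚ ≤ K → (∀ i j → ∣ A i j ∣ ≤ K) → ∣ Det A ∣ ≤ det-bound n K
  ∣det∣≤det-bound {zero}  A 0≤K A≤K = ≤-refl
  ∣det∣≤det-bound {suc n} A {K} 0≤K A≤K = ≤-trans
    (∣sum∣≤sum∣∣ λ j → sign j * (A zero j * Det (minor A j))) (sum-mono-≤ λ j → begin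
    ∣ sign j * (A zero j * Det (minor A j)) ∣     ≡⟨ ∣p*q∣≡∣p∣*∣q∣ (sign j) (A zero j * Det (minor A j)) ⟩
    ∣ sign j ∣ * ∣ A zero j * Det (minor A j) ∣   ≡⟨ cong₂ _*_ (∣sign∣ j) (∣p*q∣≡∣p∣*∣q∣ (A zero j) (Det (minor A j))) ⟩
    1ℚ * (∣ A zero j ∣ * ∣ Det (minor A j) ∣)     ≡⟨ *-identityˡ _ ⟩
    ∣ A zero j ∣ * ∣ Det (minor A j) ∣            ≤⟨ *-mono-≤ (0≤∣p∣ (A zero j)) (det-bound-nonNeg n 0≤K) (A≤K zero j)
                                                      (∣det∣≤det-bound (minor A j) 0≤K λ i k → A≤K (suc i) _) ⟩
    K * det-bound n K                             ∎)
    where open ≤-Reasoning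

  -- Rayleigh quotients

  dot : ∀ {n} → Vector ℚ n → Vector ℚ n → ℚ
  dot u v = sum λ i → u i * v i

  act : ∀ {n} → Matrix ℚ n → Vector ℚ n → Vector ℚ n
  act A v i = sum λ j → A i j * v j

  pencil : ∀ {n} → Matrix ℚ n → ℚ → Matrix ℚ n
  pencil M x i j = diag 0ℚ (λ _ → x) i j - M i j

  diag-scalar : ∀ {n} x (i j : Fin n) → diag 0ℚ (λ _ → x) i j ≡ x * I i j
  diag-scalar x i j with i ≟ᶠ j
  ... | yes _ = sym (*-identityʳ x)
  ... | no  _ = sym (*-zeroʳ x)

  dot-cong : ∀ {n} {u u′ v v′ : Vector ℚ n} → (∀ i → u i ≡ u′ i) → (∀ i → v i ≡ v′ i) → dot u v ≡ dot u′ v′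
  dot-cong u≡u′ v≡v′ = sum-cong λ i → cong₂ _*_ (u≡u′ i) (v≡v′ i)

  dot-linearˡ : ∀ {n} a b (u v w : Vector ℚ n) → dot (λ i → a * u i + b * v i) w ≡ a * dot u w + b * dot v w
  dot-linearˡ a b u v w = sum-linear a b λ i →
    solve 5 (λ a u b v w → (a :* u :+ b :* v) :* w := a :* (u :* w) :+ b :* (v :* w)) refl a (u i) b (v i) (w i)

  dot-linearʳ : ∀ {n} a b (u v w : Vector ℚ n) → dot w (λ i → a * u i + b * v i) ≡ a * dot w u + b * dot w v
  dot-linearʳ a b u v w = sum-linear a b λ i →
    solve 5 (λ a u b v w → w :* (a :* u :+ b :* v) := a :* (w :* u) :+ b :* (w :* v)) refl a (u i) b (v i) (w i)

  act-linear : ∀ {n} (A : Matrix ℚ n) a b u v i → act A (λ j → a * u j + b * v j) i ≡ a * act A u i + b * act A v i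
  act-linear A a b u v i = dot-linearʳ a b u v (A i)

  dot-act-symmetric : ∀ {n} {A : Matrix ℚ n} → (∀ i j → A i j ≡ A j i) → ∀ u v → dot u (act A v) ≡ dot (act A u) v
  dot-act-symmetric {A = A} symm u v = begin
    sum (λ i → u i * sum (λ j → A i j * v j))     ≡⟨ sum-cong (λ i → *-distribˡ-sum (u i) (λ j → A i j * v j)) ⟩
    sum (λ i → sum (λ j → u i * (A i j * v j)))   ≡⟨ ∑-comm (λ i j → u i * (A i j * v j)) ⟩
    sum (λ j → sum (λ i → u i * (A i j * v j)))   ≡⟨ sum-cong (λ j → sum-cong λ i →
                                                       trans (cong (λ a → u i * (a * v j)) (symm i j))
                                                         (solve 3 (λ u a v → u :* (a :* v) := a :* u :* v) refl (u i) (A j i) (v j))) ⟩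
    sum (λ j → sum (λ i → A j i * u i * v j))     ≡⟨ sum-cong (λ j → *-distribʳ-sum (v j) (λ i → A j i * u i)) ⟨
    sum (λ j → sum (λ i → A j i * u i) * v j)     ∎
    where open ≡-Reasoning

  dot-act-pencil : ∀ {n} (M : Matrix ℚ n) x u v → dot u (act (pencil M x) v) ≡ x * dot u v + - 1ℚ * dot u (act M v)
  dot-act-pencil M x u v = trans (dot-cong {u = u} (λ _ → refl) act-pencil) (dot-linearʳ x (- 1ℚ) v (act M v) u)
    where
    act-pencil : ∀ i → act (pencil M x) v i ≡ x * v i + - 1ℚ * act M v i
    act-pencil i = trans
      (sum-linear x (- 1ℚ) λ j → trans (cong (λ d → (d - M i j) * v j) (diag-scalar x i j))
        (solve 4 (λ x d m v → (x :* d :- m) :* v := x :* (d :* v) :+ (:- con 1ℚ) :* (m :* v)) refl x (I i j) (M i j) (v j)))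
      (cong (λ s → x * s + - 1ℚ * act M v i) (sum-I* v i))

  pencil-symmetric : ∀ {n} {M : Matrix ℚ n} → (∀ i j → M i j ≡ M j i) → ∀ x i j → pencil M x i j ≡ pencil M x j i
  pencil-symmetric {M = M} symm x i j = cong₂ _-_ diag-symmetric (symm i j)
    where
    diag-symmetric : diag 0ℚ (λ _ → x) i j ≡ diag 0ℚ (λ _ → x) j i
    diag-symmetric with i ≟ᶠ j | j ≟ᶠ i
    ... | yes _    | yes _    = refl
    ... | no _     | no _     = refl
    ... | yes refl | no j≢i   = contradiction refl j≢i
    ... | no i≢j   | yes refl = contradiction refl i≢j

  dot-self-nonNeg : ∀ {n} (v : Vector ℚ n) → 0ℚ ≤ dot v v
  dot-self-nonNeg v = sum-nonNeg λ i → square-nonNeg (v i)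

  x*y≤x²+y² : ∀ x y → ∣ x ∣ * ∣ y ∣ ≤ x * x + y * y
  x*y≤x²+y² x y = subst (∣ x ∣ * ∣ y ∣ ≤_) (cong₂ _+_ (square x) (square y))
    (≤-from-difference ((∣ x ∣ - ∣ y ∣) * (∣ x ∣ - ∣ y ∣) + ∣ x ∣ * ∣ y ∣)
      (solve 2 (λ x y → (x :* x :+ y :* y) :- x :* y := (x :- y) :* (x :- y) :+ x :* y) refl (∣ x ∣) (∣ y ∣))
      (+-nonNeg (square-nonNeg (∣ x ∣ - ∣ y ∣)) (*-nonNeg (0≤∣p∣ x) (0≤∣p∣ y))))
    where
    square : ∀ x → ∣ x ∣ * ∣ x ∣ ≡ x * x
    square x = trans (sym (∣p*q∣≡∣p∣*∣q∣ x x)) (0≤p⇒∣p∣≡p (square-nonNeg x))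

  -- This is 2nK: a product of two coordinates is at most the sum of their squares, and each square
  -- then occurs 2n times.
  form-bound : ℕ → ℚ → ℚ
  form-bound n K = sum {n} (λ _ → K) + sum {n} (λ _ → K)

  form≤form-bound : ∀ {n} (A : Matrix ℚ n) {K} → (∀ i j → ∣ A i j ∣ ≤ K) → ∀ v → dot v (act A v) ≤ form-bound n K * dot v v
  form≤form-bound {n} A {K} A≤K v = begin
    sum (λ i → v i * sum (λ j → A i j * v j))
      ≡⟨ sum-cong (λ i → *-distribˡ-sum (v i) (λ j → A i j * v j)) ⟩
    sum (λ i → sum (λ j → v i * (A i j * v j)))
      ≤⟨ sum-mono-≤ (λ i → sum-mono-≤ λ j → entry i j) ⟩
    sum (λ i → sum (λ j → K * (v i * v i + v j * v j)))
      ≡⟨ sum-cong (λ i → sum-linear (v i * v i) 1ℚ λ j →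
           solve 3 (λ k x y → k :* (x :+ y) := x :* k :+ con 1ℚ :* (k :* y)) refl K (v i * v i) (v j * v j)) ⟩
    sum (λ i → v i * v i * C + 1ℚ * sum (λ j → K * (v j * v j)))
      ≡⟨ sum-cong (λ i → cong (λ s → v i * v i * C + 1ℚ * s) (*-distribˡ-sum K (λ j → v j * v j))) ⟨
    sum (λ i → v i * v i * C + 1ℚ * (K * dot v v))
      ≡⟨ sum-linear C (dot v v) (λ i → solve 4 (λ x c k d → x :* c :+ con 1ℚ :* (k :* d) := c :* x :+ d :* k) refl (v i * v i) C K (dot v v)) ⟩
    C * dot v v + dot v v * C
      ≡⟨ solve 2 (λ c d → c :* d :+ d :* c := (c :+ c) :* d) refl C (dot v v) ⟩
    form-bound n K * dot v v ∎
    where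
    open ≤-Reasoning
    C : ℚ
    C = sum {n} (λ _ → K)
    entry : ∀ i j → v i * (A i j * v j) ≤ K * (v i * v i + v j * v j)
    entry i j = begin
      v i * (A i j * v j)               ≤⟨ p≤∣p∣ _ ⟩
      ∣ v i * (A i j * v j) ∣           ≡⟨ trans (∣p*q∣≡∣p∣*∣q∣ (v i) (A i j * v j)) (cong (∣ v i ∣ *_) (∣p*q∣≡∣p∣*∣q∣ (A i j) (v j))) ⟩
      ∣ v i ∣ * (∣ A i j ∣ * ∣ v j ∣)   ≡⟨ solve 3 (λ x a y → x :* (a :* y) := a :* (x :* y)) refl (∣ v i ∣) (∣ A i j ∣) (∣ v j ∣) ⟩
      ∣ A i j ∣ * (∣ v i ∣ * ∣ v j ∣)   ≤⟨ *-mono-≤ (0≤∣p∣ (A i j)) (+-nonNeg (square-nonNeg (v i)) (square-nonNeg (v j)))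
                                             (A≤K i j) (x*y≤x²+y² (v i) (v j)) ⟩
      K * (v i * v i + v j * v j)       ∎

  -- Says that `x I − M` is positive semidefinite, tested on rational vectors.
  RayleighBound : ∀ {n} → Matrix ℚ n → ℚ → Set
  RayleighBound M x = ∀ v → dot v (act M v) ≤ x * dot v v

  rayleighBound-mono : ∀ {n} (M : Matrix ℚ n) {x y} → x ≤ y → RayleighBound M x → RayleighBound M y
  rayleighBound-mono M x≤y bound v = ≤-trans (bound v) (*-monoʳ-≤-nonNeg (dot v v) {{nonNegative (dot-self-nonNeg v)}} x≤y)

  -- For A = x I − M and u = adj(A) v we have A u = f v; minimising the
  -- nonnegative form of A along t u − v (Cauchy–Schwarz for A) makes it
  -- positive definite with constant f / C.
  rayleighBound-improve : ∀ {n} {M : Matrix ℚ n} → (∀ i j → M i j ≡ M j i) → ∀ {x c C t} →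
    RayleighBound M x → 0ℚ ≤ c → c ≤ Det (pencil M x) → 0ℚ ≤ t → t * C ≡ 1ℚ →
    (∀ v → dot v (act (adjugate (pencil M x)) v) ≤ C * dot v v) → RayleighBound M (x - t * c)
  rayleighBound-improve {M = M} symm {x} {c} {C} {t} bound 0≤c c≤f 0≤t tC≡1 adj≤C v =
    ≤-from-difference
      -- The form at `w` equals `t² f b − 2 t f a + x a − m`. Since `t` is the reciprocal of `C`,
      -- one of the two terms `t f a` combines with `t² f b` into a multiple of `C a − b`; the other
      -- one pays for the decrease `t c` of `x`.
      (dot w (act A w) + t * t * f * (C * a - b) + t * (f - c) * a)
      difference
      (+-nonNeg (+-nonNeg form-nonNeg (*-nonNeg (*-nonNeg (*-nonNeg 0≤t 0≤t) 0≤f) (p≤q⇒0≤q-p b≤Ca)))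
        (*-nonNeg (*-nonNeg 0≤t (p≤q⇒0≤q-p c≤f)) 0≤a))
    where
    A = pencil M x
    f = Det A
    u w : Vector ℚ _
    u = act (adjugate A) v
    w i = t * u i + - 1ℚ * v i
    a = dot v v
    b = dot v u
    m = dot v (act M v)
    0≤a : 0ℚ ≤ a
    0≤a = dot-self-nonNeg v
    0≤f : 0ℚ ≤ f
    0≤f = ≤-trans 0≤c c≤f
    b≤Ca : b ≤ C * a
    b≤Ca = adj≤C v

    Au : ∀ i → act A u i ≡ f * v i
    Au i = begin
      sum (λ j → A i j * sum (λ k → adjugate A j k * v k))    ≡⟨ sum-cong (λ j → *-distribˡ-sum (A i j) (λ k → adjugate A j k * v k)) ⟩
      sum (λ j → sum (λ k → A i j * (adjugate A j k * v k)))  ≡⟨ ∑-comm (λ j k → A i j * (adjugate A j k * v k)) ⟩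
      sum (λ k → sum (λ j → A i j * (adjugate A j k * v k)))  ≡⟨ sum-cong (λ k → trans
                                                                   (sum-cong λ j → sym (*-assoc (A i j) (adjugate A j k) (v k)))
                                                                   (sym (*-distribʳ-sum (v k) λ j → A i j * adjugate A j k))) ⟩
      sum (λ k → (A ⊗ adjugate A) i k * v k)                  ≡⟨ sum-cong (λ k → trans (cong (_* v k) (⊗-adjugate A i k)) (*-assoc f (I i k) (v k))) ⟩
      sum (λ k → f * (I i k * v k))                           ≡⟨ *-distribˡ-sum f (λ k → I i k * v k) ⟨
      f * sum (λ k → I i k * v k)                             ≡⟨ cong (f *_) (sum-I* v i) ⟩
      f * v i                                                 ∎
      where open ≡-Reasoning

    form-nonNeg : 0ℚ ≤ dot w (act A w)
    form-nonNeg = subst (0ℚ ≤_)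
      (trans (solve 2 (λ p q → p :- q := p :+ (:- con 1ℚ) :* q) refl (x * dot w w) (dot w (act M w))) (sym (dot-act-pencil M x w w)))
      (p≤q⇒0≤q-p (bound w))

    dot-·-Au : ∀ z → dot z (act A u) ≡ f * dot z v
    dot-·-Au z = trans
      (sum-cong λ i → trans (cong (z i *_) (Au i)) (solve 3 (λ z f v → z :* (f :* v) := f :* (z :* v)) refl (z i) f (v i)))
      (sym (*-distribˡ-sum f λ i → z i * v i))

    u·v≡b : dot u v ≡ b
    u·v≡b = sum-cong λ i → *-comm (u i) (v i)

    form : dot w (act A w) ≡ t * (t * (f * b) + - 1ℚ * (f * a)) + - 1ℚ * (t * (f * a) + - 1ℚ * (x * a + - 1ℚ * m))
    form = begin
      dot w (act A w)
        ≡⟨ dot-cong {u = w} (λ _ → refl) (act-linear A t (- 1ℚ) u v) ⟩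
      dot w (λ i → t * act A u i + - 1ℚ * act A v i)
        ≡⟨ dot-linearˡ t (- 1ℚ) u v _ ⟩
      t * dot u (λ i → t * act A u i + - 1ℚ * act A v i) + - 1ℚ * dot v (λ i → t * act A u i + - 1ℚ * act A v i)
        ≡⟨ cong₂ (λ p q → t * p + - 1ℚ * q) (dot-linearʳ t (- 1ℚ) (act A u) (act A v) u) (dot-linearʳ t (- 1ℚ) (act A u) (act A v) v) ⟩
      t * (t * dot u (act A u) + - 1ℚ * dot u (act A v)) + - 1ℚ * (t * dot v (act A u) + - 1ℚ * dot v (act A v))
        ≡⟨ cong₂ (λ p q → t * p + - 1ℚ * q)
             (cong₂ (λ p q → t * p + - 1ℚ * q) (trans (dot-·-Au u) (cong (f *_) u·v≡b)) u·Av)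
             (cong₂ (λ p q → t * p + - 1ℚ * q) (dot-·-Au v) (dot-act-pencil M x v v)) ⟩
      t * (t * (f * b) + - 1ℚ * (f * a)) + - 1ℚ * (t * (f * a) + - 1ℚ * (x * a + - 1ℚ * m)) ∎
      where
      open ≡-Reasoning
      u·Av : dot u (act A v) ≡ f * a
      u·Av = trans (dot-act-symmetric (pencil-symmetric symm x) u v)
        (trans (sum-cong λ i → *-comm (act A u i) (v i)) (dot-·-Au v))

    difference : (x - t * c) * a - m ≡ dot w (act A w) + t * t * f * (C * a - b) + t * (f - c) * a
    difference = begin
      (x - t * c) * a - m
        ≡⟨ solve 9 (λ x t c a m f b C one →
             (x :- t :* c) :* a :- m :=
             (t :* (t :* (f :* b) :+ (:- con 1ℚ) :* (f :* a)) :+ (:- con 1ℚ) :* (t :* (f :* a) :+ (:- con 1ℚ) :* (x :* a :+ (:- con 1ℚ) :* m)))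
               :+ (con 1ℚ :* (t :* f :* a) :- t :* t :* f :* b) :+ t :* (f :- c) :* a) refl x t c a m f b C 1ℚ ⟩
      Q + (1ℚ * (t * f * a) - t * t * f * b) + t * (f - c) * a
        ≡⟨ cong (λ e → Q + (e * (t * f * a) - t * t * f * b) + t * (f - c) * a) tC≡1 ⟨
      Q + (t * C * (t * f * a) - t * t * f * b) + t * (f - c) * a
        ≡⟨ solve 7 (λ Q t C f a b c → Q :+ (t :* C :* (t :* f :* a) :- t :* t :* f :* b) :+ t :* (f :- c) :* a
                       := Q :+ t :* t :* f :* (C :* a :- b) :+ t :* (f :- c) :* a) refl Q t C f a b c ⟩
      Q + t * t * f * (C * a - b) + t * (f - c) * a
        ≡⟨ cong (λ e → e + t * t * f * (C * a - b) + t * (f - c) * a) form ⟨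
      dot w (act A w) + t * t * f * (C * a - b) + t * (f - c) * a ∎
      where
      open ≡-Reasoning
      Q = t * (t * (f * b) + - 1ℚ * (f * a)) + - 1ℚ * (t * (f * a) + - 1ℚ * (x * a + - 1ℚ * m))

  p≤p+q : ∀ p {q} → 0ℚ ≤ q → p ≤ p + q
  p≤p+q p {q} 0≤q = subst (_≤ p + q) (+-identityʳ p) (+-monoʳ-≤ p 0≤q)

  p≤q+p : ∀ p {q} → 0ℚ ≤ q → p ≤ q + p
  p≤q+p p {q} 0≤q = subst (_≤ q + p) (+-identityˡ p) (+-monoˡ-≤ p 0≤q)

  ∣diag∣≤ : ∀ {n} x (i j : Fin n) → ∣ diag 0ℚ (λ _ → x) i j ∣ ≤ ∣ x ∣
  ∣diag∣≤ x i j with i ≟ᶠ j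
  ... | yes _ = ≤-refl
  ... | no  _ = 0≤∣p∣ x

  -- Away from the replaced row the entries are at most `r + m`, and in that row at most 1. The
  -- bound is uniform for `x` in a bounded range, which is why one step length serves the whole
  -- descent.
  ∣adjugate-pencil∣≤ : ∀ {n} {M : Matrix ℚ n} {m r x} → (∀ i j → ∣ M i j ∣ ≤ m) → 0ℚ ≤ m → ∣ x ∣ ≤ r →
    ∀ i j → ∣ adjugate (pencil M x) i j ∣ ≤ det-bound n (r + m + 1ℚ)
  ∣adjugate-pencil∣≤ {M = M} {m} {r} {x} M≤m 0≤m x≤r i j = ∣det∣≤det-bound _ 0≤K entry
    where
    K = r + m + 1ℚ
    0≤r+m : 0ℚ ≤ r + m
    0≤r+m = +-nonNeg (≤-trans (0≤∣p∣ x) x≤r) 0≤m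
    0≤K : 0ℚ ≤ K
    0≤K = +-nonNeg 0≤r+m 0≤1
    entry : ∀ k l → ∣ ([ j ≔ I i ] pencil M x) k l ∣ ≤ K
    entry k l with k ≟ᶠ j
    ... | yes refl = subst (λ z → ∣ z ∣ ≤ K) (sym (≔-hit k (I i) (pencil M x) l)) (≤-trans (∣diag∣≤ 1ℚ i l) (p≤q+p 1ℚ 0≤r+m))
    ... | no k≢j   = subst (λ z → ∣ z ∣ ≤ K) (sym (≔-miss (I i) (pencil M x) k k≢j l))
      (≤-trans (∣p-q∣≤∣p∣+∣q∣ (diag 0ℚ (λ _ → x) k l) (M k l))
        (≤-trans (+-mono-≤ (≤-trans (∣diag∣≤ x k l) x≤r) (M≤m k l)) (p≤p+q (r + m) 0≤1)))

  -- `k` limits the number of steps still to be made. The last step may pass below `q`; the bound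
  -- reached there is weakened back to `q`.
  rayleighBound-descent : ∀ {n} (M : Matrix ℚ n) {q X δ} →
    (∀ x → q ≤ x → x ≤ X → RayleighBound M x → RayleighBound M (x - δ)) → 0ℚ ≤ δ →
    ∀ k x → q ≤ x → x ≤ X → x ≤ q + fromℕ k * δ → RayleighBound M x → RayleighBound M q
  rayleighBound-descent M {q = q} {δ = δ} step 0≤δ zero x q≤x x≤X x≤q+0 bound =
    rayleighBound-mono M (subst (x ≤_) (trans (cong (q +_) (*-zeroˡ δ)) (+-identityʳ q)) x≤q+0) bound
  rayleighBound-descent M {q = q} {X} {δ} step 0≤δ (suc k) x q≤x x≤X x≤ bound with ≤-total q (x - δ)
  ... | inj₂ x-δ≤q = rayleighBound-mono M x-δ≤q (step x q≤x x≤X bound)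
  ... | inj₁ q≤x-δ = rayleighBound-descent M step 0≤δ k (x - δ) q≤x-δ
    (≤-trans (≤-from-difference δ (solve 2 (λ x d → x :- (x :- d) := d) refl x δ) 0≤δ) x≤X)
    (≤-from-difference (q + fromℕ (suc k) * δ - x)
      (trans (solve 4 (λ q k d x → (q :+ k :* d) :- (x :- d) := (q :+ (con 1ℚ :+ k) :* d) :- x) refl q (fromℕ k) δ x)
             (cong (λ s → q + s * δ - x) (sym (fromℕ-suc k))))
      (p≤q⇒0≤q-p x≤))
    (step x q≤x x≤X bound)

  -- The largest zero of x ↦ det (x I − M) bounds the Rayleigh quotients: start
  -- from a large x and descend in steps of a fixed size.
  rayleigh : ∀ {n} {M : Matrix ℚ n} → (∀ i j → M i j ≡ M j i) → ∀ {q c} → 0ℚ < c →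
    (∀ x → q ≤ x → c ≤ Det (pencil M x)) → RayleighBound M q
  rayleigh {n} {M} symm {q} {c} 0<c c≤f with matrix-bounded M
  ... | m , 0≤m , M≤m with ≤-total (form-bound n m) q
  ...   | inj₁ X≤q = rayleighBound-mono M X≤q (form≤form-bound M M≤m)
  ...   | inj₂ q≤X = rayleighBound-descent M step (<⇒≤ 0<δ) (proj₁ steps) X q≤X ≤-refl X≤ (form≤form-bound M M≤m)
    where
    X r K C : ℚ
    X = form-bound n m
    r = ∣ q ∣ + ∣ X ∣
    K = det-bound n (r + m + 1ℚ)
    -- `form-bound n K` is only known to be nonnegative; the summand 1 makes `C` invertible.
    C = form-bound n K + 1ℚ
    0≤K : 0ℚ ≤ K
    0≤K = det-bound-nonNeg n (+-nonNeg (+-nonNeg (+-nonNeg (0≤∣p∣ q) (0≤∣p∣ X)) 0≤m) 0≤1)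
    0≤sumK : 0ℚ ≤ sum {n} (λ _ → K)
    0≤sumK = sum-nonNeg {n} λ _ → 0≤K
    0<C : 0ℚ < C
    0<C = +-mono-≤-< (+-nonNeg 0≤sumK 0≤sumK) 0<1
    t δ : ℚ
    t = proj₁ (reciprocal 0<C)
    δ = t * c
    0<t : 0ℚ < t
    0<t = proj₁ (proj₂ (reciprocal 0<C))
    0<δ : 0ℚ < δ
    0<δ = *-pos 0<t 0<c
    step : ∀ x → q ≤ x → x ≤ X → RayleighBound M x → RayleighBound M (x - δ)
    step x q≤x x≤X bound = rayleighBound-improve symm bound (<⇒≤ 0<c) (c≤f x q≤x) (<⇒≤ 0<t) (proj₂ (proj₂ (reciprocal 0<C)))
      λ v → ≤-trans (form≤form-bound (adjugate (pencil M x)) (∣adjugate-pencil∣≤ M≤m 0≤m x≤r) v)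
        (*-monoʳ-≤-nonNeg (dot v v) {{nonNegative (dot-self-nonNeg v)}} (p≤p+q (form-bound n K) 0≤1))
      where
      x≤r : ∣ x ∣ ≤ r
      x≤r = ∣p∣≤q (≤-trans x≤X (≤-trans (p≤∣p∣ X) (p≤q+p (∣ X ∣) (0≤∣p∣ q))))
                  (≤-trans (neg-antimono-≤ q≤x) (≤-trans (-p≤∣p∣ q) (p≤p+q (∣ q ∣) (0≤∣p∣ X))))
    d : ℚ
    d = proj₁ (reciprocal 0<δ)
    steps : Σ[ k ∈ ℕ ] (X - q) * d ≤ fromℕ k
    steps = ≤-fromℕ ((X - q) * d)
    X≤ : X ≤ q + fromℕ (proj₁ steps) * δ
    X≤ = subst (_≤ q + fromℕ (proj₁ steps) * δ)
      (trans (cong (λ e → q + e) (trans (*-assoc (X - q) d δ) (trans (cong ((X - q) *_) (proj₂ (proj₂ (reciprocal 0<δ)))) (*-identityʳ _))))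
        (solve 2 (λ q X → q :+ (X :- q) := X) refl q X))
      (+-monoʳ-≤ q (*-monoʳ-≤-nonNeg δ {{nonNegative (<⇒≤ 0<δ)}} (proj₂ steps)))

  -- Powers and products of rationals

  open RawSemiringDefinitions (RawRing.rawSemiring (CommutativeRing.rawRing +-*-commutativeRing)) using (_^_; product)

  ^-pos : ∀ {p} → 0ℚ < p → ∀ n → 0ℚ < p ^ n
  ^-pos 0<p zero    = 0<1
  ^-pos 0<p (suc n) = *-pos 0<p (^-pos 0<p n)

  ^-nonNeg : ∀ {p} → 0ℚ ≤ p → ∀ n → 0ℚ ≤ p ^ n
  ^-nonNeg 0≤p zero    = 0≤1
  ^-nonNeg 0≤p (suc n) = *-nonNeg 0≤p (^-nonNeg 0≤p n)

  ^≤product : ∀ {n} {f : Vector ℚ n} {p} → 0ℚ ≤ p → (∀ i → p ≤ f i) → p ^ n ≤ product f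
  ^≤product {zero}  0≤p p≤f = ≤-refl
  ^≤product {suc n} 0≤p p≤f = *-mono-≤ 0≤p (≤-trans (^-nonNeg 0≤p n) (^≤product 0≤p (p≤f ∘ suc))) (p≤f zero) (^≤product 0≤p (p≤f ∘ suc))

  ∣product∣ : ∀ {n} (f : Vector ℚ n) → ∣ product f ∣ ≡ product (λ i → ∣ f i ∣)
  ∣product∣ {zero}  f = refl
  ∣product∣ {suc n} f = trans (∣p*q∣≡∣p∣*∣q∣ (f zero) (product (f ∘ suc))) (cong (∣ f zero ∣ *_) (∣product∣ (f ∘ suc)))

  product≤^ : ∀ {n} {f : Vector ℚ n} {p} → (∀ i → 0ℚ ≤ f i) → (∀ i → f i ≤ p) → product f ≤ p ^ n
  product≤^ {zero}  0≤f f≤p = ≤-refl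
  product≤^ {suc n} 0≤f f≤p = *-mono-≤ (0≤f zero) (^-nonNeg (≤-trans (0≤f zero) (f≤p zero)) n) (f≤p zero) (product≤^ (0≤f ∘ suc) (f≤p ∘ suc))

  product-init-last : ∀ {n} (f : Vector ℚ (suc n)) → product f ≡ product (f ∘ inject₁) * f (Fin.fromℕ n)
  product-init-last = ProductProperties.sum-init-last
    where module ProductProperties = Algebra.Properties.CommutativeMonoid.Sum (CommutativeRing.*-commutativeMonoid +-*-commutativeRing)

  product-zero : ∀ {n} (f : Vector ℚ n) i → f i ≡ 0ℚ → product f ≡ 0ℚ
  product-zero f zero    fi≡0 = trans (cong (_* product (f ∘ suc)) fi≡0) (*-zeroˡ (product (f ∘ suc)))
  product-zero f (suc i) fi≡0 = trans (cong (f zero *_) (product-zero (f ∘ suc) i fi≡0)) (*-zeroʳ (f zero))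

  -- The distance Laplacian in terms of the Laplacian of the complement

  2ℚ : ℚ
  2ℚ = 1ℚ + 1ℚ

  I-symmetric : ∀ {n} (i j : Fin n) → I i j ≡ I j i
  I-symmetric i j with i ≟ᶠ j
  ... | yes refl = sym (diag-≡ (λ _ → 1ℚ) i)
  ... | no i≢j   = sym (diag-≢ (λ _ → 1ℚ) (i≢j ∘ sym))

  -- c is the adjacency matrix of the complement.  When G has diameter at most
  -- two, DL below is its distance Laplacian ν I − J + L, with ν the order of G,
  -- J the all-ones matrix and L the Laplacian of the complement.
  module CoLaplacian {m} (c : Matrix ℚ (suc m)) (c-sym : ∀ i j → c i j ≡ c j i) (c-irrefl : ∀ i → c i i ≡ 0ℚ) where

    ν : ℚ
    ν = sum {suc m} (λ _ → 1ℚ)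

    d : Vector ℚ (suc m)
    d i = sum (c i)

    L DL : Matrix ℚ (suc m)
    L i j = d i * I i j - c i j
    DL i j = (ν + d i) * I i j - (1ℚ + c i j)

    d*I-symmetric : ∀ i j → d i * I i j ≡ d j * I j i
    d*I-symmetric i j with i ≟ᶠ j
    ... | yes refl = cong (d i *_) (sym (diag-≡ (λ _ → 1ℚ) i))
    ... | no i≢j   = trans (*-zeroʳ (d i)) (sym (trans (cong (d j *_) (diag-≢ (λ _ → 1ℚ) (i≢j ∘ sym))) (*-zeroʳ (d j))))

    L-symmetric : ∀ i j → L i j ≡ L j i
    L-symmetric i j = cong₂ _-_ (d*I-symmetric i j) (c-sym i j)

    DL≡ : ∀ i j → DL i j ≡ ν * I i j - 1ℚ + L i j
    DL≡ i j = solve 4 (λ n d e c → (n :+ d) :* e :- (con 1ℚ :+ c) := n :* e :- con 1ℚ :+ (d :* e :- c)) refl ν (d i) (I i j) (c i j)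

    DL-symmetric : ∀ i j → DL i j ≡ DL j i
    DL-symmetric i j = trans (DL≡ i j) (trans (cong₂ (λ e l → ν * e - 1ℚ + l) (I-symmetric i j) (L-symmetric i j)) (sym (DL≡ j i)))

    -- x I − DL = (y I − L) + J with y = x − ν.
    shifted : ℚ → Matrix ℚ (suc m)
    shifted y i j = y * I i j - L i j

    pencil-DL : ∀ y i j → pencil DL (y + ν) i j ≡ 1ℚ + shifted y i j
    pencil-DL y i j = trans (cong₂ _-_ (diag-scalar (y + ν) i j) (DL≡ i j))
      (solve 4 (λ y n e l → (y :+ n) :* e :- (n :* e :- con 1ℚ :+ l) := con 1ℚ :+ (y :* e :- l)) refl y ν (I i j) (L i j))

    -- The hypothesis says that `v` is constant along the edges of the complement, in a form that
    -- multiplies into sums. Such vectors lie in the kernel of `L`, taken on the left because the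
    -- determinant lemmas combine rows.
    weighted-L : ∀ (v : Vector ℚ (suc m)) → (∀ i j → c i j * v i ≡ c i j * v j) → ∀ j → sum (λ i → v i * L i j) ≡ 0ℚ
    weighted-L v invariant j = begin
      sum (λ i → v i * L i j)
        ≡⟨ sum-linear 1ℚ (- 1ℚ) {g = λ i → v i * d i * I i j} {λ i → v i * c i j} (λ i → solve 4 (λ v d e c → v :* (d :* e :- c) := con 1ℚ :* (v :* d :* e) :+ (:- con 1ℚ) :* (v :* c)) refl (v i) (d i) (I i j) (c i j)) ⟩
      1ℚ * sum (λ i → v i * d i * I i j) + - 1ℚ * sum (λ i → v i * c i j)
        ≡⟨ cong₂ (λ a b → 1ℚ * a + - 1ℚ * b) (sum-*I (λ i → v i * d i) j)
             (trans (sum-cong λ i → trans (*-comm (v i) (c i j)) (trans (invariant i j) (cong (_* v j) (c-sym i j)))) (sym (*-distribʳ-sum (v j) (c j)))) ⟩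
      1ℚ * (v j * d j) + - 1ℚ * (d j * v j)
        ≡⟨ solve 2 (λ v d → con 1ℚ :* (v :* d) :+ (:- con 1ℚ) :* (d :* v) := con 0ℚ) refl (v j) (d j) ⟩
      0ℚ ∎
      where open ≡-Reasoning

    weighted-shifted : ∀ y (v : Vector ℚ (suc m)) → (∀ i j → c i j * v i ≡ c i j * v j) → ∀ j →
      sum (λ i → v i * shifted y i j) ≡ y * v j
    weighted-shifted y v invariant j = begin
      sum (λ i → v i * shifted y i j)
        ≡⟨ sum-linear y (- 1ℚ) {g = λ i → v i * I i j} {λ i → v i * L i j} (λ i → solve 4 (λ v y e l → v :* (y :* e :- l) := y :* (v :* e) :+ (:- con 1ℚ) :* (v :* l)) refl (v i) y (I i j) (L i j)) ⟩
      y * sum (λ i → v i * I i j) + - 1ℚ * sum (λ i → v i * L i j)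
        ≡⟨ cong₂ (λ a b → y * a + - 1ℚ * b) (sum-*I v j) (weighted-L v invariant j) ⟩
      y * v j + - 1ℚ * 0ℚ
        ≡⟨ solve 1 (λ a → a :+ (:- con 1ℚ) :* con 0ℚ := a) refl (y * v j) ⟩
      y * v j ∎
      where open ≡-Reasoning

    weighted-pencil : ∀ y (v : Vector ℚ (suc m)) → (∀ i j → c i j * v i ≡ c i j * v j) → ∀ j →
      sum (λ i → v i * pencil DL (y + ν) i j) ≡ sum v + y * v j
    weighted-pencil y v invariant j = begin
      sum (λ i → v i * pencil DL (y + ν) i j)
        ≡⟨ sum-linear 1ℚ 1ℚ {g = v} {λ i → v i * shifted y i j} (λ i → trans (cong (v i *_) (pencil-DL y i j))
             (solve 2 (λ v s → v :* (con 1ℚ :+ s) := con 1ℚ :* v :+ con 1ℚ :* (v :* s)) refl (v i) (shifted y i j))) ⟩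
      1ℚ * sum v + 1ℚ * sum (λ i → v i * shifted y i j)
        ≡⟨ cong₂ _+_ (*-identityˡ (sum v)) (trans (*-identityˡ _) (weighted-shifted y v invariant j)) ⟩
      sum v + y * v j ∎
      where open ≡-Reasoning

    -- For `y` = 0 the rows weighted by `v` add up to the constant `sum v`, so they are dependent.
    -- Keeping the factor `v i` for every `i` avoids choosing an index where `v` is nonzero.
    det-pencil-at-ν : ∀ (v : Vector ℚ (suc m)) → (∀ i j → c i j * v i ≡ c i j * v j) → sum v ≡ 0ℚ →
      ∀ i → v i * Det (pencil DL ν) ≡ 0ℚ
    det-pencil-at-ν v invariant sum≡0 i = dependent-rows det-isVolumeForm i v (pencil DL ν) λ j →
      trans (sum-cong λ t → cong (λ x → v t * pencil DL x t j) (sym (+-identityˡ ν)))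
        (trans (weighted-pencil 0ℚ v invariant j)
          (trans (cong₂ _+_ sum≡0 (*-zeroˡ (v j))) (+-identityˡ 0ℚ)))

    ones : Vector ℚ (suc m)
    ones _ = 1ℚ

    -- The determinant of `y I − L` divided by `y`, obtained without dividing. Both this matrix and
    -- its sum with J have constant column sums, `y` and `y + ν`. Replacing the first row by the sum
    -- of all rows extracts these constants, and the same determinant remains in both cases.
    reduced : ℚ → ℚ
    reduced y = Det ([ zero ≔ ones ] shifted y)

    det-constant-column-sums : ∀ {s} A → (∀ j → sum (λ i → 1ℚ * A i j) ≡ s) → Det A ≡ s * Det ([ zero ≔ ones ] A)
    det-constant-column-sums {s} A column-sums = begin
      Det A                                                      ≡⟨ *-identityˡ (Det A) ⟨
      1ℚ * Det A                                                 ≡⟨ combine-rows det-isVolumeForm zero ones A ⟨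
      Det ([ zero ≔ (λ k → sum λ i → 1ℚ * A i k) ] A)            ≡⟨ row-cong zero A (λ k → trans (column-sums k) (sym (*-identityʳ s))) ⟩
      Det ([ zero ≔ (λ k → s * 1ℚ) ] A)                          ≡⟨ scale-≔ zero s ones A ⟩
      s * Det ([ zero ≔ ones ] A)                                ∎
      where
      open ≡-Reasoning
      open IsVolumeForm det-isVolumeForm

    det-shifted : ∀ y → Det (shifted y) ≡ y * reduced y
    det-shifted y = det-constant-column-sums (shifted y) λ j →
      trans (weighted-shifted y ones (λ _ _ → refl) j) (*-identityʳ y)

    -- Once the first row consists of ones, adding J to the other rows is a shear and leaves the
    -- determinant unchanged.
    det-pencil : ∀ y → Det (pencil DL (y + ν)) ≡ (y + ν) * reduced y
    det-pencil y = trans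
      (det-constant-column-sums (pencil DL (y + ν)) λ j →
        trans (weighted-pencil y ones (λ _ _ → refl) j) (trans (cong (ν +_) (*-identityʳ y)) (+-comm ν y)))
      (cong ((y + ν) *_) (trans (det-cong rows) (det-shear (λ _ → 1ℚ) ([ zero ≔ ones ] shifted y))))
      where
      rows : ∀ i j → ([ zero ≔ ones ] pencil DL (y + ν)) i j ≡ shear (λ _ → 1ℚ) ([ zero ≔ ones ] shifted y) i j
      rows zero    j = refl
      rows (suc i) j = pencil-DL y (suc i) j

    det-pencil-at-0 : Det (pencil DL 0ℚ) ≡ 0ℚ
    det-pencil-at-0 = trans (cong (λ x → Det (pencil DL x)) (sym (+-inverseˡ ν)))
      (trans (det-pencil (- ν)) (trans (cong (_* reduced (- ν)) (+-inverseˡ ν)) (*-zeroˡ (reduced (- ν)))))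

    module _ (0≤c : ∀ i j → 0ℚ ≤ c i j) where

      c≤d : ∀ i j → c i j ≤ d i
      c≤d i j = subst (_≤ d i) (sum-*I (λ _ → c i j) j) (sum-mono-≤ entry)
        where
        entry : ∀ k → c i j * I k j ≤ c i k
        entry k with k ≟ᶠ j
        ... | yes refl = ≤-reflexive (*-identityʳ (c i j))
        ... | no _     = ≤-trans (≤-reflexive (*-zeroʳ (c i j))) (0≤c i k)

      c+c≤d : ∀ i j k → j ≢ k → c i j + c i k ≤ d i
      c+c≤d i j k j≢k = subst (_≤ d i)
        (trans (∑-distrib-+ (λ l → c i j * I l j) (λ l → c i k * I l k))
          (cong₂ _+_ (sum-*I (λ _ → c i j) j) (sum-*I (λ _ → c i k) k)))
        (sum-mono-≤ entry)
        where
        entry : ∀ l → c i j * I l j + c i k * I l k ≤ c i l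
        entry l with l ≟ᶠ j | l ≟ᶠ k
        ... | yes refl | yes refl = contradiction refl j≢k
        ... | yes refl | no _     = ≤-reflexive (solve 2 (λ a b → a :* con 1ℚ :+ b :* con 0ℚ := a) refl (c i j) (c i k))
        ... | no _     | yes refl = ≤-reflexive (solve 2 (λ a b → a :* con 0ℚ :+ b :* con 1ℚ := b) refl (c i j) (c i k))
        ... | no _     | no _     = ≤-trans (≤-reflexive (solve 2 (λ a b → a :* con 0ℚ :+ b :* con 0ℚ := con 0ℚ) refl (c i j) (c i k))) (0≤c i l)

    -- The test vector is e_i − e_j.
    rayleigh-at-edge : ∀ {q} → RayleighBound DL q → ∀ i j → c i j ≡ 1ℚ → d i + d j + 2ℚ ≤ (q - ν) + (q - ν)
    -- The test vector has squared norm 2, and `DL` takes the value `2ν + d i + d j + 2` on it; `2ν`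
    -- is subtracted from both sides.
    rayleigh-at-edge {q} bound i j cij≡1 = subst₂ _≤_ left right (+-monoˡ-≤ (- (ν + ν)) (bound v))
      where
      open ≡-Reasoning
      v : Vector ℚ (suc m)
      v k = 1ℚ * I i k + - 1ℚ * I j k
      i≢j : i ≢ j
      i≢j refl with () ← trans (sym (c-irrefl i)) cij≡1
      Iii : ∀ i → I {suc m} i i ≡ 1ℚ
      Iii i = diag-≡ (λ _ → 1ℚ) i
      Iij : I i j ≡ 0ℚ
      Iij = diag-≢ (λ _ → 1ℚ) i≢j
      Iji : I j i ≡ 0ℚ
      Iji = diag-≢ (λ _ → 1ℚ) (i≢j ∘ sym)
      dot-v : ∀ z → dot v z ≡ 1ℚ * z i + - 1ℚ * z j
      dot-v z = trans (dot-linearˡ 1ℚ (- 1ℚ) (I i) (I j) z) (cong₂ (λ a b → 1ℚ * a + - 1ℚ * b) (sum-I* z i) (sum-I* z j))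
      act-v : ∀ k → act DL v k ≡ 1ℚ * DL k i + - 1ℚ * DL k j
      act-v k = trans (sum-cong λ l → *-comm (DL k l) (v l)) (dot-v (DL k))
      right : q * dot v v + - (ν + ν) ≡ (q - ν) + (q - ν)
      right = trans (cong (λ s → q * s + - (ν + ν)) (trans (dot-v v)
          (cong₂ (λ a b → 1ℚ * a + - 1ℚ * b)
            (cong₂ (λ a b → 1ℚ * a + - 1ℚ * b) (Iii i) Iji)
            (cong₂ (λ a b → 1ℚ * a + - 1ℚ * b) Iij (Iii j)))))
        (solve 2 (λ q n → q :* (con 1ℚ :* (con 1ℚ :* con 1ℚ :+ (:- con 1ℚ) :* con 0ℚ) :+ (:- con 1ℚ) :* (con 1ℚ :* con 0ℚ :+ (:- con 1ℚ) :* con 1ℚ)) :+ :- (n :+ n)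
             := (q :- n) :+ (q :- n)) refl q ν)
      entry-≡ : ∀ i → DL i i ≡ ν + d i - 1ℚ
      entry-≡ i = trans (cong₂ (λ e c → (ν + d i) * e - (1ℚ + c)) (Iii i) (c-irrefl i))
        (solve 2 (λ n d → (n :+ d) :* con 1ℚ :- (con 1ℚ :+ con 0ℚ) := n :+ d :- con 1ℚ) refl ν (d i))
      entry-≢ : ∀ i j → I i j ≡ 0ℚ → c i j ≡ 1ℚ → DL i j ≡ - 2ℚ
      entry-≢ i j I≡0 c≡1 = trans (cong₂ (λ e c → (ν + d i) * e - (1ℚ + c)) I≡0 c≡1)
        (solve 2 (λ n d → (n :+ d) :* con 0ℚ :- (con 1ℚ :+ con 1ℚ) := :- (con 1ℚ :+ con 1ℚ)) refl ν (d i))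
      left : dot v (act DL v) + - (ν + ν) ≡ d i + d j + 2ℚ
      left = begin
        dot v (act DL v) + - (ν + ν)
          ≡⟨ cong (_+ - (ν + ν)) (trans (dot-v (act DL v)) (cong₂ (λ a b → 1ℚ * a + - 1ℚ * b) (act-v i) (act-v j))) ⟩
        1ℚ * (1ℚ * DL i i + - 1ℚ * DL i j) + - 1ℚ * (1ℚ * DL j i + - 1ℚ * DL j j) + - (ν + ν)
          ≡⟨ cong (_+ - (ν + ν)) (cong₂ (λ a b → 1ℚ * a + - 1ℚ * b)
               (cong₂ (λ a b → 1ℚ * a + - 1ℚ * b) (entry-≡ i) (entry-≢ i j Iij cij≡1))
               (cong₂ (λ a b → 1ℚ * a + - 1ℚ * b) (entry-≢ j i Iji (trans (c-sym j i) cij≡1)) (entry-≡ j))) ⟩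
        1ℚ * (1ℚ * (ν + d i - 1ℚ) + - 1ℚ * - 2ℚ) + - 1ℚ * (1ℚ * - 2ℚ + - 1ℚ * (ν + d j - 1ℚ)) + - (ν + ν)
          ≡⟨ solve 3 (λ n a b → let one = con 1ℚ; two = con 1ℚ :+ con 1ℚ in
               one :* (one :* (n :+ a :- one) :+ (:- one) :* (:- two)) :+ (:- one) :* (one :* (:- two) :+ (:- one) :* (n :+ b :- one)) :+ :- (n :+ n)
               := a :+ b :+ two) refl ν (d i) (d j) ⟩
        d i + d j + 2ℚ ∎

    -- L² = 2 L makes (y − 2) I + L a cofactor of y I − L.
    module Matching (c-idem : ∀ i j → c i j * c i j ≡ c i j) (c-matching : ∀ i j k → j ≢ k → c i j * c i k ≡ 0ℚ) where

      c*c : ∀ i j k → c i j * c i k ≡ c i j * I j k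
      c*c i j k with j ≟ᶠ k
      ... | yes refl = trans (c-idem i j) (sym (*-identityʳ (c i j)))
      ... | no j≢k   = trans (c-matching i j k j≢k) (sym (*-zeroʳ (c i j)))

      d*c : ∀ i k → d i * c i k ≡ c i k
      d*c i k = trans (*-distribʳ-sum (c i k) (c i)) (trans (sum-cong λ j → c*c i j k) (sum-*I (c i) k))

      d*d : ∀ i → d i * d i ≡ d i
      d*d i = trans (*-distribˡ-sum (d i) (c i)) (sum-cong λ k → d*c i k)

      -- In a matching every walk of length 2 returns to its start, so the square of the adjacency
      -- matrix is the diagonal matrix of degrees.
      c⊗c : ∀ i k → sum (λ j → c i j * c j k) ≡ d i * I i k
      c⊗c i k = trans (sum-cong λ j → trans (cong (_* c j k) (c-sym i j)) (trans (c*c j i k) (cong (_* I i k) (c-sym j i))))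
        (sym (*-distribʳ-sum (I i k) (c i)))

      -- Write L as D - C. Degrees are 0 or 1, so D² = D; edges join vertices of degree 1, so DC =
      -- CD = C; and C² = D.
      L⊗L : ∀ i k → (L ⊗ L) i k ≡ 2ℚ * L i k
      L⊗L i k = begin
        sum (λ j → (d i * I i j - c i j) * L j k)
          ≡⟨ sum-linear (d i) (- 1ℚ) {g = λ j → I i j * L j k} {λ j → c i j * L j k} (λ j → solve 4 (λ d e c l → (d :* e :- c) :* l := d :* (e :* l) :+ (:- con 1ℚ) :* (c :* l)) refl (d i) (I i j) (c i j) (L j k)) ⟩
        d i * sum (λ j → I i j * L j k) + - 1ℚ * sum (λ j → c i j * (d j * I j k - c j k))
          ≡⟨ cong₂ (λ a b → d i * a + - 1ℚ * b) (sum-I* (λ j → L j k) i)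
               (sum-linear 1ℚ (- 1ℚ) {g = λ j → c i j * d j * I j k} {λ j → c i j * c j k} (λ j → solve 4 (λ c d e f → c :* (d :* e :- f) := con 1ℚ :* (c :* d :* e) :+ (:- con 1ℚ) :* (c :* f)) refl (c i j) (d j) (I j k) (c j k))) ⟩
        d i * (d i * I i k - c i k) + - 1ℚ * (1ℚ * sum (λ j → c i j * d j * I j k) + - 1ℚ * sum (λ j → c i j * c j k))
          ≡⟨ cong₂ (λ a b → d i * (d i * I i k - c i k) + - 1ℚ * (1ℚ * a + - 1ℚ * b)) (sum-*I (λ j → c i j * d j) k) (c⊗c i k) ⟩
        d i * (d i * I i k - c i k) + - 1ℚ * (1ℚ * (c i k * d k) + - 1ℚ * (d i * I i k))
          ≡⟨ solve 4 (λ d e c f → d :* (d :* e :- c) :+ (:- con 1ℚ) :* (con 1ℚ :* (c :* f) :+ (:- con 1ℚ) :* (d :* e))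
               := (d :* d) :* e :- d :* c :- f :* c :+ d :* e) refl (d i) (I i k) (c i k) (d k) ⟩
        (d i * d i) * I i k - d i * c i k - d k * c i k + d i * I i k
          ≡⟨ cong₂ (λ a b → a * I i k - b - d k * c i k + d i * I i k) (d*d i) (d*c i k) ⟩
        d i * I i k - c i k - d k * c i k + d i * I i k
          ≡⟨ cong (λ a → d i * I i k - c i k - a + d i * I i k)
               (trans (cong (d k *_) (c-sym i k)) (trans (d*c k i) (c-sym k i))) ⟩
        d i * I i k - c i k - c i k + d i * I i k
          ≡⟨ solve 3 (λ d e c → d :* e :- c :- c :+ d :* e := (con 1ℚ :+ con 1ℚ) :* (d :* e :- c)) refl (d i) (I i k) (c i k) ⟩
        2ℚ * L i k ∎
        where open ≡-Reasoning

      cofactor : ℚ → Matrix ℚ (suc m)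
      cofactor y i j = (y - 2ℚ) * I i j + L i j

      shifted⊗cofactor : ∀ y i k → (shifted y ⊗ cofactor y) i k ≡ diag 0ℚ (λ _ → y * (y - 2ℚ)) i k
      shifted⊗cofactor y i k = begin
        sum (λ j → (y * I i j - L i j) * cofactor y j k)
          ≡⟨ sum-linear y (- 1ℚ) {g = λ j → I i j * cofactor y j k} {λ j → L i j * cofactor y j k} (λ j → solve 4 (λ y e l h → (y :* e :- l) :* h := y :* (e :* h) :+ (:- con 1ℚ) :* (l :* h)) refl y (I i j) (L i j) (cofactor y j k)) ⟩
        y * sum (λ j → I i j * cofactor y j k) + - 1ℚ * sum (λ j → L i j * ((y - 2ℚ) * I j k + L j k))
          ≡⟨ cong₂ (λ a b → y * a + - 1ℚ * b) (sum-I* (λ j → cofactor y j k) i)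
               (sum-linear (y - 2ℚ) 1ℚ {g = λ j → L i j * I j k} {λ j → L i j * L j k} (λ j → solve 4 (λ l z e f → l :* (z :* e :+ f) := z :* (l :* e) :+ con 1ℚ :* (l :* f)) refl (L i j) (y - 2ℚ) (I j k) (L j k))) ⟩
        y * ((y - 2ℚ) * I i k + L i k) + - 1ℚ * ((y - 2ℚ) * sum (λ j → L i j * I j k) + 1ℚ * (L ⊗ L) i k)
          ≡⟨ cong₂ (λ a b → y * ((y - 2ℚ) * I i k + L i k) + - 1ℚ * ((y - 2ℚ) * a + 1ℚ * b)) (sum-*I (L i) k) (L⊗L i k) ⟩
        y * ((y - 2ℚ) * I i k + L i k) + - 1ℚ * ((y - 2ℚ) * L i k + 1ℚ * (2ℚ * L i k))
          ≡⟨ solve 3 (λ y e l → let two = con 1ℚ :+ con 1ℚ in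
               y :* ((y :- two) :* e :+ l) :+ (:- con 1ℚ) :* ((y :- two) :* l :+ con 1ℚ :* (two :* l)) := y :* (y :- two) :* e) refl y (I i k) (L i k) ⟩
        y * (y - 2ℚ) * I i k
          ≡⟨ diag-scalar (y * (y - 2ℚ)) i k ⟨
        diag 0ℚ (λ _ → y * (y - 2ℚ)) i k ∎
        where open ≡-Reasoning

      -- The leading factor `y` completes `reduced y` to the determinant of `y I − L`, whose product
      -- with that of the cofactor is the determinant of a scalar matrix.
      det-pencil-matching : ∀ y → y * Det (pencil DL (y + ν)) * Det (cofactor y) ≡ (y + ν) * (y * (y - 2ℚ)) ^ suc m
      det-pencil-matching y = begin
        y * Det (pencil DL (y + ν)) * Det (cofactor y)
          ≡⟨ cong (λ f → y * f * Det (cofactor y)) (det-pencil y) ⟩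
        y * ((y + ν) * reduced y) * Det (cofactor y)
          ≡⟨ solve 4 (λ y x g h → y :* (x :* g) :* h := x :* ((y :* g) :* h)) refl y (y + ν) (reduced y) (Det (cofactor y)) ⟩
        (y + ν) * ((y * reduced y) * Det (cofactor y))
          ≡⟨ cong (λ f → (y + ν) * (f * Det (cofactor y))) (det-shifted y) ⟨
        (y + ν) * (Det (shifted y) * Det (cofactor y))
          ≡⟨ cong ((y + ν) *_) (det-⊗ (shifted y) (cofactor y)) ⟨
        (y + ν) * Det (shifted y ⊗ cofactor y)
          ≡⟨ cong ((y + ν) *_) (trans (det-cong (shifted⊗cofactor y)) (det-scalar (suc m) (y * (y - 2ℚ)))) ⟩
        (y + ν) * (y * (y - 2ℚ)) ^ suc m ∎
        where open ≡-Reasoning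

  -- Real numbers and roots of the characteristic polynomial

  Eventually : (ℕ → Set) → Set
  Eventually P = Σ[ N ∈ ℕ ] (∀ k → N ℕ.≤ k → P k)

  eventually-map : ∀ {P Q : ℕ → Set} → (∀ k → P k → Q k) → Eventually P → Eventually Q
  eventually-map f (N , p) = N , λ k N≤k → f k (p k N≤k)

  eventually-zip : ∀ {P Q R : ℕ → Set} → (∀ k → P k → Q k → R k) → Eventually P → Eventually Q → Eventually R
  eventually-zip f (M , p) (N , q) = M ℕ.⊔ N , λ k K≤k → f k (p k (ℕP.m⊔n≤o⇒m≤o M N K≤k)) (q k (ℕP.m⊔n≤o⇒n≤o M N K≤k))

  eventually-all : ∀ {n} {P : Fin n → ℕ → Set} → (∀ i → Eventually (P i)) → Eventually (λ k → ∀ i → P i k)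
  eventually-all {zero}  p = 0 , λ _ _ ()
  eventually-all {suc n} p = eventually-zip (λ k p₀ ps → λ { zero → p₀ ; (suc i) → ps i }) (p zero) (eventually-all (p ∘ suc))

  eventually-witness : ∀ {P : ℕ → Set} → Eventually P → ∃ P
  eventually-witness (N , p) = N , p N ℕP.≤-refl

  halve : ∀ {ε} → 0ℚ < ε → Σ[ δ ∈ ℚ ] (0ℚ < δ × δ + δ ≡ ε)
  halve {ε} 0<ε = ½ * ε , *-pos (positive⁻¹ ½) 0<ε , trans (sym (*-distribʳ-+ ε ½ ½)) (*-identityˡ ε)

  <-shift : ∀ p q {r} → p - q < r → p < q + r
  <-shift p q {r} p-q<r = subst (_< q + r) (solve 2 (λ p q → q :+ (p :- q) := p) refl p q) (+-monoʳ-< q p-q<r)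

  ∣-∣<⇒< : ∀ p q {r} → ∣ p - q ∣ < r → p < q + r
  ∣-∣<⇒< p q ∣p-q∣<r = <-shift p q (≤-<-trans (p≤∣p∣ (p - q)) ∣p-q∣<r)

  ∣-∣-sym : ∀ p q → ∣ p - q ∣ ≡ ∣ q - p ∣
  ∣-∣-sym p q = trans (sym (∣-p∣≡∣p∣ (p - q))) (cong ∣_∣ (solve 2 (λ p q → :- (p :- q) := q :- p) refl p q))

  ∣-∣<⇒>  : ∀ p q {r} → ∣ p - q ∣ < r → q < p + r
  ∣-∣<⇒> p q {r} lt = ∣-∣<⇒< q p (subst (_< r) (∣-∣-sym p q) lt)

  ∣p∣<q : ∀ {p q} → p < q → - p < q → ∣ p ∣ < q
  ∣p∣<q {p} {q} p<q -p<q with ∣p∣≡p∨∣p∣≡-p p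
  ... | Data.Sum.inj₁ eq = subst (_< q) (sym eq) p<q
  ... | Data.Sum.inj₂ eq = subst (_< q) (sym eq) -p<q

  module _ (q : ℚ) (x : ℝ) where

    -- From some index `N` on, `x` stays within a quarter `h` of ε of its value there. Comparing
    -- that rational value with `q`, up to `2h`, decides between the desired bound and a permanent
    -- gap `h`, which is excluded.
    fromℚ-≤ᴿ : (∀ δ → 0ℚ < δ → ¬ Eventually (λ k → seq x k + δ ≤ q)) → fromℚ q ≤ᴿ x
    fromℚ-≤ᴿ never = mk≤ λ ε 0<ε → bound 0<ε
      where
      bound : ∀ {ε} → 0ℚ < ε → Eventually (λ k → q < seq x k + ε)
      bound 0<ε with halve 0<ε
      ... | e , 0<e , refl with halve 0<e
      ... | h , 0<h , refl with cauchy x h 0<h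
      ... | N , close with q <? seq x N + (h + h)
      ... | yes q< = N , λ k N≤k → <-trans q< (<-from-difference
              ((seq x k + h - seq x N) + h)
              (solve 3 (λ k a h → k :+ (h :+ h :+ (h :+ h)) :- (a :+ (h :+ h)) := (k :+ h :- a) :+ h) refl (seq x k) (seq x N) h)
              (+-pos (p<q⇒0<q-p (∣-∣<⇒< (seq x N) (seq x k) (close N k ℕP.≤-refl N≤k))) 0<h))
      ... | no q≮ = contradiction
              (N , λ k N≤k → ≤-trans (<⇒≤ (+-monoˡ-< h (∣-∣<⇒< (seq x k) (seq x N) (close k N N≤k ℕP.≤-refl))))
                (subst (_≤ q) (sym (+-assoc (seq x N) h h)) (≮⇒≥ q≮)))
              (never h 0<h)

    ≤ᴿ-fromℚ : (∀ δ → 0ℚ < δ → ¬ Eventually (λ k → q + δ ≤ seq x k)) → x ≤ᴿ fromℚ q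
    ≤ᴿ-fromℚ never = mk≤ λ ε 0<ε → bound 0<ε
      where
      bound : ∀ {ε} → 0ℚ < ε → Eventually (λ k → seq x k < q + ε)
      bound 0<ε with halve 0<ε
      ... | e , 0<e , refl with halve 0<e
      ... | h , 0<h , refl with cauchy x h 0<h
      ... | N , close with seq x N <? q + (h + h)
      ... | yes x< = N , λ k N≤k → <-trans (∣-∣<⇒< (seq x k) (seq x N) (close k N N≤k ℕP.≤-refl)) (<-from-difference
              ((q + (h + h) - seq x N) + h)
              (solve 3 (λ q a h → q :+ (h :+ h :+ (h :+ h)) :- (a :+ h) := (q :+ (h :+ h) :- a) :+ h) refl q (seq x N) h)
              (+-pos (p<q⇒0<q-p x<) 0<h))
      ... | no x≮ = contradiction
              (N , λ k N≤k → ≤-from-difference ((seq x N - (q + (h + h))) + (seq x k + h - seq x N))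
                (solve 4 (λ q a k h → k :- (q :+ h) := (a :- (q :+ (h :+ h))) :+ (k :+ h :- a)) refl q (seq x N) (seq x k) h)
                (+-nonNeg (p≤q⇒0≤q-p (≮⇒≥ x≮)) (p≤q⇒0≤q-p (<⇒≤ (∣-∣<⇒< (seq x N) (seq x k) (close N k ℕP.≤-refl N≤k))))))
              (never h 0<h)

  eventually-bounded : ∀ x → Σ[ R ∈ ℚ ] (0ℚ ≤ R × Eventually (λ k → ∣ seq x k ∣ ≤ R))
  eventually-bounded x with cauchy x 1ℚ 0<1
  ... | N , close = ∣ seq x N ∣ + 1ℚ , +-nonNeg (0≤∣p∣ (seq x N)) 0≤1 , N , λ k N≤k →
    subst (λ z → ∣ z ∣ ≤ ∣ seq x N ∣ + 1ℚ) (solve 2 (λ a b → a :+ (b :- a) := b) refl (seq x N) (seq x k))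
      (≤-trans (∣p+q∣≤∣p∣+∣q∣ (seq x N) (seq x k - seq x N)) (+-monoʳ-≤ ∣ seq x N ∣ (<⇒≤ (close k N N≤k ℕP.≤-refl))))

  eventually-bounded-all : ∀ {n} (∂ : Vector ℝ n) → Σ[ R ∈ ℚ ] (0ℚ ≤ R × Eventually (λ k → ∀ i → ∣ seq (∂ i) k ∣ ≤ R))
  eventually-bounded-all ∂ with ∣∣-bounded (λ i → proj₁ (eventually-bounded (∂ i)))
  ... | R , 0≤R , bounds = R , 0≤R , eventually-all λ i →
    eventually-map (λ k ≤Rᵢ → ≤-trans ≤Rᵢ (≤-trans (p≤∣p∣ _) (bounds i))) (proj₂ (proj₂ (eventually-bounded (∂ i))))

  -- Determinants and products of reals, index by index

  module _ {r s ℓ₁ ℓ₂} (R : RawRing r ℓ₁) (S : RawRing s ℓ₂) (φ : RawRing.Carrier R → RawRing.Carrier S) where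
    private
      module R = RawRing R
      module S = RawRing S
      module RD = RawSemiringDefinitions R.rawSemiring
      module SD = RawSemiringDefinitions S.rawSemiring

    module _ (φ-* : ∀ x y → φ (x R.* y) ≡ φ x S.* φ y) (φ-1 : φ R.1# ≡ S.1#) where

      map-product : ∀ {n} (f : Vector R.Carrier n) → φ (RD.product f) ≡ SD.product (λ i → φ (f i))
      map-product {zero}  f = φ-1
      map-product {suc n} f = trans (φ-* _ _) (cong (φ (f zero) S.*_) (map-product (λ i → f (suc i))))

      map-^ : ∀ x n → φ (x RD.^ n) ≡ φ x SD.^ n
      map-^ x zero    = φ-1
      map-^ x (suc n) = trans (φ-* _ _) (cong (φ x S.*_) (map-^ x n))

      module _ (φ-+ : ∀ x y → φ (x R.+ y) ≡ φ x S.+ φ y) (φ-0 : φ R.0# ≡ S.0#) (φ-- : ∀ x → φ (R.- x) ≡ S.- φ x) where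

        map-sum : ∀ {n} {f : Vector R.Carrier n} {g : Vector S.Carrier n} → (∀ i → φ (f i) ≡ g i) → φ (RD.sum f) ≡ SD.sum g
        map-sum {zero}  eq = φ-0
        map-sum {suc n} eq = trans (φ-+ _ _) (cong₂ S._+_ (eq zero) (map-sum (λ i → eq (suc i))))

        map-det : ∀ {n} {A : Matrix R.Carrier n} {B : Matrix S.Carrier n} → (∀ i j → φ (A i j) ≡ B i j) → φ (det R A) ≡ det S B
        map-det {zero}  eq = φ-1
        map-det {suc n} eq = map-sum λ j → trans (φ-* _ _) (cong₂ S._*_
          (trans (map-^ (R.- R.1#) (toℕ j)) (cong (SD._^ toℕ j) (trans (φ-- R.1#) (cong S.-_ φ-1))))
          (trans (φ-* _ _) (cong₂ S._*_ (eq zero j) (map-det λ i k → eq (suc i) (Fin.punchIn j k)))))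

  ℚ-rawRing : RawRing _ _
  ℚ-rawRing = CommutativeRing.rawRing +-*-commutativeRing

  -- Taking the k-th term of a sequence commutes with the operations of ℝ by definition, so the real
  -- determinant is, at each index, a rational one. This moves the linear algebra to ℚ.
  seq-charPoly : ∀ {n} (M : Matrix ℤ n) x k → seq (charPoly M x) k ≡ Det (pencil (λ i j → ι (M i j)) (seq x k))
  seq-charPoly M x k = map-det ℝ-rawRing ℚ-rawRing (λ x → seq x k)
    (λ _ _ → refl) refl (λ _ _ → refl) refl (λ _ → refl) (λ i j → cong (_- ι (M i j)) (seq-diag i j))
    where
    seq-diag : ∀ i j → seq (diag (fromℚ 0ℚ) (λ _ → x) i j) k ≡ diag 0ℚ (λ _ → seq x k) i j
    seq-diag i j with i ≟ᶠ j
    ... | yes _ = refl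
    ... | no  _ = refl

  seq-product : ∀ {n} (f : Vector ℝ n) k →
    seq (RawSemiringDefinitions.product (RawRing.rawSemiring ℝ-rawRing) f) k ≡ product (λ i → seq (f i) k)
  seq-product f k = map-product ℝ-rawRing ℚ-rawRing (λ x → seq x k) (λ _ _ → refl) refl f

  ^-mono-≤ : ∀ {p q} → 0ℚ ≤ p → p ≤ q → ∀ n → p ^ n ≤ q ^ n
  ^-mono-≤ 0≤p p≤q zero    = ≤-refl
  ^-mono-≤ 0≤p p≤q (suc n) = *-mono-≤ 0≤p (^-nonNeg (≤-trans 0≤p p≤q) n) p≤q (^-mono-≤ 0≤p p≤q n)

  ∣^∣ : ∀ p n → ∣ p ^ n ∣ ≡ ∣ p ∣ ^ n
  ∣^∣ p zero    = refl
  ∣^∣ p (suc n) = trans (∣p*q∣≡∣p∣*∣q∣ p (p ^ n)) (cong (∣ p ∣ *_) (∣^∣ p n))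

  cancel-factor-< : ∀ {p q r} → 0ℚ < p → p * q < p * r → q < r
  cancel-factor-< {p} 0<p = *-cancelˡ-<-nonNeg p {{nonNegative (<⇒≤ 0<p)}}

  module Spectrum {m} (M : Matrix ℤ (suc (suc m))) (D : Matrix ℚ (suc (suc m))) (ιM≡D : ∀ i j → ι (M i j) ≡ D i j)
    (∂ : Vector ℝ (suc (suc m))) (spectrum : IsSpectrum M ∂) where

    seq-charPoly-D : ∀ x k → seq (charPoly M x) k ≡ Det (pencil D (seq x k))
    seq-charPoly-D x k = trans (seq-charPoly M x k) (det-cong λ i j → cong (λ e → diag 0ℚ (λ _ → seq x k) i j - e) (ιM≡D i j))

    sorted : ∀ i j → i Fin.≤ j → ∀ {ε} → 0ℚ < ε → Eventually (λ k → seq (∂ j) k < seq (∂ i) k + ε)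
    sorted i j i≤j {ε} 0<ε = eventually≤ (proj₁ spectrum i j i≤j) ε 0<ε

    factorised : ∀ x {ε} → 0ℚ < ε → Eventually (λ k → ∣ Det (pencil D x) - product (λ i → x - seq (∂ i) k) ∣ < ε)
    factorised x {ε} 0<ε = eventually-map
      (λ k → subst (_< ε) (cong ∣_∣ (cong₂ _-_ (seq-charPoly-D (fromℚ x) k) (seq-product (λ i → fromℚ x -ᴿ ∂ i) k))))
      (eventually≈ (proj₂ spectrum (fromℚ x)) ε 0<ε)

    -- The polynomial identity is taken at the real point `∂ j`, where the j-th factor is exactly 0
    -- at every index.
    root : ∀ j {ε} → 0ℚ < ε → Eventually (λ k → ∣ Det (pencil D (seq (∂ j) k)) ∣ < ε)
    root j {ε} 0<ε = eventually-map
      (λ k → subst (_< ε) (cong ∣_∣ (trans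
        (cong₂ _-_ (seq-charPoly-D (∂ j) k) (trans (seq-product (λ i → ∂ j -ᴿ ∂ i) k)
          (product-zero (λ i → seq (∂ j) k - seq (∂ i) k) j (+-inverseʳ (seq (∂ j) k)))))
        (solve 1 (λ x → x :- con 0ℚ := x) refl (Det (pencil D (seq (∂ j) k)))))))
      (eventually≈ (proj₂ spectrum (∂ j)) ε 0<ε)

  -- μ i k is the k-th rational approximation of the i-th root.
  module Roots {m} (f : ℚ → ℚ) (μ : Fin (suc (suc m)) → ℕ → ℚ)
    (sorted : ∀ i j → i Fin.≤ j → ∀ {ε} → 0ℚ < ε → Eventually (λ k → μ j k < μ i k + ε))
    (factorised : ∀ x {ε} → 0ℚ < ε → Eventually (λ k → ∣ f x - product (λ i → x - μ i k) ∣ < ε))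
    where

    last penultimate : Fin (suc (suc m))
    last = Fin.fromℕ (suc m)
    penultimate = inject₁ (Fin.fromℕ m)

    inject₁≤penultimate : ∀ (i : Fin (suc m)) → inject₁ i Fin.≤ penultimate
    inject₁≤penultimate i = subst₂ ℕ._≤_ (sym (FinP.toℕ-inject₁ i)) (sym (FinP.toℕ-inject₁ (Fin.fromℕ m))) (FinP.≤fromℕ i)

    penultimate≤last : penultimate Fin.≤ last
    penultimate≤last = FinP.≤fromℕ penultimate

    -- With `δ` halved to `p`, approximate sortedness makes every factor at least `p`, so the
    -- product is at least a power of `p`. Half of that power absorbs the error of the
    -- factorisation; the other half is the constant, the same for all `x`.
    positive-above-largest : ∀ {q δ} → 0ℚ < δ → Eventually (λ k → μ zero k + δ ≤ q) →
      Σ[ c ∈ ℚ ] (0ℚ < c × (∀ x → q ≤ x → c ≤ f x))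
    positive-above-largest {q} {δ} 0<δ below with halve 0<δ
    ... | p , 0<p , refl with halve (^-pos 0<p (suc (suc m)))
    ... | c , 0<c , c+c≡pⁿ = c , 0<c , bound
      where
      gap-at : ∀ i k → μ zero k + (p + p) ≤ q → μ i k < μ zero k + p → p ≤ q - μ i k
      gap-at i k ∂₀+δ≤q ∂ᵢ<∂₀+p = ≤-from-difference ((q - (μ zero k + (p + p))) + (μ zero k + p - μ i k))
        (solve 4 (λ q a b p → (q :- b) :- p := (q :- (a :+ (p :+ p))) :+ (a :+ p :- b)) refl q (μ zero k) (μ i k) p)
        (+-nonNeg (p≤q⇒0≤q-p ∂₀+δ≤q) (p≤q⇒0≤q-p (<⇒≤ ∂ᵢ<∂₀+p)))
      gap : Eventually (λ k → ∀ i → p ≤ q - μ i k)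
      gap = eventually-all λ i → eventually-zip (gap-at i) below (sorted zero i ℕ.z≤n 0<p)
      module _ (x : ℚ) (q≤x : q ≤ x) where
        P : ℕ → ℚ
        P k = product (λ i → x - μ i k)
        pⁿ≤P : ∀ k → (∀ i → p ≤ q - μ i k) → p ^ suc (suc m) ≤ P k
        pⁿ≤P k p≤ = ^≤product (<⇒≤ 0<p) λ i → ≤-trans (p≤ i) (+-monoˡ-≤ (- μ i k) q≤x)
        c≤f-at : ∀ k → (∀ i → p ≤ q - μ i k) → ∣ f x - P k ∣ < c → c ≤ f x
        c≤f-at k p≤ close = difference (f x) (P k) (<⇒≤ (∣-∣<⇒> (f x) (P k) close)) (subst (_≤ P k) (sym c+c≡pⁿ) (pⁿ≤P k p≤))
          where
          difference : ∀ y P → P ≤ y + c → c + c ≤ P → c ≤ y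
          difference y P P≤ 2c≤P = ≤-from-difference ((y + c - P) + (P - (c + c)))
            (solve 3 (λ f c P → f :- c := (f :+ c :- P) :+ (P :- (c :+ c))) refl y c P)
            (+-nonNeg (p≤q⇒0≤q-p P≤) (p≤q⇒0≤q-p 2c≤P))
        bound : c ≤ f x
        bound = proj₂ (eventually-witness (eventually-zip c≤f-at gap (factorised x 0<c)))

    -- The product tends to `f x` = 0 while all factors but the last stay bounded away from 0.
    last-root : ∀ {x p} → f x ≡ 0ℚ → 0ℚ < p → Eventually (λ k → ∀ i → p ≤ ∣ x - μ (inject₁ i) k ∣) →
      ∀ {η} → 0ℚ < η → Eventually (λ k → ∣ x - μ last k ∣ < η)
    last-root {x} {p} fx≡0 0<p away {η} 0<η = eventually-zip
      (λ k p≤ close → cancel-factor-< (^-pos 0<p (suc m)) (begin-strict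
        p ^ suc m * ∣ x - μ last k ∣
          ≤⟨ *-monoʳ-≤-nonNeg ∣ x - μ last k ∣ {{nonNegative (0≤∣p∣ (x - μ last k))}} (^≤product (<⇒≤ 0<p) p≤) ⟩
        product (λ i → ∣ x - μ (inject₁ i) k ∣) * ∣ x - μ last k ∣
          ≡⟨ product-init-last (λ i → ∣ x - μ i k ∣) ⟨
        product (λ i → ∣ x - μ i k ∣)
          ≡⟨ ∣product∣ (λ i → x - μ i k) ⟨
        ∣ product (λ i → x - μ i k) ∣
          ≡⟨ ∣-p∣≡∣p∣ (product (λ i → x - μ i k)) ⟨
        ∣ - product (λ i → x - μ i k) ∣
          ≡⟨ cong ∣_∣ (trans (sym (+-identityˡ _)) (cong (_- product (λ i → x - μ i k)) (sym fx≡0))) ⟩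
        ∣ f x - product (λ i → x - μ i k) ∣
          <⟨ close ⟩
        p ^ suc m * η ∎))
      away (factorised x (*-pos (^-pos 0<p (suc m)) 0<η))
      where open ≤-Reasoning

    penultimate-gap : ∀ {q p} → 0ℚ < p → Eventually (λ k → q + (p + p) ≤ μ penultimate k) →
      Eventually (λ k → ∀ i → p ≤ μ (inject₁ i) k - q)
    penultimate-gap {q} {p} 0<p above = eventually-all λ i → eventually-zip
      (λ k q+2p≤ ∂ₚ< → ≤-from-difference ((μ penultimate k - (q + (p + p))) + (μ (inject₁ i) k + p - μ penultimate k))
        (solve 4 (λ n a b p → (a :- n) :- p := (b :- (n :+ (p :+ p))) :+ (a :+ p :- b)) refl q (μ (inject₁ i) k) (μ penultimate k) p)
        (+-nonNeg (p≤q⇒0≤q-p q+2p≤) (p≤q⇒0≤q-p (<⇒≤ ∂ₚ<))))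
      above (sorted (inject₁ i) penultimate (inject₁≤penultimate i) 0<p)

    -- If the penultimate eigenvalue exceeded ν, the last one would have to be
    -- both of the roots 0 and ν.
    penultimate≤ν : ∀ {ν} → 0ℚ < ν → f 0ℚ ≡ 0ℚ → f ν ≡ 0ℚ → ∀ {δ} → 0ℚ < δ → ¬ Eventually (λ k → ν + δ ≤ μ penultimate k)
    penultimate≤ν {ν} 0<ν f0≡0 fν≡0 0<δ above with halve 0<δ
    ... | p , 0<p , refl with halve 0<ν
    ... | h , 0<h , h+h≡ν = clash (eventually-witness (eventually-zip (λ k → _,_)
            (last-root f0≡0 0<p away-0 0<h) (last-root fν≡0 0<p away-ν 0<h)))
      where
      away-ν : Eventually (λ k → ∀ i → p ≤ ∣ ν - μ (inject₁ i) k ∣)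
      away-ν = eventually-map (λ k gap i → ≤-trans (gap i)
        (subst (_≤ ∣ ν - μ (inject₁ i) k ∣) (solve 2 (λ n a → :- (n :- a) := a :- n) refl ν (μ (inject₁ i) k))
          (-p≤∣p∣ (ν - μ (inject₁ i) k)))) (penultimate-gap 0<p above)
      away-0 : Eventually (λ k → ∀ i → p ≤ ∣ 0ℚ - μ (inject₁ i) k ∣)
      away-0 = eventually-map (λ k gap i → ≤-trans (gap i) (≤-trans
        (≤-from-difference ν (solve 2 (λ n a → (:- (con 0ℚ :- a)) :- (a :- n) := n) refl ν (μ (inject₁ i) k)) (<⇒≤ 0<ν))
        (-p≤∣p∣ (0ℚ - μ (inject₁ i) k)))) (penultimate-gap 0<p above)
      clash : (∃ λ k → ∣ 0ℚ - μ last k ∣ < h × ∣ ν - μ last k ∣ < h) → ⊥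
      clash (k , near-0 , near-ν) = <-irrefl refl (begin-strict
        ν                                              ≡⟨ solve 2 (λ n a → n := (n :- a) :+ (:- (con 0ℚ :- a))) refl ν (μ last k) ⟩
        (ν - μ last k) + - (0ℚ - μ last k)         ≤⟨ +-mono-≤ (p≤∣p∣ (ν - μ last k)) (-p≤∣p∣ (0ℚ - μ last k)) ⟩
        ∣ ν - μ last k ∣ + ∣ 0ℚ - μ last k ∣       <⟨ +-mono-< near-ν near-0 ⟩
        h + h                                          ≡⟨ h+h≡ν ⟩
        ν                                              ∎)
        where open ≤-Reasoning

    module Matching (N : ℕ) (H : ℚ → ℚ) (ν : ℚ) (4≤ν : 2ℚ + 2ℚ ≤ ν)
      (identity : ∀ y → y * f (y + ν) * H y ≡ (y + ν) * (y * (y - 2ℚ)) ^ N)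
      (H-bounded : ∀ R → 0ℚ ≤ R → Σ[ B ∈ ℚ ] (0ℚ ≤ B × (∀ y → ∣ y ∣ ≤ R → ∣ H y ∣ ≤ B)))
      (root : ∀ j {ε} → 0ℚ < ε → Eventually (λ k → ∣ f (μ j k) ∣ < ε))
      (μ-bound : ℚ) (0≤μ-bound : 0ℚ ≤ μ-bound) (μ-bounded : Eventually (λ k → ∀ i → ∣ μ i k ∣ ≤ μ-bound)) where

      -- The right-hand side of `identity` at `y` = `x − ν`. It is a multiple of `f`, with cofactor
      -- bounded on bounded sets, so wherever `f` is small `P` is small, and the zeros of `P` are
      -- explicit.
      P : ℚ → ℚ
      P x = x * ((x - ν) * (x - ν - 2ℚ)) ^ N

      0<ν : 0ℚ < ν
      0<ν = <-≤-trans (positive⁻¹ (2ℚ + 2ℚ)) 4≤ν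

      0≤ν : 0ℚ ≤ ν
      0≤ν = <⇒≤ 0<ν

      P=O[f] : ∀ R → 0ℚ ≤ R → Σ[ B ∈ ℚ ] (0ℚ < B × (∀ x → ∣ x ∣ ≤ R → ∣ P x ∣ ≤ B * ∣ f x ∣))
      P=O[f] R 0≤R with H-bounded (R + ν) (+-nonNeg 0≤R 0≤ν)
      -- The summand 1 makes the constant positive, so that `P-root` can divide by it.
      ... | B , 0≤B , H≤B = (R + ν) * B + 1ℚ , +-mono-≤-< (*-nonNeg 0≤R+ν 0≤B) 0<1 , bound
        where
        open ≤-Reasoning
        0≤R+ν : 0ℚ ≤ R + ν
        0≤R+ν = +-nonNeg 0≤R 0≤ν
        bound : ∀ x → ∣ x ∣ ≤ R → ∣ P x ∣ ≤ ((R + ν) * B + 1ℚ) * ∣ f x ∣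
        bound x x≤R = begin
          ∣ P x ∣                          ≡⟨ cong ∣_∣ (trans (cong (_* (y * (y - 2ℚ)) ^ N) (sym y+ν≡x)) (sym (identity y))) ⟩
          ∣ y * f (y + ν) * H y ∣          ≡⟨ trans (∣p*q∣≡∣p∣*∣q∣ (y * f (y + ν)) (H y)) (cong (_* ∣ H y ∣) (∣p*q∣≡∣p∣*∣q∣ y (f (y + ν)))) ⟩
          ∣ y ∣ * ∣ f (y + ν) ∣ * ∣ H y ∣  ≡⟨ cong (λ z → ∣ y ∣ * ∣ f z ∣ * ∣ H y ∣) y+ν≡x ⟩
          ∣ y ∣ * ∣ f x ∣ * ∣ H y ∣        ≡⟨ solve 3 (λ y f h → y :* f :* h := (y :* h) :* f) refl (∣ y ∣) (∣ f x ∣) (∣ H y ∣) ⟩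
          ∣ y ∣ * ∣ H y ∣ * ∣ f x ∣        ≤⟨ *-monoʳ-≤-nonNeg ∣ f x ∣ {{nonNegative (0≤∣p∣ (f x))}}
                                                (≤-trans (*-mono-≤ (0≤∣p∣ y) 0≤B y≤ (H≤B y y≤)) (p≤p+q _ 0≤1)) ⟩
          ((R + ν) * B + 1ℚ) * ∣ f x ∣     ∎
          where
          y : ℚ
          y = x - ν
          y+ν≡x : y + ν ≡ x
          y+ν≡x = solve 2 (λ x n → x :- n :+ n := x) refl x ν
          y≤ : ∣ y ∣ ≤ R + ν
          y≤ = ≤-trans (∣p-q∣≤∣p∣+∣q∣ x ν) (+-mono-≤ x≤R (≤-reflexive (0≤p⇒∣p∣≡p 0≤ν)))

      P-root : ∀ j {η} → 0ℚ < η → Eventually (λ k → ∣ P (μ j k) ∣ < η)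
      P-root j {η} 0<η = from-O (P=O[f] μ-bound 0≤μ-bound)
        where
        module _ (B B⁻¹ : ℚ) (0<B : 0ℚ < B) (B⁻¹B≡1 : B⁻¹ * B ≡ 1ℚ) (P≤ : ∀ x → ∣ x ∣ ≤ μ-bound → ∣ P x ∣ ≤ B * ∣ f x ∣) where
          cancel : B * (B⁻¹ * η) ≡ η
          cancel = trans (solve 3 (λ b c e → b :* (c :* e) := (c :* b) :* e) refl B B⁻¹ η) (trans (cong (_* η) B⁻¹B≡1) (*-identityˡ η))
          at : ∀ k → (∀ i → ∣ μ i k ∣ ≤ μ-bound) → ∣ f (μ j k) ∣ < B⁻¹ * η → ∣ P (μ j k) ∣ < η
          at k bounded small = ≤-<-trans (P≤ (μ j k) (bounded j))
            (subst (B * ∣ f (μ j k) ∣ <_) cancel (*-monoʳ-<-pos B {{positive 0<B}} small))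
        from-O : Σ[ B ∈ ℚ ] (0ℚ < B × (∀ x → ∣ x ∣ ≤ μ-bound → ∣ P x ∣ ≤ B * ∣ f x ∣)) → Eventually (λ k → ∣ P (μ j k) ∣ < η)
        from-O (B , 0<B , P≤) = from-reciprocal (reciprocal 0<B)
          where
          from-reciprocal : Σ[ r ∈ ℚ ] (0ℚ < r × r * B ≡ 1ℚ) → Eventually (λ k → ∣ P (μ j k) ∣ < η)
          from-reciprocal (B⁻¹ , 0<B⁻¹ , B⁻¹B≡1) = eventually-zip (at B B⁻¹ 0<B B⁻¹B≡1 P≤) μ-bounded (root j (*-pos 0<B⁻¹ 0<η))

      -- Beyond `ν + 2 + δ` the factors `x` and `x − ν` are at least 1 and `x − ν − 2` is at least
      -- `δ`, which keeps `P` away from 0.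
      largest≤ν+2 : ∀ {δ} → 0ℚ < δ → ¬ Eventually (λ k → ν + 2ℚ + δ ≤ μ zero k)
      largest≤ν+2 {δ} 0<δ above = proj₂ (eventually-witness (eventually-zip
        (λ k x≥ small → <-irrefl refl (≤-<-trans (at (μ zero k) x≥) small)) above (P-root zero (^-pos 0<δ N))))
        where
        at : ∀ x → ν + 2ℚ + δ ≤ x → δ ^ N ≤ ∣ P x ∣
        at x x≥ = begin
          δ ^ N                                      ≡⟨ *-identityˡ _ ⟨
          1ℚ * δ ^ N                                 ≤⟨ *-mono-≤ 0≤1 (^-nonNeg 0≤q N) 1≤x (^-mono-≤ (<⇒≤ 0<δ) δ≤q N) ⟩
          x * ((x - ν) * (x - ν - 2ℚ)) ^ N           ≤⟨ p≤∣p∣ (P x) ⟩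
          ∣ P x ∣                                              ∎
          where
          open ≤-Reasoning
          e : ℚ
          e = x - (ν + 2ℚ + δ)
          0≤e : 0ℚ ≤ e
          0≤e = p≤q⇒0≤q-p x≥
          δ≤y-2 : δ ≤ x - ν - 2ℚ
          δ≤y-2 = ≤-from-difference e (solve 4 (λ x n t d → x :- n :- t :- d := x :- (n :+ t :+ d)) refl x ν 2ℚ δ) 0≤e
          1≤y : 1ℚ ≤ x - ν
          1≤y = ≤-from-difference (e + (1ℚ + δ)) (solve 3 (λ x n d → let one = con 1ℚ in x :- n :- one := (x :- (n :+ (one :+ one) :+ d)) :+ (one :+ d)) refl x ν δ)
            (+-nonNeg 0≤e (+-nonNeg 0≤1 (<⇒≤ 0<δ)))
          1≤x : 1ℚ ≤ x
          1≤x = ≤-from-difference ((x - ν - 1ℚ) + ν) (solve 2 (λ x n → x :- con 1ℚ := (x :- n :- con 1ℚ) :+ n) refl x ν) (+-nonNeg (p≤q⇒0≤q-p 1≤y) 0≤ν)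
          δ≤q : δ ≤ (x - ν) * (x - ν - 2ℚ)
          δ≤q = subst (_≤ _) (*-identityˡ δ) (*-mono-≤ 0≤1 (≤-trans (<⇒≤ 0<δ) δ≤y-2) 1≤y δ≤y-2)
          0≤q : 0ℚ ≤ (x - ν) * (x - ν - 2ℚ)
          0≤q = ≤-trans (<⇒≤ 0<δ) δ≤q

      q≤∣∣ : ∀ {p} x → 0ℚ ≤ p → x ≤ ν - p → p ≤ ∣ (x - ν) * (x - ν - 2ℚ) ∣
      q≤∣∣ {p} x 0≤p x≤ = ≤-trans
        (subst₂ _≤_ (*-identityʳ p) (solve 3 (λ x n t → (:- (x :- n)) :* (:- (x :- n :- t)) := (x :- n) :* (x :- n :- t)) refl x ν 2ℚ)
          (*-mono-≤ 0≤p (≤-trans 0≤1 1≤) p≤ 1≤))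
        (p≤∣p∣ _)
        where
        e : ℚ
        e = (ν - p) - x
        0≤e : 0ℚ ≤ e
        0≤e = p≤q⇒0≤q-p x≤
        p≤ : p ≤ - (x - ν)
        p≤ = ≤-from-difference e (solve 3 (λ x n p → (:- (x :- n)) :- p := (n :- p) :- x) refl x ν p) 0≤e
        1≤ : 1ℚ ≤ - (x - ν - 2ℚ)
        1≤ = ≤-from-difference (e + (p + 1ℚ)) (solve 3 (λ x n p → let one = con 1ℚ in (:- (x :- n :- (one :+ one))) :- one := ((n :- p) :- x) :+ (p :+ one)) refl x ν p)
          (+-nonNeg 0≤e (+-nonNeg 0≤p 0≤1))

      -- Up to `ν − p` the numbers `ν − x` and `ν + 2 − x` are at least `p` and 1, so only the
      -- linear factor `x` can make `P` small.
      p^*∣x∣≤∣P∣ : ∀ {p} x → 0ℚ ≤ p → x ≤ ν - p → p ^ N * ∣ x ∣ ≤ ∣ P x ∣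
      p^*∣x∣≤∣P∣ {p} x 0≤p x≤ = begin
        p ^ N * ∣ x ∣                                     ≤⟨ *-monoʳ-≤-nonNeg ∣ x ∣ {{nonNegative (0≤∣p∣ x)}} (^-mono-≤ 0≤p (q≤∣∣ x 0≤p x≤) N) ⟩
        ∣ (x - ν) * (x - ν - 2ℚ) ∣ ^ N * ∣ x ∣            ≡⟨ cong (_* ∣ x ∣) (∣^∣ ((x - ν) * (x - ν - 2ℚ)) N) ⟨
        ∣ ((x - ν) * (x - ν - 2ℚ)) ^ N ∣ * ∣ x ∣          ≡⟨ *-comm _ (∣ x ∣) ⟩
        ∣ x ∣ * ∣ ((x - ν) * (x - ν - 2ℚ)) ^ N ∣          ≡⟨ ∣p*q∣≡∣p∣*∣q∣ x (((x - ν) * (x - ν - 2ℚ)) ^ N) ⟨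
        ∣ P x ∣                                                     ∎
        where open ≤-Reasoning

      tends-to-0 : ∀ j {p} → 0ℚ < p → Eventually (λ k → μ j k ≤ ν - p) → ∀ {η} → 0ℚ < η → Eventually (λ k → ∣ μ j k ∣ < η)
      tends-to-0 j {p} 0<p below {η} 0<η = eventually-zip
        (λ k x≤ small → cancel-factor-< (^-pos 0<p N) (≤-<-trans (p^*∣x∣≤∣P∣ (μ j k) (<⇒≤ 0<p) x≤) small))
        below (P-root j (*-pos (^-pos 0<p N) 0<η))

      -- Evaluate at a small `η`. With two roots closer to 0 than `η`, the product has two factors
      -- of size at most `2η`, so `f η` is of order `η²`; but `P η` is at least `η` and is bounded
      -- by a constant times `f η`.
      no-double-zero : (∀ {η} → 0ℚ < η → Eventually (λ k → ∣ μ penultimate k ∣ < η)) →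
        (∀ {η} → 0ℚ < η → Eventually (λ k → ∣ μ last k ∣ < η)) → ⊥
      no-double-zero penultimate→0 last→0 = from-O (P=O[f] 1ℚ 0≤1)
        where
        open ≤-Reasoning
        C : ℚ
        C = μ-bound + 1ℚ
        0≤C : 0ℚ ≤ C
        0≤C = +-nonNeg 0≤μ-bound 0≤1
        Near0 : ℚ → ℕ → Set
        Near0 η k = (∣ μ penultimate k ∣ < η) × (∣ μ last k ∣ < η)

        product-small : ∀ η k → 0ℚ < η → η ≤ 1ℚ → (∀ i → ∣ μ i k ∣ ≤ μ-bound) → Near0 η k →
          ∣ product (λ i → η - μ i k) ∣ ≤ C ^ m * (η + η) * (η + η)
        product-small η k 0<η η≤1 bounded (pen , lst) = begin
          ∣ product (λ i → η - μ i k) ∣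
            ≡⟨ ∣product∣ (λ i → η - μ i k) ⟩
          product g
            ≡⟨ trans (product-init-last g) (cong (_* g last) (product-init-last (λ i → g (inject₁ i)))) ⟩
          product (λ i → g (inject₁ (inject₁ i))) * g penultimate * g last
            ≤⟨ *-mono-≤ (*-nonNeg 0≤∏ (0≤∣p∣ (η - μ penultimate k))) 0≤2η
                 (*-mono-≤ 0≤∏ 0≤2η (product≤^ (λ i → 0≤∣p∣ (η - μ (inject₁ (inject₁ i)) k)) λ i → factor≤ (inject₁ (inject₁ i))) (near penultimate pen))
                 (near last lst) ⟩
          C ^ m * (η + η) * (η + η) ∎
          where
          g : Vector ℚ (suc (suc m))
          g i = ∣ η - μ i k ∣
          0≤2η : 0ℚ ≤ η + η
          0≤2η = <⇒≤ (+-pos 0<η 0<η)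
          ∣η∣≡η : ∣ η ∣ ≡ η
          ∣η∣≡η = 0≤p⇒∣p∣≡p (<⇒≤ 0<η)
          0≤∏ : 0ℚ ≤ product (λ i → g (inject₁ (inject₁ i)))
          0≤∏ = subst (0ℚ ≤_) (∣product∣ (λ i → η - μ (inject₁ (inject₁ i)) k)) (0≤∣p∣ _)
          factor≤ : ∀ i → g i ≤ C
          factor≤ i = ≤-trans (∣p-q∣≤∣p∣+∣q∣ η (μ i k))
            (subst (∣ η ∣ + ∣ μ i k ∣ ≤_) (+-comm 1ℚ μ-bound) (+-mono-≤ (≤-trans (≤-reflexive ∣η∣≡η) η≤1) (bounded i)))
          near : ∀ i → ∣ μ i k ∣ < η → g i ≤ η + η
          near i small = ≤-trans (∣p-q∣≤∣p∣+∣q∣ η (μ i k)) (+-mono-≤ (≤-reflexive ∣η∣≡η) (<⇒≤ small))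

        module _ (B : ℚ) (0<B : 0ℚ < B) (P≤ : ∀ x → ∣ x ∣ ≤ 1ℚ → ∣ P x ∣ ≤ B * ∣ f x ∣) where
          K : ℚ
          -- Chosen so that `B` times the bound on `f η` is `K η²`: the factors `2η` contribute 4,
          -- the tolerated error `η²` contributes 1, and `C` bounds each remaining factor. With `η`
          -- the reciprocal of `K + 1` this falls short of `η`.
          K = B * (C ^ m * (2ℚ * 2ℚ) + 1ℚ)
          0≤K : 0ℚ ≤ K
          0≤K = *-nonNeg (<⇒≤ 0<B) (+-nonNeg (*-nonNeg (^-nonNeg 0≤C m) (nonNegative⁻¹ (2ℚ * 2ℚ))) 0≤1)

          module _ (η : ℚ) (0<η : 0ℚ < η) (η[K+1]≡1 : η * (K + 1ℚ) ≡ 1ℚ) where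
            η≤1 : η ≤ 1ℚ
            η≤1 = ≤-from-difference (η * K)
              (trans (cong (_- η) (sym η[K+1]≡1)) (solve 2 (λ h k → h :* (k :+ con 1ℚ) :- h := h :* k) refl η K))
              (*-nonNeg (<⇒≤ 0<η) 0≤K)
            ∣η∣≤1 : ∣ η ∣ ≤ 1ℚ
            ∣η∣≤1 = ≤-trans (≤-reflexive (0≤p⇒∣p∣≡p (<⇒≤ 0<η))) η≤1

            η≤∣P∣ : η ≤ ∣ P η ∣
            η≤∣P∣ = begin
              η                   ≤⟨ p≤∣p∣ η ⟩
              ∣ η ∣               ≡⟨ *-identityˡ _ ⟨
              1ℚ * ∣ η ∣          ≡⟨ cong (_* ∣ η ∣) (1^ N) ⟨
              -- Since `ν` is at least 4, the point `η` lies below `ν − 1`, so the estimate applies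
              -- with `p` = 1.
              1ℚ ^ N * ∣ η ∣      ≤⟨ p^*∣x∣≤∣P∣ η 0≤1 (≤-trans η≤1 1≤ν-1) ⟩
              ∣ P η ∣             ∎
              where
              1^ : ∀ n → 1ℚ ^ n ≡ 1ℚ
              1^ zero    = refl
              1^ (suc n) = trans (*-identityˡ _) (1^ n)
              1≤ν-1 : 1ℚ ≤ ν - 1ℚ
              1≤ν-1 = ≤-trans (≤-trans 1≤3 (≤-reflexive refl)) (+-monoˡ-≤ (- 1ℚ) 4≤ν)
                where
                1≤3 : 1ℚ ≤ 2ℚ + 2ℚ - 1ℚ
                1≤3 = ≤-from-difference 2ℚ refl (nonNegative⁻¹ 2ℚ)

            contradiction-at : ∀ k → (∀ i → ∣ μ i k ∣ ≤ μ-bound) → Near0 η k → ∣ f η - product (λ i → η - μ i k) ∣ < η * η → ⊥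
            contradiction-at k bounded near close = <-irrefl refl (begin-strict
              η                                                    ≤⟨ ≤-trans η≤∣P∣ (P≤ η ∣η∣≤1) ⟩
              B * ∣ f η ∣                                          ≤⟨ *-monoˡ-≤-nonNeg B {{nonNegative (<⇒≤ 0<B)}} ∣f∣≤ ⟩
              B * (C ^ m * (η + η) * (η + η) + η * η)              ≡⟨ solve 3 (λ b c h → let two = con 1ℚ :+ con 1ℚ in b :* (c :* (h :+ h) :* (h :+ h) :+ h :* h) := (b :* (c :* (two :* two) :+ con 1ℚ)) :* h :* h) refl B (C ^ m) η ⟩
              K * η * η                                            <⟨ <-from-difference (η * η) (solve 2 (λ k h → h :* (k :+ con 1ℚ) :* h :- k :* h :* h := h :* h) refl K η) (*-pos 0<η 0<η) ⟩
              η * (K + 1ℚ) * η                                     ≡⟨ trans (cong (_* η) η[K+1]≡1) (*-identityˡ η) ⟩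
              η                                                    ∎)
              where
              Q : ℚ
              Q = product (λ i → η - μ i k)
              ∣f∣≤ : ∣ f η ∣ ≤ C ^ m * (η + η) * (η + η) + η * η
              ∣f∣≤ = subst (λ z → ∣ z ∣ ≤ _) (solve 2 (λ q f → q :+ (f :- q) := f) refl Q (f η))
                (≤-trans (∣p+q∣≤∣p∣+∣q∣ Q (f η - Q)) (+-mono-≤ (product-small η k 0<η η≤1 bounded near) (<⇒≤ close)))

            impossible : ⊥
            impossible = proj₂ (eventually-witness (eventually-zip (λ k (bounded , near) close → contradiction-at k bounded near close)
              (eventually-zip (λ k → _,_) μ-bounded (eventually-zip (λ k → _,_) (penultimate→0 0<η) (last→0 0<η)))
              (factorised η (*-pos 0<η 0<η))))

        from-O : Σ[ B ∈ ℚ ] (0ℚ < B × (∀ x → ∣ x ∣ ≤ 1ℚ → ∣ P x ∣ ≤ B * ∣ f x ∣)) → ⊥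
        from-O (B , 0<B , P≤) = from-reciprocal (reciprocal (+-mono-≤-< (0≤K B 0<B P≤) 0<1))
          where
          from-reciprocal : Σ[ η ∈ ℚ ] (0ℚ < η × η * (K B 0<B P≤ + 1ℚ) ≡ 1ℚ) → ⊥
          from-reciprocal (η , 0<η , eq) = impossible B 0<B P≤ η 0<η eq

      -- If the penultimate root stayed below `ν`, so would the last one; both would then tend to 0,
      -- the only root of `P` below `ν`.
      penultimate≥ν : ∀ {δ} → 0ℚ < δ → ¬ Eventually (λ k → μ penultimate k + δ ≤ ν)
      penultimate≥ν {δ} 0<δ below = from-half (halve 0<δ)
        where
        from-half : Σ[ p ∈ ℚ ] (0ℚ < p × p + p ≡ δ) → ⊥
        from-half (p , 0<p , p+p≡δ) = no-double-zero (tends-to-0 penultimate 0<p below-penultimate) (tends-to-0 last 0<p below-last)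
          where
          e≥0 : ∀ k → μ penultimate k + δ ≤ ν → 0ℚ ≤ ν - (μ penultimate k + (p + p))
          e≥0 k le = p≤q⇒0≤q-p (subst (λ d → μ penultimate k + d ≤ ν) (sym p+p≡δ) le)
          below-penultimate : Eventually (λ k → μ penultimate k ≤ ν - p)
          below-penultimate = eventually-map (λ k le → ≤-from-difference ((ν - (μ penultimate k + (p + p))) + p)
            (solve 3 (λ n a p → n :- p :- a := (n :- (a :+ (p :+ p))) :+ p) refl ν (μ penultimate k) p)
            (+-nonNeg (e≥0 k le) (<⇒≤ 0<p))) below
          below-last : Eventually (λ k → μ last k ≤ ν - p)
          below-last = eventually-zip (λ k le lt → ≤-trans (<⇒≤ lt) (≤-from-difference (ν - (μ penultimate k + (p + p)))
            (solve 3 (λ n a p → n :- p :- (a :+ p) := n :- (a :+ (p :+ p))) refl ν (μ penultimate k) p)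
            (e≥0 k le))) below (sorted penultimate last penultimate≤last 0<p)

  -- Graphs with disconnected complement

  walk-++ : ∀ {V} {G : Graph V} {u v w k l} → Walk G u v k → Walk G v w l → Walk G u w (k ℕ.+ l)
  walk-++ []      q = q
  walk-++ (e ∷ p) q = e ∷ walk-++ p q

  Reachable : ∀ {V} → Graph V → V → V → Set
  Reachable G u v = ∃ (Walk G u v)

  reachable-trans : ∀ {V} {G : Graph V} {u v w} → Reachable G u v → Reachable G v w → Reachable G u w
  reachable-trans (_ , p) (_ , q) = _ , walk-++ p q

  reachable-sym : ∀ {V} {G : Graph V} {u v} → Reachable G u v → Reachable G v u
  reachable-sym (_ , [])              = _ , []
  reachable-sym {G = G} (_ , (e ∷ p)) = reachable-trans (reachable-sym (_ , p)) (_ , adj-sym G e ∷ [])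

  distance-unique : ∀ {V} {G : Graph V} {u v d d′} → IsDistance G u v d → IsDistance G u v d′ → d ≡ d′
  distance-unique (p , d-min) (p′ , d′-min) = ℕP.≤-antisym (d-min _ p′) (d′-min _ p)

  -- The double-negation shift, which holds because the index set is finite. It supplies a decision
  -- of reachability for all vertices at once when a contradiction is sought.
  ¬¬-∀ : ∀ {n} {P : Fin n → Set} → (∀ i → ¬ ¬ P i) → ¬ ¬ (∀ i → P i)
  ¬¬-∀ {zero}  ¬¬p ¬all = ¬all λ ()
  ¬¬-∀ {suc n} ¬¬p ¬all = ¬¬p zero λ p₀ → ¬¬-∀ (¬¬p ∘ suc) λ ps → ¬all λ { zero → p₀ ; (suc i) → ps i }

  indicator : ∀ {A : Set} → Dec A → ℚ
  indicator (yes _) = 1ℚ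
  indicator (no _)  = 0ℚ

  indicator-yes : ∀ {A : Set} (A? : Dec A) → A → indicator A? ≡ 1ℚ
  indicator-yes (yes _) _ = refl
  indicator-yes (no ¬a) a = contradiction a ¬a

  indicator-no : ∀ {A : Set} (A? : Dec A) → ¬ A → indicator A? ≡ 0ℚ
  indicator-no (yes a) ¬a = contradiction a ¬a
  indicator-no (no _)  _  = refl

  indicator-cong : ∀ {A B : Set} (A? : Dec A) (B? : Dec B) → (A → B) → (B → A) → indicator A? ≡ indicator B?
  indicator-cong (yes a) B? f g = sym (indicator-yes B? (f a))
  indicator-cong (no ¬a) B? f g = sym (indicator-no B? (¬a ∘ g))

  0≤indicator : ∀ {A : Set} (A? : Dec A) → 0ℚ ≤ indicator A?
  0≤indicator (yes _) = 0≤1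
  0≤indicator (no _)  = ≤-refl

  indicator-idem : ∀ {A : Set} (A? : Dec A) → indicator A? * indicator A? ≡ indicator A?
  indicator-idem (yes _) = refl
  indicator-idem (no _)  = refl

  module DisconnectedComplement {m} (G : Graph (Fin (suc m))) (conn : Connected G) (disconnected : ¬ Connected (complement G)) where

    Ḡ : Graph (Fin (suc m))
    Ḡ = complement G

    -- Without a common neighbour, every other vertex would be a non-neighbour of `u` or of `v`. As
    -- `u` and `v` are adjacent in the complement, the complement would be connected.
    common-neighbour : ∀ {u v} → Adj Ḡ u v → ∃ λ w → Adj G u w × Adj G w v
    common-neighbour {u} {v} uv with any? (λ w → adj? G u w ×-dec adj? G w v)
    ... | yes common = common
    ... | no ¬common = contradiction (λ x y → reachable-trans (reachable-sym (from-u x)) (from-u y)) disconnected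
      where
      from-u : ∀ x → Reachable Ḡ u x
      from-u x with x ≟ᶠ u | x ≟ᶠ v
      ... | yes refl | _        = _ , []
      ... | no _     | yes refl = _ , uv ∷ []
      ... | no x≢u   | no x≢v with adj? G u x
      ... | yes ux = _ , (uv ∷ (((x≢v ∘ sym) , λ vx → ¬common (x , ux , adj-sym G vx)) ∷ []))
      ... | no ¬ux = _ , (((x≢u ∘ sym) , ¬ux) ∷ [])

    c : Matrix ℚ (suc m)
    c u v = indicator (adj? Ḡ u v)

    c-sym : ∀ u v → c u v ≡ c v u
    c-sym u v = indicator-cong (adj? Ḡ u v) (adj? Ḡ v u) (adj-sym Ḡ) (adj-sym Ḡ)

    c-irrefl : ∀ u → c u u ≡ 0ℚ
    c-irrefl u = indicator-no (adj? Ḡ u u) (irrefl Ḡ)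

    0≤c : ∀ u v → 0ℚ ≤ c u v
    0≤c u v = 0≤indicator (adj? Ḡ u v)

    open CoLaplacian c c-sym c-irrefl

    distance≡ : ∀ {u v k} → IsDistance G u v k → ∀ {e a} → I u v ≡ e → c u v ≡ a → ι (ℤ.+ k) ≡ 1ℚ - e + a →
      ι (ℤ.+ distance G conn u v) ≡ 1ℚ - I u v + c u v
    distance≡ {u} {v} isDistance I≡e c≡a eq = trans
      (cong (λ d → ι (ℤ.+ d)) (distance-unique (proj₂ (distance∃ G conn u v)) isDistance))
      (trans eq (cong₂ (λ e a → 1ℚ - e + a) (sym I≡e) (sym c≡a)))

    ι-distance : ∀ u v → ι (ℤ.+ distance G conn u v) ≡ 1ℚ - I u v + c u v
    ι-distance u v = cases (u ≟ᶠ v) (adj? G u v)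
      where
      at-least-1 : u ≢ v → ∀ k → Walk G u v k → 1 ℕ.≤ k
      at-least-1 u≢v _ []      = contradiction refl u≢v
      at-least-1 u≢v _ (_ ∷ _) = s≤s z≤n
      at-least-2 : u ≢ v → ¬ Adj G u v → ∀ k → Walk G u v k → 2 ℕ.≤ k
      at-least-2 u≢v ¬uv _ []          = contradiction refl u≢v
      at-least-2 u≢v ¬uv _ (uv ∷ [])   = contradiction uv ¬uv
      at-least-2 u≢v ¬uv _ (_ ∷ (_ ∷ _)) = s≤s (s≤s z≤n)
      walk₂ : (∃ λ w → Adj G u w × Adj G w v) → Walk G u v 2
      walk₂ (_ , uw , wv) = uw ∷ (wv ∷ [])
      cases : Dec (u ≡ v) → Dec (Adj G u v) → ι (ℤ.+ distance G conn u v) ≡ 1ℚ - I u v + c u v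
      cases (yes refl) _ = distance≡ ([] , λ _ _ → z≤n) (diag-≡ (λ _ → 1ℚ) u) (c-irrefl u) refl
      cases (no u≢v) (yes uv) = distance≡ (uv ∷ [] , at-least-1 u≢v) (diag-≢ (λ _ → 1ℚ) u≢v)
        (indicator-no (adj? Ḡ u v) λ (_ , ¬uv) → ¬uv uv) refl
      cases (no u≢v) (no ¬uv) = distance≡ (walk₂ (common-neighbour (u≢v , ¬uv)) , at-least-2 u≢v ¬uv) (diag-≢ (λ _ → 1ℚ) u≢v)
        (indicator-yes (adj? Ḡ u v) (u≢v , ¬uv)) refl

    ι-ℕ-sum : ∀ {n} (f : Vector ℕ n) → ι (ℤ.+ Vector.foldr ℕ._+_ 0 f) ≡ sum (λ i → ι (ℤ.+ f i))
    ι-ℕ-sum {zero}  f = refl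
    ι-ℕ-sum {suc n} f = trans (ι-+ (ℤ.+ f zero) (ℤ.+ Vector.foldr ℕ._+_ 0 (f ∘ suc))) (cong (ι (ℤ.+ f zero) +_) (ι-ℕ-sum (f ∘ suc)))

    ι-transmission : ∀ v → ι (ℤ.+ transmission G conn v) ≡ ν - 1ℚ + d v
    ι-transmission v = begin
      ι (ℤ.+ transmission G conn v)                       ≡⟨ ι-ℕ-sum (λ u → distance G conn u v) ⟩
      sum (λ u → ι (ℤ.+ distance G conn u v))             ≡⟨ sum-cong (λ u → ι-distance u v) ⟩
      sum (λ u → 1ℚ - I u v + c u v)                      ≡⟨ ∑-distrib-+ (λ u → 1ℚ - I u v) (λ u → c u v) ⟩
      sum (λ u → 1ℚ - I u v) + sum (λ u → c u v)          ≡⟨ cong₂ _+_ ones-minus (sum-cong λ u → c-sym u v) ⟩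
      ν - 1ℚ + d v                                        ∎
      where
      open ≡-Reasoning
      ones-minus : sum (λ u → 1ℚ - I u v) ≡ ν - 1ℚ
      ones-minus = trans
        (sum-linear 1ℚ (- 1ℚ) {g = λ _ → 1ℚ} {λ u → 1ℚ * I u v} λ u → solve 1 (λ e → con 1ℚ :- e := con 1ℚ :* con 1ℚ :+ (:- con 1ℚ) :* (con 1ℚ :* e)) refl (I u v))
        (trans (cong (λ s → 1ℚ * ν + - 1ℚ * s) (sum-*I (λ _ → 1ℚ) v)) (solve 1 (λ n → con 1ℚ :* n :+ (:- con 1ℚ) :* con 1ℚ := n :- con 1ℚ) refl ν))

    ι-distanceLaplacian : ∀ u v → ι (distanceLaplacian G conn u v) ≡ DL u v
    ι-distanceLaplacian u v = begin
      ι (diag (ℤ.+ 0) (λ w → ℤ.+ transmission G conn w) u v ℤ.- ℤ.+ distance G conn u v)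
        ≡⟨ trans (ι-+ (diag (ℤ.+ 0) (λ w → ℤ.+ transmission G conn w) u v) (ℤ.- ℤ.+ distance G conn u v)) (cong₂ _+_ (ι-diag u v) (ι-neg (ℤ.+ distance G conn u v))) ⟩
      (ν - 1ℚ + d u) * I u v + - ι (ℤ.+ distance G conn u v)
        ≡⟨ cong (λ e → (ν - 1ℚ + d u) * I u v + - e) (ι-distance u v) ⟩
      (ν - 1ℚ + d u) * I u v + - (1ℚ - I u v + c u v)
        ≡⟨ solve 4 (λ n d e c → let one = con 1ℚ in (n :- one :+ d) :* e :+ :- (one :- e :+ c) := (n :+ d) :* e :- (one :+ c)) refl ν (d u) (I u v) (c u v) ⟩
      DL u v ∎
      where
      open ≡-Reasoning
      ι-diag : ∀ u v → ι (diag (ℤ.+ 0) (λ w → ℤ.+ transmission G conn w) u v) ≡ (ν - 1ℚ + d u) * I u v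
      ι-diag u v with u ≟ᶠ v
      ... | yes refl = trans (ι-transmission u) (sym (*-identityʳ _))
      ... | no _     = sym (*-zeroʳ (ν - 1ℚ + d u))

    0<ν : 0ℚ < ν
    0<ν = +-mono-<-≤ 0<1 (sum-nonNeg {m} λ _ → 0≤1)

    -- The eigenvector for ν is constant on the component S of u and on its
    -- complement: ν χ_S − |S|.
    det-pencil-at-ν≡0 : Det (pencil DL ν) ≡ 0ℚ
    -- Disconnectedness is a mere negation and yields no pair of separated vertices. Equality of
    -- rationals is stable, so such a pair and a decision of its component may be assumed while
    -- refuting the opposite.
    det-pencil-at-ν≡0 = decidable-stable (Det (pencil DL ν) ≟ 0ℚ) λ F≢0 →
      ¬¬-∀ (λ u → ¬¬-∀ λ v ¬uv → ¬¬-∀ (λ w → ¬¬-excluded-middle) λ reach? → F≢0 (from-component u v ¬uv reach?)) disconnected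
      where
      from-component : ∀ u v → ¬ Reachable Ḡ u v → (∀ w → Dec (Reachable Ḡ u w)) → Det (pencil DL ν) ≡ 0ℚ
      from-component u v ¬uv reach? = *-cancelˡ-≡0
        where
        χ z : Vector ℚ (suc m)
        χ w = indicator (reach? w)
        z w = ν * χ w + - sum χ * 1ℚ
        F : ℚ
        F = Det (pencil DL ν)
        χ-invariant : ∀ i j → Adj Ḡ i j → χ i ≡ χ j
        χ-invariant i j ij = indicator-cong (reach? i) (reach? j)
          (λ ui → reachable-trans ui (_ , ij ∷ [])) (λ uj → reachable-trans uj (_ , adj-sym Ḡ ij ∷ []))
        invariant : ∀ i j → c i j * z i ≡ c i j * z j
        invariant i j with adj? Ḡ i j
        ... | yes ij = cong (λ x → 1ℚ * (ν * x + - sum χ * 1ℚ)) (χ-invariant i j ij)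
        ... | no _   = trans (*-zeroˡ (z i)) (sym (*-zeroˡ (z j)))
        sum-z : sum z ≡ 0ℚ
        sum-z = trans (sum-linear ν (- sum χ) {g = χ} {λ _ → 1ℚ} λ _ → refl)
          (solve 2 (λ n s → n :* s :+ (:- s) :* n := con 0ℚ) refl ν (sum χ))
        -- `z u − z v` is `ν`, because `u` lies in the component and `v` does not.
        νF≡0 : ν * F ≡ 0ℚ
        νF≡0 = begin
          ν * F                                                             ≡⟨ solve 3 (λ n s f → let one = con 1ℚ; nil = con 0ℚ in
                                                                                 n :* f := (n :* one :+ (:- s) :* one) :* f :- (n :* nil :+ (:- s) :* one) :* f) refl ν (sum χ) F ⟩
          (ν * 1ℚ + - sum χ * 1ℚ) * F - (ν * 0ℚ + - sum χ * 1ℚ) * F         ≡⟨ cong₂ (λ a b → (ν * a + - sum χ * 1ℚ) * F - (ν * b + - sum χ * 1ℚ) * F)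
                                                                                 (indicator-yes (reach? u) (_ , [])) (indicator-no (reach? v) ¬uv) ⟨
          z u * F - z v * F                                                 ≡⟨ cong₂ _-_ (det-pencil-at-ν z invariant sum-z u) (det-pencil-at-ν z invariant sum-z v) ⟩
          0ℚ - 0ℚ                                                           ≡⟨⟩
          0ℚ                                                                ∎
          where open ≡-Reasoning
        *-cancelˡ-≡0 : F ≡ 0ℚ
        *-cancelˡ-≡0 = ≤-antisym (cancel (≤-reflexive νF≡ν0)) (cancel (≤-reflexive (sym νF≡ν0)))
          where
          νF≡ν0 : ν * F ≡ ν * 0ℚ
          νF≡ν0 = trans νF≡0 (sym (*-zeroʳ ν))
          cancel : ∀ {p q} → ν * p ≤ ν * q → p ≤ q
          cancel = *-cancelˡ-≤-pos ν {{positive 0<ν}}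

    -- If the complement had no edge, a proper colouring would be injective and `χ` would be at
    -- least the number of vertices.
    complement-edge : ∀ χ → IsChromaticNumber G χ → χ ℕ.≤ m → ∃ λ u → ∃ λ v → Adj Ḡ u v
    complement-edge χ ((colour , proper) , _) χ≤m with any? (λ u → any? λ v → adj? Ḡ u v)
    ... | yes edge = edge
    ... | no ¬edge = contradiction (ℕP.≤-trans (FinP.injective⇒≤ injective) χ≤m) ℕP.1+n≰n
      where
      injective : ∀ {u v} → colour u ≡ colour v → u ≡ v
      injective {u} {v} eq with u ≟ᶠ v
      ... | yes u≡v = u≡v
      ... | no u≢v with adj? G u v
      ... | yes uv = contradiction eq (proper u v uv)
      ... | no ¬uv = contradiction (u , v , u≢v , ¬uv) ¬edge

  -- From bounds on two eigenvalues to bounds on their difference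

  quarter : ∀ {ε} → 0ℚ < ε → Σ[ h ∈ ℚ ] (0ℚ < h × h + h + (h + h) ≡ ε)
  quarter 0<ε with halve 0<ε
  ... | e , 0<e , refl with halve 0<e
  ... | h , 0<h , refl = h , 0<h , refl

  module _ {t q : ℚ} {s x y : ℝ} (s≈x-y : s ≈ᴿ x -ᴿ y) where

    private
      identity-≥ : ∀ t s x y h → s + (h + h + (h + h)) - t ≡ (x + h - (q + t)) + (q + h - y) + (s + h - (x - y)) + h
      identity-≥ t s x y h = solve 6 (λ q t s x y h → s :+ (h :+ h :+ (h :+ h)) :- t := (x :+ h :- (q :+ t)) :+ (q :+ h :- y) :+ (s :+ h :- (x :- y)) :+ h)
        refl q t s x y h

      identity-≤ : ∀ t s x y h → t + (h + h + (h + h)) - s ≡ (q + t + h - x) + (y + h - q) + (x - y + h - s) + h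
      identity-≤ t s x y h = solve 6 (λ q t s x y h → t :+ (h :+ h :+ (h :+ h)) :- s := (q :+ t :+ h :- x) :+ (y :+ h :- q) :+ (x :- y :+ h :- s) :+ h)
        refl q t s x y h

      at-≥ : ∀ {s x y h} → 0ℚ < h → q + t < x + h → y < q + h → ∣ s - (x - y) ∣ < h → t < s + (h + h + (h + h))
      at-≥ {s} {x} {y} {h} 0<h x> y< close = <-from-difference _ (identity-≥ t s x y h)
        (+-pos (+-pos (+-pos (p<q⇒0<q-p x>) (p<q⇒0<q-p y<)) (p<q⇒0<q-p (∣-∣<⇒> s (x - y) close))) 0<h)

      at-≤ : ∀ {s x y h} → 0ℚ < h → x < q + t + h → q < y + h → ∣ s - (x - y) ∣ < h → s < t + (h + h + (h + h))
      at-≤ {s} {x} {y} {h} 0<h x< y> close = <-from-difference _ (identity-≤ t s x y h)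
        (+-pos (+-pos (+-pos (p<q⇒0<q-p x<) (p<q⇒0<q-p y>)) (p<q⇒0<q-p (∣-∣<⇒< s (x - y) close))) 0<h)

    -- Three quarters of ε pay for the two eigenvalue bounds and for the approximation of `s` by
    -- `x − y`; the fourth is slack.
    difference-≥ : fromℚ (q + t) ≤ᴿ x → y ≤ᴿ fromℚ q → fromℚ t ≤ᴿ s
    difference-≥ q+t≤x y≤q = mk≤ λ ε 0<ε → bound (quarter 0<ε)
      where
      bound : ∀ {ε} → Σ[ h ∈ ℚ ] (0ℚ < h × h + h + (h + h) ≡ ε) → Eventually (λ k → t < seq s k + ε)
      bound (h , 0<h , refl) = eventually-zip (λ k (x> , y<) close → at-≥ {seq s k} {seq x k} {seq y k} {h} 0<h x> y< close)
        (eventually-zip {P = λ k → q + t < seq x k + h} {λ k → seq y k < q + h} (λ k → _,_) (eventually≤ q+t≤x h 0<h) (eventually≤ y≤q h 0<h))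
        (eventually≈ s≈x-y h 0<h)

    difference-≤ : x ≤ᴿ fromℚ (q + t) → fromℚ q ≤ᴿ y → s ≤ᴿ fromℚ t
    difference-≤ x≤q+t q≤y = mk≤ λ ε 0<ε → bound (quarter 0<ε)
      where
      bound : ∀ {ε} → Σ[ h ∈ ℚ ] (0ℚ < h × h + h + (h + h) ≡ ε) → Eventually (λ k → seq s k < t + ε)
      bound (h , 0<h , refl) = eventually-zip (λ k (x< , y>) close → at-≤ {seq s k} {seq x k} {seq y k} {h} 0<h x< y> close)
        (eventually-zip {P = λ k → seq x k < q + t + h} {λ k → q < seq y k + h} (λ k → _,_) (eventually≤ x≤q+t h 0<h) (eventually≤ q≤y h 0<h))
        (eventually≈ s≈x-y h 0<h)

  ≤ᴿ-antisym : ∀ {x y} → x ≤ᴿ y → y ≤ᴿ x → x ≈ᴿ y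
  ≤ᴿ-antisym {x} {y} x≤y y≤x = mk≈ λ ε 0<ε → eventually-zip
    (λ k x< y< → ∣p∣<q
      (subst₂ _<_ refl (solve 2 (λ y e → y :+ e :- y := e) refl (seq y k) ε) (+-monoˡ-< (- seq y k) x<))
      (subst₂ _<_ (solve 2 (λ x y → y :- x := :- (x :- y)) refl (seq x k) (seq y k)) (solve 2 (λ y e → y :+ e :- y := e) refl (seq x k) ε) (+-monoˡ-< (- seq x k) y<)))
    (eventually≤ x≤y ε 0<ε) (eventually≤ y≤x ε 0<ε)

  ≤ᴿ-strict : ∀ {p q s} → p < q → fromℚ q ≤ᴿ s → ¬ s ≈ᴿ fromℚ p
  ≤ᴿ-strict {p} {q} {s} p<q q≤s s≈p = from-half (halve (p<q⇒0<q-p p<q))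
    where
    from-half : Σ[ h ∈ ℚ ] (0ℚ < h × h + h ≡ q - p) → ⊥
    from-half (h , 0<h , h+h≡q-p) = proj₂ (eventually-witness (eventually-zip clash (eventually≤ q≤s h 0<h) (eventually≈ s≈p h 0<h)))
      where
      open ≤-Reasoning
      clash : ∀ k → q < seq s k + h → ∣ seq s k - p ∣ < h → ⊥
      clash k q< close = <-irrefl refl (begin-strict
        q                  <⟨ q< ⟩
        seq s k + h        <⟨ +-monoˡ-< h (∣-∣<⇒< (seq s k) p close) ⟩
        p + h + h          ≡⟨ trans (+-assoc p h h) (trans (cong (p +_) h+h≡q-p) (solve 2 (λ p q → p :+ (q :- p) := q) refl p q)) ⟩
        q                  ∎)

  -- Bounds on the largest and the penultimate eigenvalue

  module SpectralBounds {m} (G : Graph (Fin (suc (suc m)))) (conn : Connected G) (disconnected : ¬ Connected (complement G))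
    (∂ : Vector ℝ (suc (suc m))) (spectrum : IsSpectrum (distanceLaplacian G conn) ∂) where

    open DisconnectedComplement G conn disconnected public
    open CoLaplacian c c-sym c-irrefl public
    open Spectrum (distanceLaplacian G conn) DL ι-distanceLaplacian ∂ spectrum
    open Roots (λ x → Det (pencil DL x)) (λ i k → seq (∂ i) k) sorted factorised using (positive-above-largest; penultimate; penultimate≤ν) renaming (module Matching to MatchingRoots)

    -- If the largest eigenvalue stayed `2p` below `ν + t`, the determinant would be uniformly
    -- positive from `ν + t − p` on. That number would then bound all Rayleigh quotients, which the
    -- edge `uv` contradicts.
    largest≥ : ∀ t {u v} → Adj Ḡ u v → t + t ≤ d u + d v + 2ℚ → fromℚ (ν + t) ≤ᴿ ∂ zero
    largest≥ t {u} {v} uv 2t≤ = fromℚ-≤ᴿ (ν + t) (∂ zero) λ δ 0<δ below → from-half below (halve 0<δ)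
      where
      from-half : ∀ {δ} → Eventually (λ k → seq (∂ zero) k + δ ≤ ν + t) → Σ[ p ∈ ℚ ] (0ℚ < p × p + p ≡ δ) → ⊥
      from-half below (p , 0<p , refl) = from-positive (positive-above-largest {q = ν + t - p} 0<p (eventually-map shift below))
        where
        shift : ∀ k → seq (∂ zero) k + (p + p) ≤ ν + t → seq (∂ zero) k + p ≤ ν + t - p
        shift k le = subst (_≤ ν + t - p) (solve 2 (λ a p → a :+ (p :+ p) :- p := a :+ p) refl (seq (∂ zero) k) p) (+-monoˡ-≤ (- p) le)
        from-positive : Σ[ ρ ∈ ℚ ] (0ℚ < ρ × (∀ x → ν + t - p ≤ x → ρ ≤ Det (pencil DL x))) → ⊥
        from-positive (ρ , 0<ρ , ρ≤) = <-irrefl refl (begin-strict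
          t + t                                        ≤⟨ 2t≤ ⟩
          d u + d v + 2ℚ                               ≤⟨ rayleigh-at-edge {ν + t - p} (rayleigh DL-symmetric {ν + t - p} 0<ρ ρ≤) u v (indicator-yes (adj? Ḡ u v) uv) ⟩
          (ν + t - p - ν) + (ν + t - p - ν)            <⟨ <-from-difference (p + p) (solve 3 (λ n t p → (t :+ t) :- ((n :+ t :- p :- n) :+ (n :+ t :- p :- n)) := p :+ p) refl ν t p) (+-pos 0<p 0<p) ⟩
          t + t                                        ∎)
          where open ≤-Reasoning

    1≤d : ∀ {u v} → Adj Ḡ u v → 1ℚ ≤ d u
    1≤d {u} {v} uv = subst (_≤ d u) (indicator-yes (adj? Ḡ u v) uv) (c≤d 0≤c u v)

    2≤d : ∀ {u v w} → Adj Ḡ u v → Adj Ḡ u w → v ≢ w → 2ℚ ≤ d u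
    2≤d {u} {v} {w} uv uw v≢w = subst (_≤ d u)
      (cong₂ _+_ (indicator-yes (adj? Ḡ u v) uv) (indicator-yes (adj? Ḡ u w) uw)) (c+c≤d 0≤c u v w v≢w)

    largest≥ν+2 : ∀ {u v} → Adj Ḡ u v → fromℚ (ν + 2ℚ) ≤ᴿ ∂ zero
    largest≥ν+2 uv = largest≥ 2ℚ uv (+-monoˡ-≤ 2ℚ (+-mono-≤ (1≤d uv) (1≤d (adj-sym Ḡ uv))))

    5/2 : ℚ
    5/2 = 2ℚ + ½

    largest≥ν+5/2 : ∀ {u v w} → Adj Ḡ u v → Adj Ḡ u w → v ≢ w → fromℚ (ν + 5/2) ≤ᴿ ∂ zero
    largest≥ν+5/2 uv uw v≢w = largest≥ 5/2 uv (+-monoˡ-≤ 2ℚ (+-mono-≤ (2≤d uv uw v≢w) (1≤d (adj-sym Ḡ uv))))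

    penultimate-≤ν : ∂ penultimate ≤ᴿ fromℚ ν
    penultimate-≤ν = ≤ᴿ-fromℚ ν (∂ penultimate) λ δ 0<δ → penultimate≤ν 0<ν det-pencil-at-0 det-pencil-at-ν≡0 0<δ

    module _ (4≤ν : 2ℚ + 2ℚ ≤ ν) (matching : ∀ u v w → Adj Ḡ u v → Adj Ḡ u w → v ≡ w) where

      c-matching : ∀ u v w → v ≢ w → c u v * c u w ≡ 0ℚ
      c-matching u v w v≢w = cases (adj? Ḡ u v) (adj? Ḡ u w)
        where
        cases : Dec (Adj Ḡ u v) → Dec (Adj Ḡ u w) → c u v * c u w ≡ 0ℚ
        cases (yes uv) (yes uw) = contradiction (matching u v w uv uw) v≢w
        cases (no ¬uv) _        = trans (cong (_* c u w) (indicator-no (adj? Ḡ u v) ¬uv)) (*-zeroˡ (c u w))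
        cases (yes _)  (no ¬uw) = trans (cong (c u v *_) (indicator-no (adj? Ḡ u w) ¬uw)) (*-zeroʳ (c u v))

      open CoLaplacian.Matching c c-sym c-irrefl (λ u v → indicator-idem (adj? Ḡ u v)) c-matching using (cofactor; det-pencil-matching)

      cofactor-bounded : ∀ R → 0ℚ ≤ R → Σ[ B ∈ ℚ ] (0ℚ ≤ B × (∀ y → ∣ y ∣ ≤ R → ∣ Det (cofactor y) ∣ ≤ B))
      cofactor-bounded R 0≤R = from-L (matrix-bounded L)
        where
        from-L : Σ[ l ∈ ℚ ] (0ℚ ≤ l × (∀ i j → ∣ L i j ∣ ≤ l)) → Σ[ B ∈ ℚ ] (0ℚ ≤ B × (∀ y → ∣ y ∣ ≤ R → ∣ Det (cofactor y) ∣ ≤ B))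
        from-L (l , 0≤l , L≤l) = det-bound (suc (suc m)) K , det-bound-nonNeg (suc (suc m)) 0≤K , λ y y≤R → ∣det∣≤det-bound (cofactor y) 0≤K λ i j →
          ≤-trans (∣p+q∣≤∣p∣+∣q∣ ((y - 2ℚ) * I i j) (L i j))
            (+-mono-≤ (subst (λ z → ∣ z ∣ ≤ R + 2ℚ) (diag-scalar (y - 2ℚ) i j)
              (≤-trans (∣diag∣≤ (y - 2ℚ) i j) (≤-trans (∣p-q∣≤∣p∣+∣q∣ y 2ℚ) (+-monoˡ-≤ 2ℚ y≤R)))) (L≤l i j))
          where
          K : ℚ
          K = R + 2ℚ + l
          0≤K : 0ℚ ≤ K
          0≤K = +-nonNeg (+-nonNeg 0≤R (nonNegative⁻¹ 2ℚ)) 0≤l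

      module MatchingBounds (R : ℚ) (0≤R : 0ℚ ≤ R) (bounded : Eventually (λ k → ∀ i → ∣ seq (∂ i) k ∣ ≤ R)) =
        MatchingRoots (suc (suc m)) (λ y → Det (cofactor y)) ν 4≤ν det-pencil-matching cofactor-bounded root R 0≤R bounded

      largest≤ : ∂ zero ≤ᴿ fromℚ (ν + 2ℚ)
      largest≤ = from-bound (eventually-bounded-all ∂)
        where
        from-bound : Σ[ R ∈ ℚ ] (0ℚ ≤ R × Eventually (λ k → ∀ i → ∣ seq (∂ i) k ∣ ≤ R)) → ∂ zero ≤ᴿ fromℚ (ν + 2ℚ)
        from-bound (R , 0≤R , bounded) = ≤ᴿ-fromℚ (ν + 2ℚ) (∂ zero) λ δ 0<δ → MatchingBounds.largest≤ν+2 R 0≤R bounded 0<δ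

      penultimate≥ : fromℚ ν ≤ᴿ ∂ penultimate
      penultimate≥ = from-bound (eventually-bounded-all ∂)
        where
        from-bound : Σ[ R ∈ ℚ ] (0ℚ ≤ R × Eventually (λ k → ∀ i → ∣ seq (∂ i) k ∣ ≤ R)) → fromℚ ν ≤ᴿ ∂ penultimate
        from-bound (R , 0≤R , bounded) = fromℚ-≤ᴿ ν (∂ penultimate) λ δ 0<δ → MatchingBounds.penultimate≥ν R 0≤R bounded 0<δ

  2<5/2 : 2ℚ < 2ℚ + ½
  2<5/2 = <-from-difference ½ refl (positive⁻¹ ½)

  4≤4+k : ∀ k → 2ℚ + 2ℚ ≤ sum {4 ℕ.+ k} (λ _ → 1ℚ)
  4≤4+k k = ≤-from-difference (sum {k} (λ _ → 1ℚ))
    (solve 1 (λ s → let one = con 1ℚ; two = one :+ one in (one :+ (one :+ (one :+ (one :+ s)))) :- (two :+ two) := s) refl (sum {k} (λ _ → 1ℚ)))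
    (sum-nonNeg {k} λ _ → 0≤1)

-- Complete multipartite graphs and complements of matchings

module CompleteMultipartite where

  open ≡ using (refl; sym; trans; cong; cong₂; subst; subst₂)

  induced : ∀ {V W} → (W → V) → Graph V → Graph W
  induced e G = record
    { Adj     = λ u v → Adj G (e u) (e v)
    ; adj?    = λ u v → adj? G (e u) (e v)
    ; adj-sym = adj-sym G
    ; irrefl  = irrefl G
    }

  module _ {V W} (G : Graph V) {l ls} (e₀ : Fin l → V) (e : W → V)
    (cover : ∀ x → (∃ λ s → e₀ s ≡ x) ⊎ (∃ λ k → e k ≡ x))
    (e₀-injective : ∀ {s t} → e₀ s ≡ e₀ t → s ≡ t) (e-injective : ∀ {j k} → e j ≡ e k → j ≡ k) (disjoint : ∀ {s k} → e₀ s ≢ e k)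
    (independent : ∀ s t → ¬ Adj G (e₀ s) (e₀ t)) (joined : ∀ s k → Adj G (e₀ s) (e k))
    (rest : induced e G ≅ completeMultipartite ls) where

    private
      module F = Inverse (proj₁ rest)
      Vertices = Σ[ i ∈ Fin (length (l List.∷ ls)) ] Fin (List.lookup (l List.∷ ls) i)

      -- Takes the evidence that `x` is covered as an argument, so that the inverse laws can be
      -- proved for arbitrary evidence by cases, without unfolding `cover`.
      to-part : ∀ {x} → (∃ λ s → e₀ s ≡ x) ⊎ (∃ λ k → e k ≡ x) → Vertices
      to-part (inj₁ (s , _)) = zero , s
      to-part (inj₂ (k , _)) = suc (proj₁ (F.to k)) , proj₂ (F.to k)

      from : Vertices → V
      from (zero , s)  = e₀ s
      from (suc i , s) = e (F.from (i , s))

      from-to-part : ∀ {x} p → from (to-part {x} p) ≡ x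
      from-to-part (inj₁ (s , eq)) = eq
      from-to-part (inj₂ (k , eq)) = trans (cong e (F.strictlyInverseʳ k)) eq

      to-part-from : ∀ y p → to-part {from y} p ≡ y
      to-part-from (zero , s)  (inj₁ (t , eq)) = cong (zero ,_) (e₀-injective eq)
      to-part-from (zero , s)  (inj₂ (k , eq)) = contradiction (sym eq) disjoint
      to-part-from (suc i , s) (inj₁ (t , eq)) = contradiction eq disjoint
      to-part-from (suc i , s) (inj₂ (k , eq)) = cong (λ y → suc (proj₁ y) , proj₂ y)
        (trans (cong F.to (e-injective eq)) (F.strictlyInverseˡ (i , s)))

      adjacency : ∀ y z → Adj G (from y) (from z) ⇔ (proj₁ y ≢ proj₁ z)
      adjacency (zero , s)  (zero , t)  = mk⇔ (λ st → contradiction st (independent s t)) (contradiction refl)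
      adjacency (zero , s)  (suc j , t) = mk⇔ (λ _ ()) (λ _ → joined s _)
      adjacency (suc i , s) (zero , t)  = mk⇔ (λ _ ()) (λ _ → adj-sym G (joined t _))
      adjacency (suc i , s) (suc j , t) = mk⇔
        (λ st i≡j → Equivalence.to E st (trans (cong proj₁ (F.strictlyInverseˡ (i , s))) (trans (suc-injective i≡j) (sym (cong proj₁ (F.strictlyInverseˡ (j , t)))))))
        (λ i≢j → Equivalence.from E λ eq → i≢j (cong suc (trans (sym (cong proj₁ (F.strictlyInverseˡ (i , s)))) (trans eq (cong proj₁ (F.strictlyInverseˡ (j , t)))))))
        where E = proj₂ rest (F.from (i , s)) (F.from (j , t))

    add-class : G ≅ completeMultipartite (l List.∷ ls)
    add-class = mk↔ₛ′ (λ x → to-part (cover x)) from (λ y → to-part-from y (cover (from y))) (λ x → from-to-part (cover x)) ,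
      λ x y → subst₂ (λ u v → Adj G u v ⇔ (proj₁ (to-part (cover x)) ≢ proj₁ (to-part (cover y))))
        (from-to-part (cover x)) (from-to-part (cover y)) (adjacency (to-part (cover x)) (to-part (cover y)))

  CocktailParty : ℕ → ℕ → List ℕ
  CocktailParty a b = replicate a 2 ++ replicate b 1

  -- The complement has maximum degree at most 1; phrased through `G` itself, it passes to induced
  -- subgraphs along injections.
  CoMatching : ∀ {V} → Graph V → Set
  CoMatching G = ∀ {u v w} → u ≢ v → ¬ Adj G u v → u ≢ w → ¬ Adj G u w → v ≡ w

  complete≅ : ∀ n (G : Graph (Fin n)) → (∀ {u v} → u ≢ v → Adj G u v) → G ≅ completeMultipartite (replicate n 1)
  complete≅ zero    G complete = mk↔ₛ′ (λ ()) (λ ()) (λ ()) (λ ()) , λ ()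
  complete≅ (suc n) G complete = add-class G (λ _ → zero) suc cover Fin1-unique suc-injective (λ ())
    (λ _ _ → irrefl G) (λ _ _ → complete λ ()) (complete≅ n (induced suc G) λ u≢v → complete (u≢v ∘ suc-injective))
    where
    Fin1-unique : ∀ {s t : Fin 1} {x y : Fin (suc n)} → x ≡ y → s ≡ t
    Fin1-unique {zero} {zero} _ = refl
    cover : ∀ x → (∃ λ (s : Fin 1) → zero ≡ x) ⊎ (∃ λ k → suc k ≡ x)
    cover zero    = inj₁ (zero , refl)
    cover (suc k) = inj₂ (k , refl)

  module _ {m} (G : Graph (Fin (suc (suc m)))) (matching : CoMatching G) {u v : Fin (suc (suc m))} (u≢v : u ≢ v) (¬uv : ¬ Adj G u v) where

    private
      v′ : Fin (suc m)
      v′ = punchOut u≢v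

      pair : Fin 2 → Fin (suc (suc m))
      pair zero       = u
      pair (suc zero) = v

    others : Fin m → Fin (suc (suc m))
    others k = punchIn u (punchIn v′ k)

    others-injective : ∀ {j k} → others j ≡ others k → j ≡ k
    others-injective eq = punchIn-injective v′ _ _ (punchIn-injective u _ _ eq)

    private
      u≢others : ∀ k → u ≢ others k
      u≢others k eq = punchInᵢ≢i u (punchIn v′ k) (sym eq)

      v≢others : ∀ k → v ≢ others k
      v≢others k eq = punchInᵢ≢i v′ k (punchIn-injective u _ _ (trans (sym eq) (sym (punchIn-punchOut u≢v))))

      pair-injective : ∀ {s t} → pair s ≡ pair t → s ≡ t
      pair-injective {zero}     {zero}     _  = refl
      pair-injective {zero}     {suc zero} eq = contradiction eq u≢v
      pair-injective {suc zero} {zero}     eq = contradiction (sym eq) u≢v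
      pair-injective {suc zero} {suc zero} _  = refl

      disjoint : ∀ {s k} → pair s ≢ others k
      disjoint {zero}     = u≢others _
      disjoint {suc zero} = v≢others _

      cover : ∀ x → (∃ λ s → pair s ≡ x) ⊎ (∃ λ k → others k ≡ x)
      cover x with u ≟ᶠ x
      ... | yes u≡x = inj₁ (zero , u≡x)
      ... | no u≢x with v′ ≟ᶠ punchOut u≢x
      ... | yes eq = inj₁ (suc zero , trans (sym (punchIn-punchOut u≢v)) (trans (cong (punchIn u) eq) (punchIn-punchOut u≢x)))
      ... | no v′≢ = inj₂ (punchOut v′≢ , trans (cong (punchIn u) (punchIn-punchOut v′≢)) (punchIn-punchOut u≢x))

      independent : ∀ s t → ¬ Adj G (pair s) (pair t)
      independent zero       zero       = irrefl G
      independent zero       (suc zero) = ¬uv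
      independent (suc zero) zero       = ¬uv ∘ adj-sym G
      independent (suc zero) (suc zero) = irrefl G

      joined : ∀ s k → Adj G (pair s) (others k)
      joined zero       k = decidable-stable (adj? G _ _) λ ¬uk → v≢others k (matching u≢v ¬uv (u≢others k) ¬uk)
      joined (suc zero) k = decidable-stable (adj? G _ _) λ ¬vk → u≢others k (matching (u≢v ∘ sym) (¬uv ∘ adj-sym G) (v≢others k) ¬vk)

    remove-pair : ∀ {ls} → induced others G ≅ completeMultipartite ls → G ≅ completeMultipartite (2 List.∷ ls)
    remove-pair = add-class G pair others cover pair-injective others-injective disjoint independent joined

  -- Two nonadjacent vertices have no further non-neighbours, so they form a class of size 2 joined
  -- to all other vertices, which inherit the hypothesis. Once no such pair is left the graph is
  -- complete.
  coMatching⇒≅ : ∀ n (G : Graph (Fin n)) → CoMatching G → ∃₂ λ a b → a ℕ.+ (a ℕ.+ b) ≡ n × G ≅ completeMultipartite (CocktailParty a b)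
  coMatching⇒≅ n G matching with any? (λ u → any? λ v → adj? (complement G) u v)
  ... | no ¬pair = 0 , n , refl , complete≅ n G λ {u} {v} u≢v → decidable-stable (adj? G u v) λ ¬uv → ¬pair (u , v , u≢v , ¬uv)
  coMatching⇒≅ (suc zero) G matching | yes (zero , zero , u≢v , _) = contradiction refl u≢v
  coMatching⇒≅ (suc (suc m)) G matching | yes (u , v , u≢v , ¬uv)
    with coMatching⇒≅ m (induced (others G matching u≢v ¬uv) G)
           (λ x≢y ¬xy x≢z ¬xz → others-injective G matching u≢v ¬uv
             (matching (x≢y ∘ others-injective G matching u≢v ¬uv) ¬xy (x≢z ∘ others-injective G matching u≢v ¬uv) ¬xz))
  ... | a , b , eq , iso = suc a , b , cong suc (trans (ℕP.+-suc a (a ℕ.+ b)) (cong suc eq)) , remove-pair G matching u≢v ¬uv iso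

  cocktailParty-representative : ∀ a b i → Fin (List.lookup (CocktailParty a b) i)
  cocktailParty-representative (suc a) b       zero    = zero
  cocktailParty-representative (suc a) b       (suc i) = cocktailParty-representative a b i
  cocktailParty-representative zero    (suc b) zero    = zero
  cocktailParty-representative zero    (suc b) (suc i) = cocktailParty-representative zero b i

  cocktailParty-class-size : ∀ a b i {s t r : Fin (List.lookup (CocktailParty a b) i)} → s ≢ t → s ≢ r → t ≡ r
  cocktailParty-class-size (suc a) b       zero    {zero}     {zero}     s≢t s≢r = contradiction refl s≢t
  cocktailParty-class-size (suc a) b       zero    {zero}     {suc zero} {zero}     s≢t s≢r = contradiction refl s≢r
  cocktailParty-class-size (suc a) b       zero    {zero}     {suc zero} {suc zero} s≢t s≢r = refl
  cocktailParty-class-size (suc a) b       zero    {suc zero} {suc zero} s≢t s≢r = contradiction refl s≢t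
  cocktailParty-class-size (suc a) b       zero    {suc zero} {zero} {suc zero} s≢t s≢r = contradiction refl s≢r
  cocktailParty-class-size (suc a) b       zero    {suc zero} {zero} {zero} s≢t s≢r = refl
  cocktailParty-class-size (suc a) b       (suc i) s≢t s≢r = cocktailParty-class-size a b i s≢t s≢r
  cocktailParty-class-size zero    (suc b) zero    {zero}     {zero}     s≢t s≢r = contradiction refl s≢t
  cocktailParty-class-size zero    (suc b) (suc i) s≢t s≢r = cocktailParty-class-size zero b i s≢t s≢r

  length-cocktailParty : ∀ a b → length (CocktailParty a b) ≡ a ℕ.+ b
  length-cocktailParty a b = trans (ListP.length-++ (replicate a 2)) (cong₂ ℕ._+_ (ListP.length-replicate a) (ListP.length-replicate b))

  module _ {n} (G : Graph (Fin n)) (a b : ℕ) (iso : G ≅ completeMultipartite (CocktailParty a b)) where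

    private
      module F = Inverse (proj₁ iso)
      module Edge u v = Equivalence (proj₂ iso u v)

    ≅⇒coMatching : CoMatching G
    ≅⇒coMatching {u} {v} {w} u≢v ¬uv u≢w ¬uw = to-injective (same-class
        (decidable-stable (proj₁ (F.to u) ≟ᶠ proj₁ (F.to v)) (¬uv ∘ Edge.from u v))
        (decidable-stable (proj₁ (F.to u) ≟ᶠ proj₁ (F.to w)) (¬uw ∘ Edge.from u w))
        (u≢v ∘ to-injective) (u≢w ∘ to-injective))
      where
      to-injective : ∀ {x y} → F.to x ≡ F.to y → x ≡ y
      to-injective {x} {y} eq = trans (sym (F.strictlyInverseʳ x)) (trans (cong F.from eq) (F.strictlyInverseʳ y))
      same-class : ∀ {x y z : Σ[ i ∈ Fin (length (CocktailParty a b)) ] Fin (List.lookup (CocktailParty a b) i)} →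
        proj₁ x ≡ proj₁ y → proj₁ x ≡ proj₁ z → x ≢ y → x ≢ z → y ≡ z
      same-class {i , s} {_ , t} {_ , r} refl refl x≢y x≢z =
        cong (i ,_) (cocktailParty-class-size a b i (x≢y ∘ cong (i ,_)) (x≢z ∘ cong (i ,_)))

    -- The classes are the colours of a proper colouring, and one representative from each class
    -- gives a clique of the same size.
    chromaticNumber≡ : ∀ {χ} → IsChromaticNumber G χ → χ ≡ a ℕ.+ b
    chromaticNumber≡ {χ} ((colour , proper) , minimal) = trans
      (ℕP.≤-antisym
        (minimal _ ((λ x → proj₁ (F.to x)) , λ u v → Edge.to u v))
        (FinP.injective⇒≤ {f = λ i → colour (representative i)} λ {i} {j} eq →
          decidable-stable (i ≟ᶠ j) λ i≢j → proper (representative i) (representative j) (Edge.from (representative i) (representative j) λ same →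
            i≢j (trans (sym (cong proj₁ (F.strictlyInverseˡ _))) (trans same (cong proj₁ (F.strictlyInverseˡ _))))) eq))
      (length-cocktailParty a b)
      where
      representative : Fin (length (CocktailParty a b)) → Fin n
      representative i = F.from (i , cocktailParty-representative a b i)

  -- With `a` pairs and `b` singletons, n = 2a + b and χ = a + b, which solves to a = n - χ and b =
  -- 2χ - n.
  coMatching⇒≅χ : ∀ {n} (G : Graph (Fin n)) {χ} → IsChromaticNumber G χ → CoMatching G →
    G ≅ completeMultipartite (CocktailParty (n ℕ.∸ χ) (2 ℕ.* χ ℕ.∸ n))
  coMatching⇒≅χ {n} G {χ} chromatic matching with coMatching⇒≅ n G matching
  ... | a , b , refl , iso with chromaticNumber≡ G a b iso chromatic
  ... | refl = subst₂ (λ a′ b′ → G ≅ completeMultipartite (CocktailParty a′ b′)) (sym pairs) (sym singles) iso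
    where
    open Data.Nat.Solver.+-*-Solver
    pairs : a ℕ.+ (a ℕ.+ b) ℕ.∸ (a ℕ.+ b) ≡ a
    pairs = ℕP.m+n∸n≡m a (a ℕ.+ b)
    singles : 2 ℕ.* (a ℕ.+ b) ℕ.∸ (a ℕ.+ (a ℕ.+ b)) ≡ b
    singles = trans (cong (ℕ._∸ (a ℕ.+ (a ℕ.+ b))) (solve 2 (λ a b → con 2 :* (a :+ b) := b :+ (a :+ (a :+ b))) refl a b))
      (ℕP.m+n∸n≡m b (a ℕ.+ (a ℕ.+ b)))

-- The lower bound on the spread and its equality case

open import Data.Fin using (Fin)
open import Data.Integer using (+_)
open import Data.List using (replicate; _++_)
open import Data.Nat using (ℕ; _≤_; _*_; _∸_; z≤n; s≤s)
open import Data.Nat.Properties using (≤-trans)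
open import Data.Product using (_×_)
open import Function.Bundles using (_⇔_)
open import Relation.Nullary using (¬_)

theorem4p9 : (n : ℕ) (4≤n : 4 ≤ n) (G : Graph (Fin n)) (conn : Connected G)
    (χ : ℕ) → IsChromaticNumber G χ → n ≤ 2 * χ → χ ≤ n ∸ 1 →
    ¬ Connected (complement G) →
    (DLS : ℝ) → IsDLS G conn (≤-trans (s≤s (s≤s z≤n)) 4≤n) DLS →
    (fromℤ (+ 2) ≤ᴿ DLS) ×
    (DLS ≈ᴿ fromℤ (+ 2) ⇔ G ≅ completeMultipartite (replicate (n ∸ χ) 2 ++ replicate (2 * χ ∸ n) 1))
theorem4p9 (suc (suc (suc (suc k)))) (s≤s (s≤s (s≤s (s≤s _)))) G conn χ chromatic _ χ≤n-1 disconnected DLS (∂ , spectrum , DLS≈spread) =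
  2≤DLS , mk⇔ equality⇒≅ ≅⇒equality
  where
  open DistanceLaplacian
  open CompleteMultipartite
  open SpectralBounds G conn disconnected ∂ spectrum

  2≤DLS : fromℤ (+ 2) ≤ᴿ DLS
  2≤DLS = difference-≥ {t = 2ℚ} {ν} DLS≈spread (largest≥ν+2 (proj₂ (proj₂ (complement-edge χ chromatic χ≤n-1)))) penultimate-≤ν

  equality⇒≅ : DLS ≈ᴿ fromℤ (+ 2) → G ≅ completeMultipartite (replicate (4 ℕ.+ k ∸ χ) 2 ++ replicate (2 * χ ∸ (4 ℕ.+ k)) 1)
  equality⇒≅ DLS≈2 = coMatching⇒≅χ G chromatic λ {u} {v} {w} u≢v ¬uv u≢w ¬uw → decidable-stable (v ≟ᶠ w) λ v≢w →
    ≤ᴿ-strict {2ℚ} {5/2} 2<5/2 (difference-≥ {t = 5/2} {ν} DLS≈spread (largest≥ν+5/2 (u≢v , ¬uv) (u≢w , ¬uw) v≢w) penultimate-≤ν) DLS≈2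

  ≅⇒equality : G ≅ completeMultipartite (replicate (4 ℕ.+ k ∸ χ) 2 ++ replicate (2 * χ ∸ (4 ℕ.+ k)) 1) → DLS ≈ᴿ fromℤ (+ 2)
  ≅⇒equality iso = ≤ᴿ-antisym (difference-≤ {t = 2ℚ} {ν} DLS≈spread (largest≤ 4≤ν matching) (penultimate≥ 4≤ν matching)) 2≤DLS
    where
    matching : ∀ u v w → Adj Ḡ u v → Adj Ḡ u w → v ≡ w
    matching u v w (u≢v , ¬uv) (u≢w , ¬uw) = ≅⇒coMatching G (4 ℕ.+ k ∸ χ) (2 * χ ∸ (4 ℕ.+ k)) iso u≢v ¬uv u≢w ¬uw
    4≤ν : 2ℚ Data.Rational.+ 2ℚ Data.Rational.≤ ν
    4≤ν = 4≤4+k k
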